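{- For all integers $n$ and $m$ with $m>n\geq 2$, $$\frac{3m+\sqrt{m^2+8n^2}}{2}-8<R(K_{1,m}, F_{n})< \frac{3m+\sqrt{m^2+8n^2}}{2}+1.$$ In particular, for all integers $n\ge 2$, $(3+\sqrt{3})n-8< R(K_{1,2n}, F_n)< (3+\sqrt{3})n+1$.
   Context: For a positive integer $n$, the $n$-fan $F_n$ is the graph on $2n+1$ vertices consisting of $n$ triangles that all share one common vertex and are otherwise vertex-disjoint (i.e. a vertex joined to all vertices of a matching with $n$ edges). $K_{1,m}$ is the star with $m$ edges. For graphs $H_1,H_2$, the Ramsey number $R(H_1,H_2)$ is the smallest $N$ such that every coloring of the edges of $K_N$ with colors $1$ and $2$ contains a copy of $H_1$ all of whose edges have color $1$ or a copy of $H_2$ all of whose edges have color $2$ (copies are not necessarily induced). -}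

module Defs where

open import Data.Bool.Base using (Bool)
open import Data.Fin.Base using (Fin)
open import Data.Fin.Patterns using (0F; 1F)
open import Data.Integer.Base as ℤ using (+_; -[1+_])
import Data.Integer.Properties as ℤ
open import Data.Maybe.Base using (Maybe; just; nothing)
open import Data.Nat.Base as ℕ using (ℕ; zero; suc)
import Data.Nat.Properties as ℕ
open import Data.Nat.Coprimality as Coprimality using (1-coprimeTo)
open import Data.Product.Base using (∃; ∃-syntax; _×_; _,_; proj₁; proj₂)
open import Data.Rational.Base as ℚ
  using (ℚ; mkℚ; 0ℚ; 1ℚ; ½; _/_; _+_; _*_; -_; _-_; 1/_; _≤_; _<_; Positive; NonNegative)
open import Data.Rational.Properties
open import Data.Rational.Solver using (module +-*-Solver)
open import Data.Sum.Base using (_⊎_; inj₁; inj₂)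
open import Function.Base using (_∘_)
open import Function.Definitions using (Injective)
open import Level using (0ℓ)
open import Relation.Binary.Core using (Rel)
open import Relation.Binary.Definitions using (Symmetric; Irreflexive)
open import Relation.Binary.PropositionalEquality
open import Relation.Nullary using (¬_; yes; no; contradiction)
open import Relation.Nullary.Decidable using (_×-dec_)

------------------------------------------------------------------------
-- Graphs

record Graph : Set₁ where
  field
    Vertex      : Set
    Adj         : Rel Vertex 0ℓ
    symmetric   : Symmetric Adj
    irreflexive : Irreflexive _≡_ Adj

open Graph public using (Vertex; Adj)

edgeless : ℕ → Graph
edgeless m = record
  { Vertex      = Fin m
  ; Adj         = λ _ _ → Fin 0
  ; symmetric   = λ ()
  ; irreflexive = λ _ ()
  }

-- The edges are the n pairs {(i , false) , (i , true)}.

matching : ℕ → Graph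
matching n = record
  { Vertex      = Fin n × Bool
  ; Adj         = λ (i , a) (j , b) → i ≡ j × a ≢ b
  ; symmetric   = λ (i≡j , a≢b) → sym i≡j , a≢b ∘ sym
  ; irreflexive = λ { refl (_ , a≢a) → a≢a refl }
  }

-- `cone G` adds to G one new vertex, `nothing`, joined to all of G.

data ConeAdj (G : Graph) : Rel (Maybe (Vertex G)) 0ℓ where
  apex-base : ∀ {v} → ConeAdj G nothing (just v)
  base-apex : ∀ {v} → ConeAdj G (just v) nothing
  base-base : ∀ {u v} → Adj G u v → ConeAdj G (just u) (just v)

cone : Graph → Graph
cone G = record
  { Vertex      = Maybe (Vertex G)
  ; Adj         = ConeAdj G
  ; symmetric   = λ { apex-base     → base-apex
                    ; base-apex     → apex-base
                    ; (base-base e) → base-base (Graph.symmetric G e) }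
  ; irreflexive = λ { refl (base-base e) → Graph.irreflexive G refl e }
  }

star : ℕ → Graph
star m = cone (edgeless m)

fan : ℕ → Graph
fan n = cone (matching n)

------------------------------------------------------------------------
-- Ramsey numbers

-- A 2-colouring of the edges of K_N.  The values `colour u u` carry no
-- information: copies are injective and graphs are loopless, so these
-- values are never consulted below.

record Colouring (N : ℕ) : Set where
  field
    colour     : Fin N → Fin N → Fin 2
    colour-sym : ∀ u v → colour u v ≡ colour v u

open Colouring public

MonochromaticCopy : Graph → ∀ {N} → Colouring N → Fin 2 → Set
MonochromaticCopy H {N} c k =
  ∃[ f ] Injective {A = Vertex H} {B = Fin N} _≡_ _≡_ f
       × (∀ {u v} → Adj H u v → colour c (f u) (f v) ≡ k)

-- Colours 1 and 2 are 0F and 1F.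

Arrows : ℕ → Graph → Graph → Set
Arrows N H₁ H₂ =
  (c : Colouring N) → MonochromaticCopy H₁ c 0F ⊎ MonochromaticCopy H₂ c 1F

IsRamseyNumber : Graph → Graph → ℕ → Set
IsRamseyNumber H₁ H₂ R =
  Arrows R H₁ H₂ × (∀ N → Arrows N H₁ H₂ → R ℕ.≤ N)

------------------------------------------------------------------------
-- Dedekind reals

-- `lower p` reads p < x, and `upper q` reads x < q.

record ℝ : Set₁ where
  field
    lower upper  : ℚ → Set
    lower-closed : ∀ {p q} → p ≤ q → lower q → lower p
    lower-open   : ∀ {p} → lower p → ∃[ q ] p < q × lower q
    upper-closed : ∀ {p q} → p ≤ q → upper p → upper q
    upper-open   : ∀ {q} → upper q → ∃[ p ] p < q × upper p
    disjoint     : ∀ {q} → lower q → ¬ upper q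
    located      : ∀ {ε} → 0ℚ < ε → ∃[ p ] ∃[ q ] lower p × upper q × q ≤ p + ε

  lower<upper : ∀ {p q} → lower p → upper q → p < q
  lower<upper {p} {q} l u with p <? q
  ... | yes p<q = p<q
  ... | no  p≮q = contradiction u (disjoint (lower-closed (≮⇒≥ p≮q) l))

open ℝ public

infix 4 _<ᴿ_

_<ᴿ_ : ℝ → ℝ → Set
x <ᴿ y = ∃[ q ] upper x q × lower y q

private
  open +-*-Solver

  half-sum : ∀ p → ½ * p + ½ * p ≡ p
  half-sum = solve 1 (λ p → con ½ :* p :+ con ½ :* p := p) refl

  half-pos : ∀ {p} → 0ℚ < p → 0ℚ < ½ * p
  half-pos {p} 0<p = subst (_< ½ * p) (*-zeroʳ ½) (*-monoʳ-<-pos ½ 0<p)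

  double-mono : ∀ {p q} → p ≤ q → p + p ≤ q + q
  double-mono p≤q = +-mono-≤ p≤q p≤q

  double-cancel : ∀ {p q} → p + p < q + q → p < q
  double-cancel {p} {q} h with p <? q
  ... | yes p<q = p<q
  ... | no  p≮q = contradiction (<-≤-trans h (double-mono (≮⇒≥ p≮q))) (<-irrefl refl)

  neg-neg : ∀ p → - - p ≡ p
  neg-neg = solve 1 (λ p → :- (:- p) := p) refl

  sub-add : ∀ p q → (p - q) + q ≡ p
  sub-add = solve 2 (λ p q → (p :- q) :+ q := p) refl

  sub-≤ : ∀ {r p q} → r ≤ p + q → r - q ≤ p
  sub-≤ {r} {p} {q} h =
    subst (r - q ≤_) (solve 2 (λ p q → (p :+ q) :- q := p) refl p q) (+-monoˡ-≤ (- q) h)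

  ≤-sub : ∀ {r p q} → p + q ≤ r → p ≤ r - q
  ≤-sub {r} {p} {q} h =
    subst (_≤ r - q) (solve 2 (λ p q → (p :+ q) :- q := p) refl p q) (+-monoˡ-≤ (- q) h)

  p<p+ε : ∀ p {ε} → 0ℚ < ε → p < p + ε
  p<p+ε p {ε} 0<ε = subst (_< p + ε) (+-identityʳ p) (+-monoʳ-< p 0<ε)

  p-ε<p : ∀ p {ε} → 0ℚ < ε → p - ε < p
  p-ε<p p {ε} 0<ε = subst (p - ε <_) (sub-add p ε) (p<p+ε (p - ε) 0<ε)

fromℚ : ℚ → ℝ
fromℚ r = record
  { lower        = _< r
  ; upper        = r <_
  ; lower-closed = ≤-<-trans
  ; lower-open   = λ p<r → let (q , p<q , q<r) = <-dense p<r in q , p<q , q<r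
  ; upper-closed = λ p≤q r<p → <-≤-trans r<p p≤q
  ; upper-open   = λ r<q → let (p , r<p , p<q) = <-dense r<q in p , p<q , r<p
  ; disjoint     = <-asym
  ; located      = λ {ε} 0<ε →
      r - ½ * ε , r + ½ * ε , p-ε<p r (half-pos 0<ε) , p<p+ε r (half-pos 0<ε) ,
      ≤-reflexive (solve 2 (λ r ε → r :+ con ½ :* ε := (r :- con ½ :* ε) :+ ε) refl r ε)
  }

ℕ⇒ℚ : ℕ → ℚ
ℕ⇒ℚ n = + n / 1

fromℕ : ℕ → ℝ
fromℕ n = fromℚ (ℕ⇒ℚ n)

infix  8 -ᴿ_
infixl 7 _·ᴿ_
infixl 6 _+ᴿ_ _-ᴿ_
infixl 7 _/2

_+ᴿ_ : ℝ → ℝ → ℝ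
x +ᴿ y = record
  { lower        = λ r → ∃[ p ] ∃[ q ] lower x p × lower y q × r ≡ p + q
  ; upper        = λ r → ∃[ p ] ∃[ q ] upper x p × upper y q × r ≡ p + q
  ; lower-closed = λ { {r} r≤ (p , q , lp , lq , refl) →
      r - q , q , lower-closed x (sub-≤ r≤) lp , lq , sym (sub-add r q) }
  ; lower-open   = λ { (p , q , lp , lq , refl) →
      let (p′ , p<p′ , lp′) = lower-open x lp
      in p′ + q , +-monoˡ-< q p<p′ , p′ , q , lp′ , lq , refl }
  ; upper-closed = λ { {_} {r} ≤r (p , q , up , uq , refl) →
      r - q , q , upper-closed x (≤-sub ≤r) up , uq , sym (sub-add r q) }
  ; upper-open   = λ { (p , q , up , uq , refl) →
      let (p′ , p′<p , up′) = upper-open x up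
      in p′ + q , +-monoˡ-< q p′<p , p′ , q , up′ , uq , refl }
  ; disjoint     = λ { (p , q , lp , lq , refl) (p′ , q′ , up′ , uq′ , eq) →
      <-irrefl eq (+-mono-< (lower<upper x lp up′) (lower<upper y lq uq′)) }
  ; located      = λ {ε} 0<ε →
      let (p , p′ , lp , up′ , hp) = located x (half-pos 0<ε)
          (q , q′ , lq , uq′ , hq) = located y (half-pos 0<ε)
      in p + q , p′ + q′ , (p , q , lp , lq , refl) , (p′ , q′ , up′ , uq′ , refl) ,
         subst (p′ + q′ ≤_)
           (solve 3 (λ p q ε → (p :+ con ½ :* ε) :+ (q :+ con ½ :* ε) := (p :+ q) :+ ε)
              refl p q ε)
           (+-mono-≤ hp hq)
  }

-ᴿ_ : ℝ → ℝ
-ᴿ x = record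
  { lower        = λ p → upper x (- p)
  ; upper        = λ p → lower x (- p)
  ; lower-closed = λ p≤q → upper-closed x (neg-antimono-≤ p≤q)
  ; lower-open   = λ {p} u →
      let (q , q<-p , uq) = upper-open x u
      in - q , subst (_< - q) (neg-neg p) (neg-antimono-< q<-p) ,
         subst (upper x) (sym (neg-neg q)) uq
  ; upper-closed = λ p≤q → lower-closed x (neg-antimono-≤ p≤q)
  ; upper-open   = λ {p} l →
      let (q , -p<q , lq) = lower-open x l
      in - q , subst (- q <_) (neg-neg p) (neg-antimono-< -p<q) ,
         subst (lower x) (sym (neg-neg q)) lq
  ; disjoint     = λ u l → disjoint x l u
  ; located      = λ {ε} 0<ε →
      let (p , q , lp , uq , h) = located x 0<ε
      in - q , - p ,
         subst (upper x) (sym (neg-neg q)) uq ,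
         subst (lower x) (sym (neg-neg p)) lp ,
         subst₂ _≤_
           (solve 3 (λ p q ε → q :+ (:- p :- q) := :- p) refl p q ε)
           (solve 3 (λ p q ε → (p :+ ε) :+ (:- p :- q) := :- q :+ ε) refl p q ε)
           (+-monoˡ-≤ (- p - q) h)
  }

_-ᴿ_ : ℝ → ℝ → ℝ
x -ᴿ y = x +ᴿ (-ᴿ y)

_·ᴿ_ : ℕ → ℝ → ℝ
zero  ·ᴿ x = fromℕ 0
suc n ·ᴿ x = x +ᴿ n ·ᴿ x

_/2 : ℝ → ℝ
x /2 = record
  { lower        = λ p → lower x (p + p)
  ; upper        = λ p → upper x (p + p)
  ; lower-closed = λ p≤q → lower-closed x (double-mono p≤q)
  ; lower-open   = λ {p} l →
      let (q , <q , lq) = lower-open x l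
      in ½ * q , double-cancel (subst (p + p <_) (sym (half-sum q)) <q) ,
         subst (lower x) (sym (half-sum q)) lq
  ; upper-closed = λ p≤q → upper-closed x (double-mono p≤q)
  ; upper-open   = λ {p} u →
      let (q , q< , uq) = upper-open x u
      in ½ * q , double-cancel (subst (_< p + p) (sym (half-sum q)) q<) ,
         subst (upper x) (sym (half-sum q)) uq
  ; disjoint     = disjoint x
  ; located      = λ {ε} 0<ε →
      let (p , q , lp , uq , h) = located x (+-mono-< 0<ε 0<ε)
      in ½ * p , ½ * q ,
         subst (lower x) (sym (half-sum p)) lp ,
         subst (upper x) (sym (half-sum q)) uq ,
         subst (½ * q ≤_)
           (solve 2 (λ p ε → con ½ :* (p :+ (ε :+ ε)) := con ½ :* p :+ ε) refl p ε)
           (*-monoˡ-≤-nonNeg ½ h)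
  }

------------------------------------------------------------------------
-- Square roots of natural numbers

private
  ℕ⇒ℚ-mkℚ : ∀ n → ℕ⇒ℚ n ≡ mkℚ (+ n) 0 (Coprimality.sym (1-coprimeTo n))
  ℕ⇒ℚ-mkℚ n = normalize-coprime (Coprimality.sym (1-coprimeTo n))

  ℕ⇒ℚ-suc : ∀ n → ℕ⇒ℚ (suc n) ≡ ℕ⇒ℚ n + 1ℚ
  ℕ⇒ℚ-suc n = sym (trans (cong (_+ 1ℚ) (ℕ⇒ℚ-mkℚ n))
    (cong (_/ 1) (trans (cong (ℤ._+ + 1) (ℤ.*-identityʳ (+ n))) (ℤ.+-comm (+ n) (+ 1)))))

  0≤ℕ⇒ℚ : ∀ n → 0ℚ ≤ ℕ⇒ℚ n
  0≤ℕ⇒ℚ zero    = ≤-refl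
  0≤ℕ⇒ℚ (suc n) = subst (0ℚ ≤_) (sym (ℕ⇒ℚ-suc n))
    (≤-trans (0≤ℕ⇒ℚ n) (<⇒≤ (p<p+ε _ (positive⁻¹ 1ℚ))))

  ≤-numerator : ∀ p → p ≤ ℕ⇒ℚ ℤ.∣ ℚ.↥ p ∣
  ≤-numerator p@(mkℚ (+ n) d _) = subst (p ≤_) (sym (ℕ⇒ℚ-mkℚ n))
    (ℚ.*≤* (subst₂ ℤ._≤_ (sym (ℤ.*-identityʳ (+ n))) (ℤ.pos-* n (suc d))
      (ℤ.+≤+ (ℕ.m≤m*n n (suc d)))))
  ≤-numerator p@(mkℚ -[1+ _ ] _ _) =
    ≤-trans (<⇒≤ (negative⁻¹ p)) (0≤ℕ⇒ℚ ℤ.∣ ℚ.↥ p ∣)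

  archimedean : ∀ p {δ} → 0ℚ < δ → ∃[ k ] p ≤ ℕ⇒ℚ k * δ
  archimedean p {δ} 0<δ =
    k , subst (_≤ ℕ⇒ℚ k * δ) eq (*-monoʳ-≤-nonNeg δ (≤-numerator (p * 1/ δ)))
    where
    instance
      δ-pos : Positive δ
      δ-pos = ℚ.positive 0<δ
      δ-nonNeg : NonNegative δ
      δ-nonNeg = pos⇒nonNeg δ
      δ-nonZero : ℚ.NonZero δ
      δ-nonZero = pos⇒nonZero δ
    k : ℕ
    k = ℤ.∣ ℚ.↥ (p * 1/ δ) ∣
    eq : p * 1/ δ * δ ≡ p
    eq = trans (*-assoc p (1/ δ) δ) (trans (cong (p *_) (*-inverseˡ δ)) (*-identityʳ p))

  *-pos : ∀ {p q} → 0ℚ < p → 0ℚ < q → 0ℚ < p * q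
  *-pos {p} {q} 0<p 0<q =
    positive⁻¹ (p * q) {{pos*pos⇒pos p {{ℚ.positive 0<p}} q {{ℚ.positive 0<q}}}}

  square-mono-≤ : ∀ {p q} → 0ℚ ≤ p → p ≤ q → p * p ≤ q * q
  square-mono-≤ {p} {q} 0≤p p≤q = ≤-trans
    (*-monoˡ-≤-nonNeg p {{ℚ.nonNegative 0≤p}} p≤q)
    (*-monoʳ-≤-nonNeg q {{ℚ.nonNegative (≤-trans 0≤p p≤q)}} p≤q)

  square-mono-< : ∀ {p q} → 0ℚ ≤ p → p < q → p * p < q * q
  square-mono-< {p} {q} 0≤p p<q = ≤-<-trans
    (*-monoˡ-≤-nonNeg p {{ℚ.nonNegative 0≤p}} (<⇒≤ p<q))
    (*-monoˡ-<-pos q {{ℚ.positive (≤-<-trans 0≤p p<q)}} p<q)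

  diff-pos : ∀ {p q} → p < q → 0ℚ < q - p
  diff-pos {p} {q} p<q = subst (_< q - p) (+-inverseʳ p) (+-monoˡ-< (- p) p<q)

  -- For q ≥ 0, the number r = (q a + d) / (q + a) with a = d + 1 lies strictly
  -- between q and √d, because r - q = (d - q²) / (q + a) and
  -- d - r² = (a² - d)(d - q²) / (q + a)².

  module Mediant {d q : ℚ} (0≤d : 0ℚ ≤ d) (0≤q : 0ℚ ≤ q) where
    a s t e : ℚ
    a = d + 1ℚ
    s = q + a
    t = q * a + d
    e = a * a - d

    0<a : 0ℚ < a
    0<a = ≤-<-trans 0≤d (p<p+ε d (positive⁻¹ 1ℚ))

    0<s : 0ℚ < s
    0<s = +-mono-≤-< 0≤q 0<a

    0<e : 0ℚ < e
    0<e = subst (0ℚ <_)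
      (solve 1 (λ d → (d :* d :+ d) :+ con 1ℚ := (d :+ con 1ℚ) :* (d :+ con 1ℚ) :- d) refl d)
      (+-mono-≤-< (+-mono-≤ (square-mono-≤ ≤-refl 0≤d) 0≤d) (positive⁻¹ 1ℚ))

    instance
      s-pos : Positive s
      s-pos = ℚ.positive 0<s
      s-nonNeg : NonNegative s
      s-nonNeg = pos⇒nonNeg s
      s-nonZero : ℚ.NonZero s
      s-nonZero = pos⇒nonZero s
      ss-nonNeg : NonNegative (s * s)
      ss-nonNeg = pos⇒nonNeg (s * s) {{pos*pos⇒pos s s}}

    r : ℚ
    r = t * 1/ s

    rs≡t : r * s ≡ t
    rs≡t = trans (*-assoc t (1/ s) s) (trans (cong (t *_) (*-inverseˡ s)) (*-identityʳ t))

    rrss≡tt : r * r * (s * s) ≡ t * t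
    rrss≡tt = trans
      (solve 2 (λ r s → r :* r :* (s :* s) := (r :* s) :* (r :* s)) refl r s)
      (cong₂ _*_ rs≡t rs≡t)

    t-qs : q * s + (d - q * q) ≡ t
    t-qs = solve 3 (λ q a d → q :* (q :+ a) :+ (d :- q :* q) := q :* a :+ d) refl q a d

    dss-tt : t * t + e * (d - q * q) ≡ d * (s * s)
    dss-tt = solve 3 (λ q a d →
        (q :* a :+ d) :* (q :* a :+ d) :+ (a :* a :- d) :* (d :- q :* q)
          := d :* ((q :+ a) :* (q :+ a)))
      refl q a d

    tt-dss : d * (s * s) + e * (q * q - d) ≡ t * t
    tt-dss = solve 3 (λ q a d →
        d :* ((q :+ a) :* (q :+ a)) :+ (a :* a :- d) :* (q :* q :- d)
          := (q :* a :+ d) :* (q :* a :+ d))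
      refl q a d

    qs-t : t + (q * q - d) ≡ q * s
    qs-t = solve 3 (λ q a d → (q :* a :+ d) :+ (q :* q :- d) := q :* (q :+ a)) refl q a d

    below : q * q < d → q < r × r * r < d
    below qq<d =
      *-cancelʳ-<-nonNeg s
        (subst (q * s <_) (trans t-qs (sym rs≡t)) (p<p+ε (q * s) (diff-pos qq<d))) ,
      *-cancelʳ-<-nonNeg (s * s)
        (subst₂ _<_ (sym rrss≡tt) dss-tt (p<p+ε (t * t) (*-pos 0<e (diff-pos qq<d))))

    above : d < q * q → r < q × d < r * r
    above d<qq =
      *-cancelʳ-<-nonNeg s
        (subst₂ _<_ (sym rs≡t) qs-t (p<p+ε t (diff-pos d<qq))) ,
      *-cancelʳ-<-nonNeg (s * s)
        (subst (d * (s * s) <_) (trans tt-dss (sym rrss≡tt))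
          (p<p+ε (d * (s * s)) (*-pos 0<e (diff-pos d<qq))))

    0<r : d < q * q → 0ℚ < r
    0<r d<qq = *-cancelʳ-<-nonNeg s (subst₂ _<_ (sym (*-zeroˡ s)) (sym rs≡t) 0<t)
      where
      0<q : 0ℚ < q
      0<q with 0ℚ <? q
      ... | yes h = h
      ... | no  h = contradiction
        (<-≤-trans d<qq (subst (λ z → z * z ≤ d) (≤-antisym 0≤q (≮⇒≥ h)) 0≤d))
        (<-irrefl refl)
      0<t : 0ℚ < t
      0<t = +-mono-<-≤ (*-pos 0<q 0<a) 0≤d

√_ : ℕ → ℝ
√ n = record
  { lower        = L
  ; upper        = U
  ; lower-closed = L-closed
  ; lower-open   = L-open
  ; upper-closed = λ p≤q (0<p , d<pp) →
      <-≤-trans 0<p p≤q , <-≤-trans d<pp (square-mono-≤ (<⇒≤ 0<p) p≤q)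
  ; upper-open   = λ (0<q , d<qq) →
      let open Mediant 0≤d (<⇒≤ 0<q)
      in r , proj₁ (above d<qq) , 0<r d<qq , proj₂ (above d<qq)
  ; disjoint     = λ { (inj₁ q<0)  (0<q , _)  → <-asym q<0 0<q
                     ; (inj₂ qq<d) (_ , d<qq) → <-asym qq<d d<qq }
  ; located      = L-U-located
  }
  where
  d : ℚ
  d = ℕ⇒ℚ n

  0≤d : 0ℚ ≤ d
  0≤d = 0≤ℕ⇒ℚ n

  L U : ℚ → Set
  L q = q < 0ℚ ⊎ q * q < d
  U q = 0ℚ < q × d < q * q

  L-closed : ∀ {p q} → p ≤ q → L q → L p
  L-closed p≤q (inj₁ q<0) = inj₁ (≤-<-trans p≤q q<0)
  L-closed {p} p≤q (inj₂ qq<d) with p <? 0ℚ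
  ... | yes p<0 = inj₁ p<0
  ... | no  p≮0 = inj₂ (≤-<-trans (square-mono-≤ (≮⇒≥ p≮0) p≤q) qq<d)

  negative-open : ∀ {p} → p < 0ℚ → ∃[ q ] p < q × L q
  negative-open p<0 = let (q , p<q , q<0) = <-dense p<0 in q , p<q , inj₁ q<0

  L-open : ∀ {p} → L p → ∃[ q ] p < q × L q
  L-open (inj₁ p<0) = negative-open p<0
  L-open {p} (inj₂ pp<d) with p <? 0ℚ
  ... | yes p<0 = negative-open p<0
  ... | no  p≮0 = let open Mediant 0≤d (≮⇒≥ p≮0)
                  in r , proj₁ (below pp<d) , inj₂ (proj₂ (below pp<d))

  L-U-located : ∀ {ε} → 0ℚ < ε → ∃[ p ] ∃[ q ] L p × U q × q ≤ p + ε
  L-U-located {ε} 0<ε = search (proj₁ bound) (upper-bound (proj₂ bound))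
    where
    δ : ℚ
    δ = ½ * ε

    0<δ : 0ℚ < δ
    0<δ = half-pos 0<ε

    bound : ∃[ k ] d + 1ℚ ≤ ℕ⇒ℚ k * δ
    bound = archimedean (d + 1ℚ) 0<δ

    step : ∀ k → ℕ⇒ℚ (suc k) * δ ≡ ℕ⇒ℚ k * δ + δ
    step k = trans (cong (_* δ) (ℕ⇒ℚ-suc k))
      (solve 2 (λ x δ → (x :+ con 1ℚ) :* δ := x :* δ :+ δ) refl (ℕ⇒ℚ k) δ)

    upper-bound : ∀ {q} → d + 1ℚ ≤ q → U q
    upper-bound {q} a≤q =
      <-≤-trans 0<a a≤q ,
      <-≤-trans (subst (_< a * a) (+-identityˡ d)
                  (subst (0ℚ + d <_) (sub-add (a * a) d) (+-monoˡ-< d 0<e)))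
                (square-mono-≤ (<⇒≤ 0<a) a≤q)
      where open Mediant {q = 0ℚ} 0≤d ≤-refl

    lower-bound : ∀ x → ¬ U x → L (x - δ)
    lower-bound x ¬u with (x - δ) <? 0ℚ
    ... | yes h = inj₁ h
    ... | no  h with d <? x * x
    ...   | yes d<xx = contradiction (≤-<-trans (≮⇒≥ h) (p-ε<p x 0<δ) , d<xx) ¬u
    ...   | no  d≮xx = inj₂ (<-≤-trans (square-mono-< (≮⇒≥ h) (p-ε<p x 0<δ)) (≮⇒≥ d≮xx))

    search : ∀ k → U (ℕ⇒ℚ k * δ) → ∃[ p ] ∃[ q ] L p × U q × q ≤ p + ε
    search zero (0<0 , _) = contradiction (subst (0ℚ <_) (*-zeroˡ δ) 0<0) (<-irrefl refl)
    search (suc k) u with (0ℚ <? ℕ⇒ℚ k * δ) ×-dec (d <? (ℕ⇒ℚ k * δ) * (ℕ⇒ℚ k * δ))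
    ... | yes u′ = search k u′
    ... | no  ¬u = ℕ⇒ℚ k * δ - δ , ℕ⇒ℚ (suc k) * δ , lower-bound _ ¬u , u ,
      ≤-reflexive (trans (step k)
        (solve 2 (λ x ε → x :+ con ½ :* ε := (x :- con ½ :* ε) :+ ε) refl (ℕ⇒ℚ k * δ) ε))

{-# OPTIONS --safe #-}
-- Let G be the blue graph of a colouring of K_N without a red star, N = 2m + t, so that
-- all its degrees are at least D = m + t.  As x = (3m + √(m² + 8n²)) / 2 is the larger
-- root of (x − m)(x − 2m) = 2n², the point is to compare D t with 2n².
--
-- Upper bound.  If the neighbourhood of v has no n independent edges, alternating paths
-- yield a weak form of the Gallai–Edmonds decomposition: s < n vertices of it form a
-- set S, and most of the others an independent set J whose neighbours there lie almost
-- all in S.  Let u ∈ J be joined to S only, and let J′ be the independent set in the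
-- neighbourhood of u.  J and J′ are disjoint and almost completely joined, so a vertex
-- with many neighbours in both would have n independent edges around it.  Counting the
-- edges from J ∪ J′ to the remaining vertices gives D t ≤ 2(n − 1)² + 4(n − 1) < 2n².
--
-- Lower bound.  Near equality dictates the graph: two independent sets I₁ and I₂, joined
-- completely, and small sets R₁ and R₂, where R_i is joined completely to I_i, and a
-- vertex of R_i has n − 1 or n − 2 further neighbours, in the other half.

module Submission where

open import Defs
open import Data.Nat.Base using (ℕ; _+_; _*_; _^_; _≤_; _<_)
open import Data.Product.Base using (_×_; ∃-syntax)

open import Data.Bool.Base using (Bool; true; false; not)
open import Data.Bool.Properties using (not-¬; ¬-not) renaming (_≟_ to _≟ᵇ_)
open import Data.Empty using (⊥; ⊥-elim)
open import Data.Fin.Base using (Fin; zero; suc; toℕ; fromℕ<; inject≤; combine; remQuot; splitAt; join)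
open import Data.Fin.Patterns using (0F; 1F)
open import Data.Fin.Properties using (any?; all?; suc-injective; toℕ-injective; toℕ<n; toℕ-fromℕ<; toℕ-combine;
  remQuot-combine; combine-remQuot; splitAt-join; join-splitAt; inject≤-injective; pigeonhole; injective⇒≤)
  renaming (_≟_ to _≟ᶠ_)
open import Data.List.Base using (List; []; _∷_; _++_; length; lookup)
open import Data.List.Properties using (length-++; ++-identityʳ)
open import Data.Maybe.Base using (Maybe; just; nothing)
open import Data.Maybe.Properties using (just-injective)
open import Data.Nat.Base using (zero; suc; _∸_; _⊓_; _/_; _%_; z≤n; s≤s; NonZero; >-nonZero)
open import Data.Nat.DivMod using (%-distribˡ-+; [m+n]%n≡m%n; [m+kn]%n≡m%n; m%n%n≡m%n; m<n⇒m%n≡m; m%n<n;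
  m≡m%n+[m/n]*n; m/n*n≤m; m*n/n≡m; m<n*o⇒m/o<n; /-monoˡ-≤)
open import Data.Nat.Induction using (<-rec)
open import Data.Nat.Properties hiding (suc-injective)
open import Data.Nat.Tactic.RingSolver using (solve-∀; solve)
open import Data.Product.Base using (∃; Σ-syntax; _,_; proj₁; proj₂; map₂)
open import Data.Sum.Base using (_⊎_; inj₁; inj₂; [_,_]′)
open import Data.Sum.Properties using (inj₁-injective; inj₂-injective)
open import Function.Base using (_∘_; case_of_)
open import Function.Definitions using (Injective)
open import Relation.Binary.Definitions using (tri<; tri≈; tri>)
open import Relation.Binary.PropositionalEquality hiding (J)
open import Relation.Nullary using (¬_; Dec; yes; no; contradiction)
open import Relation.Nullary.Decidable using (_×-dec_; _⊎-dec_; _→-dec_; ¬?; map′; decidable-stable)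

-- Arithmetic

-- A linear inequality over ℕ is certified by an identity between the two sides to which
-- the sides of the added-up hypothesis and a remainder r have been added.

-- The weak decomposition leaves over a set `X` of `2 * f` vertices sending at most `2 * f` edges to
-- `J`, and every estimate has to carry `f`. There is just enough room: with ν = n - 1, the errors
-- from the two neighbourhoods add up to 2f + 2f′ ≤ 4ν, while 2n² - 2ν² = 4ν + 2. As |J| > 2f, some
-- u in J has no neighbour in X, which makes the sets obtained from v and from u disjoint.
--
-- In the lower bound the graph has 2m + 2h vertices. The edges between an independent set and the
-- opposite R impose p h ≤ ν ρ, and the largest such h is taken. Rounding, and ν in place of n, cost
-- a term linear in n; the hypothesis m > n lets a constant absorb it, whence the 8.
--
-- Both bounds reach the reals through a natural number y that stands for √(m² + 8n²). If y = m +
-- 2t, then y² = m² + 4(m + t)t, so comparing y² with m² + 8n² is comparing (m + t)t with 2n².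

linear : ∀ {a b x y} r → x ≤ y → b + x ≡ a + y + r → a ≤ b
linear {a} {b} {x} {y} r x≤y eq = +-cancelʳ-≤ y a b (begin
  a + y     ≤⟨ m≤m+n (a + y) r ⟩
  a + y + r ≡⟨ eq ⟨
  b + x     ≤⟨ +-monoʳ-≤ b x≤y ⟩
  b + y     ∎)
  where open ≤-Reasoning

infixr 6 _⊞_

_⊞_ : ∀ {a b c d} → a ≤ b → c ≤ d → a + c ≤ b + d
_⊞_ = +-mono-≤

scale : ∀ k {a b} → a ≤ b → k * a ≤ k * b
scale k = *-monoʳ-≤ k

scaleʳ : ∀ k {a b} → a ≤ b → a * k ≤ b * k
scaleʳ k = *-monoˡ-≤ k

≡⇒≥ : ∀ {a b : ℕ} → a ≡ b → b ≤ a
≡⇒≥ eq = ≤-reflexive (sym eq)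

infeasible : ∀ {x y} r → x ≤ y → x ≡ 1 + y + r → ⊥
infeasible r x≤y eq = contradiction (linear {1} {0} r x≤y eq) λ ()

4ab≤[a+b]² : ∀ a b → 4 * (a * b) ≤ (a + b) * (a + b)
4ab≤[a+b]² a b with ≤-total a b
... | inj₁ a≤b with (k , refl) ← m≤n⇒∃[o]m+o≡n a≤b =
  ≤-trans (m≤m+n _ (k * k)) (≤-reflexive (id₁ a k))
  where
  id₁ : ∀ a k → 4 * (a * (a + k)) + k * k ≡ (a + (a + k)) * (a + (a + k))
  id₁ = solve-∀
... | inj₂ b≤a with (k , refl) ← m≤n⇒∃[o]m+o≡n b≤a =
  ≤-trans (m≤m+n _ (k * k)) (≤-reflexive (id₂ b k))
  where
  id₂ : ∀ b k → 4 * ((b + k) * b) + k * k ≡ (b + k + b) * (b + k + b)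
  id₂ = solve-∀

square-cancel-≤ : ∀ {a b} → a * a ≤ b * b → a ≤ b
square-cancel-≤ {a} {b} aa≤bb with a ≤? b
... | yes a≤b = a≤b
... | no  a≰b = contradiction aa≤bb (<⇒≱ (*-mono-< (≰⇒> a≰b) (≰⇒> a≰b)))

-- Inequalities between n, D and t when 2n² ≤ D t

module Numbers {n D t : ℕ} (large : 2 * (n * n) ≤ D * t) where

  -- AM-GM gives (D + ct)² ≥ 4cDt ≥ 8cn², so e is admissible as soon as e² ≤ 8c, with slack `r` =
  -- (8c - e²)n². The instances below replace the quadratic hypothesis by linear ones, with the
  -- multiples of `t` that the eliminations call for.
  weighted-sum≥ : ∀ e c r → 4 * (c * (2 * (n * n))) ≡ (e * n) * (e * n) + r → e * n ≤ D + c * t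
  weighted-sum≥ e c r eq = square-cancel-≤ (begin
    (e * n) * (e * n)         ≤⟨ m≤m+n _ r ⟩
    (e * n) * (e * n) + r     ≡⟨ eq ⟨
    4 * (c * (2 * (n * n)))   ≤⟨ *-monoʳ-≤ 4 (*-monoʳ-≤ c large) ⟩
    4 * (c * (D * t))         ≡⟨ cong (4 *_) (swap c D t) ⟩
    4 * (D * (c * t))         ≤⟨ 4ab≤[a+b]² D (c * t) ⟩
    (D + c * t) * (D + c * t) ∎)
    where
    open ≤-Reasoning
    swap : ∀ c D t → c * (D * t) ≡ D * (c * t)
    swap = solve-∀

  4n≤D+2t : 4 * n ≤ D + 2 * t
  4n≤D+2t = weighted-sum≥ 4 2 0 (id₁ n)
    where
    id₁ : ∀ n → 4 * (2 * (2 * (n * n))) ≡ (4 * n) * (4 * n) + 0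
    id₁ = solve-∀

  5n≤D+4t : 5 * n ≤ D + 4 * t
  5n≤D+4t = weighted-sum≥ 5 4 (7 * (n * n)) (id₁ n)
    where
    id₁ : ∀ n → 4 * (4 * (2 * (n * n))) ≡ (5 * n) * (5 * n) + 7 * (n * n)
    id₁ = solve-∀

  6n≤D+5t : 6 * n ≤ D + 5 * t
  6n≤D+5t = weighted-sum≥ 6 5 (4 * (n * n)) (id₁ n)
    where
    id₁ : ∀ n → 4 * (5 * (2 * (n * n))) ≡ (6 * n) * (6 * n) + 4 * (n * n)
    id₁ = solve-∀

  7n≤D+7t : 7 * n ≤ D + 7 * t
  7n≤D+7t = weighted-sum≥ 7 7 (7 * (n * n)) (id₁ n)
    where
    id₁ : ∀ n → 4 * (7 * (2 * (n * n))) ≡ (7 * n) * (7 * n) + 7 * (n * n)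
    id₁ = solve-∀

module Bounds {ν D t : ℕ} (large : 2 * (suc ν * suc ν) ≤ D * t) where
  open Numbers {suc ν} {D} {t} large

  -- Here j = |J|. If t = s + 1 + e, then j(1 + e) ≤ 2f. For j ≥ 2 this yields D + 2t ≤ 3s + 4f + 2
  -- < 4n. For j ≤ 1 it is D that is small: D < 2n, hence t < n because m > n, and D t < 2n².
  t≤s-bound : ∀ {m s f j} → D ≡ m + t → suc ν < m → j + s + 2 * f ≡ D → s + f ≤ ν →
    j * t ≤ j * s + 2 * f → t ≤ s
  t≤s-bound {m} {s} {f} {j} D≡m+t n<m D-eq s+f≤ν jt≤ with t ≤? s
  ... | yes t≤s = t≤s
  ... | no  t≰s with (e , refl) ← m≤n⇒∃[o]m+o≡n (≰⇒> t≰s) = ⊥-elim (by-size j D-eq je≤)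
    where
    je≤ : j * suc e ≤ 2 * f
    je≤ = +-cancelˡ-≤ (j * s) _ _ (subst (_≤ j * s + 2 * f) (expand j s e) jt≤)
      where
      expand : ∀ j s e → j * (suc s + e) ≡ j * s + j * suc e
      expand = solve-∀
    small : ∀ j → j ≤ 1 → j + s + 2 * f ≡ D → ⊥
    small j j≤1 D-eq = <⇒≱ (*-mono-< D<2n t<n) (subst (_≤ D * (suc s + e)) (sym (*-assoc 2 (suc ν) (suc ν))) large)
      where
      D<2n : D < 2 * suc ν
      D<2n = linear s (≡⇒≥ D-eq ⊞ j≤1 ⊞ scale 2 s+f≤ν)
        (solve (D ∷ j ∷ s ∷ f ∷ ν ∷ []))
      t<n : suc s + e < suc ν
      t<n = linear 1 (D<2n ⊞ n<m ⊞ ≡⇒≥ D≡m+t)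
        (solve (m ∷ s ∷ e ∷ D ∷ ν ∷ []))
    by-size : ∀ j → j + s + 2 * f ≡ D → j * suc e ≤ 2 * f → ⊥
    by-size 0 D-eq _ = small 0 z≤n D-eq
    by-size 1 D-eq _ = small 1 ≤-refl D-eq
    by-size (suc (suc j)) D-eq je≤ =
      infeasible (1 + s + j * e)
        (je≤ ⊞ 4n≤D+2t ⊞ ≡⇒≥ D-eq ⊞ scale 4 s+f≤ν)
        (solve (j ∷ e ∷ f ∷ s ∷ ν ∷ D ∷ []))

  -- Makes some vertex of J have no neighbour in X, since at most 2f edges run between the two.
  2f<j : ∀ {s f j} → j + s + 2 * f ≡ D → s + f ≤ ν → t ≤ s → 2 * f < j
  2f<j {s} {f} {j} D-eq s+f≤ν t≤s =
    linear (3 + s)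
      (4n≤D+2t ⊞ ≡⇒≥ D-eq ⊞ scale 4 s+f≤ν ⊞ scale 2 t≤s)
      (solve (ν ∷ D ∷ s ∷ f ∷ t ∷ j ∷ []))

  -- As r = s + s′ - t, the terms kr cancel and `count` becomes kt ≤ 2f + 2f′ + rν. With (s + f)t ≤
  -- νt and ft ≤ fν this gives D t ≤ 2f + 2f′ + ν(r + t + f), and r + t + f + f′ ≤ 2ν bounds the
  -- right side by 2ν² + 4ν = 2n² - 2.
  final-bound : ∀ {s f s′ f′ r k} → r + t ≡ s + s′ → k + s + 2 * f ≡ D → s + f ≤ ν → s′ + f′ ≤ ν →
    t ≤ s → k * (s + s′) ≤ 2 * f + 2 * f′ + r * (k + ν) → ⊥
  final-bound {s} {f} {s′} {f′} {r} {k} r+t D-eq s+f≤ν s′+f′≤ν t≤s count =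
    infeasible (1 + 2 * s + 2 * s′ + f′ * ν)
      (large ⊞ kt≤ ⊞ Dt≤ ⊞ rt≤ ⊞ st≤ ⊞ ft≤ ⊞ scale 2 s+f≤ν ⊞ scale 2 s′+f′≤ν)
      (solve (ν ∷ D ∷ t ∷ r ∷ k ∷ s ∷ f ∷ s′ ∷ f′ ∷ []))
    where
    kt≤ : k * (r + t) ≤ 2 * f + 2 * f′ + r * (k + ν)
    kt≤ = subst (λ z → k * z ≤ 2 * f + 2 * f′ + r * (k + ν)) (sym r+t) count
    Dt≤ : D * t ≤ (k + s + 2 * f) * t
    Dt≤ = ≤-reflexive (cong (_* t) (sym D-eq))
    r≤ : r + t + f + f′ ≤ 2 * ν
    r≤ = linear 0 (≤-reflexive r+t ⊞ s+f≤ν ⊞ s′+f′≤ν)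
      (solve (r ∷ t ∷ f ∷ f′ ∷ s ∷ s′ ∷ ν ∷ []))
    rt≤ : (r + t + f + f′) * ν ≤ 2 * ν * ν
    rt≤ = *-monoˡ-≤ ν r≤
    st≤ : (s + f) * t ≤ ν * t
    st≤ = *-monoˡ-≤ t s+f≤ν
    ft≤ : f * t ≤ f * ν
    ft≤ = *-monoʳ-≤ f (≤-trans t≤s (≤-trans (m≤m+n s f) s+f≤ν))

  -- If a vertex has p neighbours in one of two independent sets of size k and q in the
  -- other, p + q > k + ν, then one of the two greedy matchings of match-into exists.

  two-sided : ∀ {s f s′ f′ k p q} → k + s + 2 * f ≡ D → s + f ≤ ν → s′ + f′ ≤ ν → t ≤ s → t ≤ s′ →
    suc (k + ν) ≤ p + q → ¬ (s + 3 * f ≤ q + t × s + 1 + suc ν ≤ q + t) →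
    ¬ (s′ + 3 * f′ ≤ p + t × s′ + 1 + suc ν ≤ p + t) → ⊥
  two-sided {s} {f} {s′} {f′} {k} {p} {q} D-eq s+f≤ν s′+f′≤ν t≤s t≤s′ p+q> ¬q ¬p
    with s + 1 + suc ν ≤? q + t | s′ + 1 + suc ν ≤? p + t
  ... | no a | no b =
    infeasible (2 + f′)
      (4n≤D+2t ⊞ ≡⇒≥ D-eq ⊞ scale 2 s+f≤ν ⊞ s′+f′≤ν ⊞ p+q> ⊞ ≰⇒> a ⊞ ≰⇒> b)
      (solve (ν ∷ D ∷ t ∷ s ∷ f ∷ s′ ∷ f′ ∷ k ∷ p ∷ q ∷ []))
  ... | yes a | no b =
    infeasible (6 + f′)
      (6n≤D+5t ⊞ ≡⇒≥ D-eq ⊞ scale 5 s+f≤ν ⊞ s′+f′≤ν ⊞ p+q> ⊞ ≰⇒> (λ h → ¬q (h , a)) ⊞ ≰⇒> b ⊞ scale 3 t≤s)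
      (solve (ν ∷ D ∷ t ∷ s ∷ f ∷ s′ ∷ f′ ∷ k ∷ p ∷ q ∷ []))
  ... | no a | yes b =
    infeasible 5
      (5n≤D+4t ⊞ ≡⇒≥ D-eq ⊞ scale 2 s+f≤ν ⊞ scale 3 s′+f′≤ν ⊞ p+q> ⊞ ≰⇒> a ⊞ ≰⇒> (λ h → ¬p (h , b)) ⊞ scale 2 t≤s′)
      (solve (ν ∷ D ∷ t ∷ s ∷ f ∷ s′ ∷ f′ ∷ k ∷ p ∷ q ∷ []))
  ... | yes a | yes b =
    infeasible 9
      (7n≤D+7t ⊞ ≡⇒≥ D-eq ⊞ scale 5 s+f≤ν ⊞ scale 3 s′+f′≤ν ⊞ p+q> ⊞ ≰⇒> (λ h → ¬q (h , a))
        ⊞ ≰⇒> (λ h → ¬p (h , b)) ⊞ scale 3 t≤s ⊞ scale 2 t≤s′)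
      (solve (ν ∷ D ∷ t ∷ s ∷ f ∷ s′ ∷ f′ ∷ k ∷ p ∷ q ∷ []))

-- The lower bound

splitAt-injective : ∀ m {n} → Injective {A = Fin (m + n)} _≡_ _≡_ (splitAt m)
splitAt-injective m {n} {x} {y} eq =
  trans (sym (join-splitAt m n x)) (trans (cong (join m n) eq) (join-splitAt m n y))

[,]-injective : ∀ {a b} {V : Set} {f : Fin a → V} {g : Fin b → V} → Injective _≡_ _≡_ f → Injective _≡_ _≡_ g →
  (∀ i j → f i ≢ g j) → Injective {A = Fin (a + b)} _≡_ _≡_ ([ f , g ]′ ∘ splitAt a)
[,]-injective {a} {f = f} {g} f-inj g-inj f≢g eq = splitAt-injective a (cases _ _ eq)
  where
  cases : ∀ x y → [ f , g ]′ x ≡ [ f , g ]′ y → x ≡ y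
  cases (inj₁ i) (inj₁ j) eq = cong inj₁ (f-inj eq)
  cases (inj₂ i) (inj₂ j) eq = cong inj₂ (g-inj eq)
  cases (inj₁ i) (inj₂ j) eq = contradiction eq (f≢g i j)
  cases (inj₂ i) (inj₁ j) eq = contradiction (sym eq) (f≢g j i)

-- Colourings from graphs with large degrees and small local covers

module Avoiding {V : Set} (E : V → V → Set) (E? : ∀ u v → Dec (E u v)) (E-sym : ∀ {u v} → E u v → E v u)
  (E-irrefl : ∀ {v} → ¬ E v v) {N} (φ : Fin N → V) (φ-inj : Injective _≡_ _≡_ φ)
  (ψ : V → Fin N) (ψ-inj : Injective _≡_ _≡_ ψ) where

  paint : ∀ {A : Set} → Dec A → Fin 2
  paint (yes _) = 1F
  paint (no  _) = 0F

  paint-cong : ∀ {A B : Set} (d : Dec A) (e : Dec B) → (A → B) → (B → A) → paint d ≡ paint e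
  paint-cong (yes _) (yes _) _ _ = refl
  paint-cong (yes a) (no ¬b) f _ = contradiction (f a) ¬b
  paint-cong (no ¬a) (yes b) _ g = contradiction (g b) ¬a
  paint-cong (no _)  (no _)  _ _ = refl

  paint-1F : ∀ {A : Set} (d : Dec A) → paint d ≡ 1F → A
  paint-1F (yes a) _ = a

  paint-0F : ∀ {A : Set} (d : Dec A) → paint d ≡ 0F → ¬ A
  paint-0F (no ¬a) _ = ¬a

  colouring : Colouring N
  colouring = record
    { colour     = λ u v → paint (E? (φ u) (φ v))
    ; colour-sym = λ u v → paint-cong (E? (φ u) (φ v)) (E? (φ v) (φ u)) E-sym E-sym }

  Neighbours : ℕ → V → Set
  Neighbours k v = ∃[ g ] Injective {A = Fin k} _≡_ _≡_ g × (∀ i → E v (g i))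

  -- A vertex cover of the graph induced on the neighbourhood of `v`. Entries may repeat or lie
  -- outside the neighbourhood, so that a list can be padded to a fixed length.
  Cover : ℕ → V → Set
  Cover k v = Σ[ s ∈ (Fin k → V) ] (∀ {a b} → E v a → E v b → E a b → ∃[ l ] (s l ≡ a ⊎ s l ≡ b))

  -- The centre, its m red and its k blue neighbours would be 1 + m + k distinct vertices, which ψ
  -- maps injectively into N ≤ k + m places.
  no-star : ∀ {m} → (∀ v → ∃[ k ] N ≤ k + m × Neighbours k v) → ¬ MonochromaticCopy (star m) colouring 0F
  no-star {m} nbrs (f , f-inj , col) with nbrs (φ (f nothing))
  ... | k , N≤k+m , g , g-inj , g∈ =
    <⇒≱ (injective⇒≤ {f = ψ ∘ all} (all-inj ∘ ψ-inj)) (≤-trans N≤k+m (≤-reflexive (+-comm k m)))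
    where
    leaf : Fin m → V
    leaf i = φ (f (just i))
    leaf-inj : Injective _≡_ _≡_ leaf
    leaf-inj = just-injective ∘ f-inj ∘ φ-inj
    leaf≢g : ∀ i j → leaf i ≢ g j
    leaf≢g i j eq = paint-0F (E? (φ (f nothing)) (φ (f (just i)))) (col apex-base) (subst (E _) (sym eq) (g∈ j))
    others : Fin (m + k) → V
    others = [ leaf , g ]′ ∘ splitAt m
    apex≢others : ∀ x → φ (f nothing) ≢ [ leaf , g ]′ x
    apex≢others (inj₁ i) eq = case f-inj (φ-inj eq) of λ ()
    apex≢others (inj₂ j) eq = E-irrefl (subst (E _) (sym eq) (g∈ j))
    all : Fin (suc (m + k)) → V
    all zero    = φ (f nothing)
    all (suc x) = others x
    all-inj : Injective _≡_ _≡_ all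
    all-inj {zero}  {zero}  eq = refl
    all-inj {zero}  {suc y} eq = contradiction eq (apex≢others (splitAt m y))
    all-inj {suc x} {zero}  eq = contradiction (sym eq) (apex≢others (splitAt m x))
    all-inj {suc x} {suc y} eq = cong suc ([,]-injective {f = leaf} {g} leaf-inj g-inj leaf≢g eq)

  -- The cover hits the outer edge of each of the ν + 1 triangles with at most ν vertices, so two of
  -- these disjoint edges would share one.
  no-fan : ∀ {ν} → (∀ v → ∃[ k ] k ≤ ν × Cover k v) → ¬ MonochromaticCopy (fan (suc ν)) colouring 1F
  no-fan {ν} covers (f , f-inj , col) with covers (φ (f nothing))
  ... | k , k≤ν , s , s-covers = clash (pigeonhole (s≤s k≤ν) (λ i → proj₁ (hit i)))
    where
    tip : Fin (suc ν) × Bool → V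
    tip e = φ (f (just e))
    edge : ∀ {x y} → Adj (fan (suc ν)) x y → E (φ (f x)) (φ (f y))
    edge xy = paint-1F (E? _ _) (col xy)
    hit : ∀ i → ∃[ l ] ∃[ b ] s l ≡ tip (i , b)
    hit i with s-covers (edge apex-base) (edge apex-base) (edge (base-base {u = i , false} {i , true} (refl , λ ())))
    ... | l , inj₁ eq = l , false , eq
    ... | l , inj₂ eq = l , true , eq
    clash : ¬ (∃[ i ] ∃[ j ] toℕ i < toℕ j × proj₁ (hit i) ≡ proj₁ (hit j))
    clash (i , j , i<j , eq) = <⇒≢ i<j (cong (toℕ ∘ proj₁) (just-injective (f-inj (φ-inj
      (trans (sym (proj₂ (proj₂ (hit i)))) (trans (cong s eq) (proj₂ (proj₂ (hit j)))))))))

  avoids : ∀ {m ν} → (∀ v → ∃[ k ] N ≤ k + m × Neighbours k v) → (∀ v → ∃[ k ] k ≤ ν × Cover k v) →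
    ¬ Arrows N (star m) (fan (suc ν))
  avoids nbrs covers arr with arr colouring
  ... | inj₁ copy = no-star nbrs copy
  ... | inj₂ copy = no-fan covers copy

side : Fin 2 → Bool
side 0F = false
side 1F = true

side⁻¹ : Bool → Fin 2
side⁻¹ false = 0F
side⁻¹ true  = 1F

side-side⁻¹ : ∀ b → side (side⁻¹ b) ≡ b
side-side⁻¹ false = refl
side-side⁻¹ true  = refl

side⁻¹-side : ∀ x → side⁻¹ (side x) ≡ x
side⁻¹-side 0F = refl
side⁻¹-side 1F = refl

module Doubled (k : ℕ) where
  fromFin : Fin (2 * k) → Bool × Fin k
  fromFin x = let (b , i) = remQuot {2} k x in side b , i

  toFin : Bool × Fin k → Fin (2 * k)
  toFin (b , i) = combine (side⁻¹ b) i

  toFin-fromFin : ∀ x → toFin (fromFin x) ≡ x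
  toFin-fromFin x = trans (cong (λ b → combine b (proj₂ (remQuot {2} k x))) (side⁻¹-side (proj₁ (remQuot {2} k x))))
    (combine-remQuot {2} k x)

  fromFin-toFin : ∀ v → fromFin (toFin v) ≡ v
  fromFin-toFin (b , i) = trans (cong (λ (b , i) → side b , i) (remQuot-combine {2} (side⁻¹ b) i))
    (cong (_, i) (side-side⁻¹ b))

  fromFin-injective : Injective _≡_ _≡_ fromFin
  fromFin-injective {x} {y} eq = trans (sym (toFin-fromFin x)) (trans (cong toFin eq) (toFin-fromFin y))

  toFin-injective : Injective _≡_ _≡_ toFin
  toFin-injective {x} {y} eq = trans (sym (fromFin-toFin x)) (trans (cong fromFin eq) (fromFin-toFin y))

two-sides : ∀ {σ τ ω : Bool} → σ ≢ τ → σ ≢ ω → ¬ τ ≢ ω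
two-sides {σ} {τ} {ω} σ≢τ σ≢ω τ≢ω with σ | τ | ω
... | false | false | _     = σ≢τ refl
... | true  | true  | _     = σ≢τ refl
... | false | _     | false = σ≢ω refl
... | true  | _     | true  = σ≢ω refl
... | false | true  | true  = τ≢ω refl
... | true  | false | false = τ≢ω refl

-- The graph for h = 0. Its degrees m equal N - m, and its neighbourhoods contain no edges, so the
-- empty cover suffices.
complete-bipartite-avoids : ∀ m ν → ¬ Arrows (2 * m) (star m) (fan (suc ν))
complete-bipartite-avoids m ν = Avoiding.avoids E E? (λ σ≢τ → σ≢τ ∘ sym) (λ σ≢σ → σ≢σ refl)
  fromFin fromFin-injective toFin toFin-injective
  (λ (σ , _) → m , ≤-reflexive (cong (m +_) (+-identityʳ m)) , (not σ ,_) , cong proj₂ , λ _ → not-¬ refl)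
  (λ _ → 0 , z≤n , (λ ()) , λ {(_ , _)} {(_ , _)} σ≢τ σ≢ω τ≢ω → contradiction τ≢ω (two-sides σ≢τ σ≢ω))
  where
  open Doubled m
  E : Bool × Fin m → Bool × Fin m → Set
  E (σ , _) (τ , _) = σ ≢ τ
  E? : ∀ u v → Dec (E u v)
  E? (σ , _) (τ , _) = ¬? (σ ≟ᵇ τ)

-- Cyclic assignments modulo ρ

module Residues (ρ : ℕ) .{{_ : NonZero ρ}} where

  residue : ℕ → Fin ρ
  residue k = fromℕ< (m%n<n k ρ)

  toℕ-residue : ∀ k → toℕ (residue k) ≡ k % ρ
  toℕ-residue k = toℕ-fromℕ< (m%n<n k ρ)

  %-+ : ∀ a b → (a % ρ + b) % ρ ≡ (a + b) % ρ
  %-+ a b = trans (%-distribˡ-+ (a % ρ) b ρ)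
    (trans (cong (λ x → (x + b % ρ) % ρ) (m%n%n≡m%n a ρ)) (sym (%-distribˡ-+ a b ρ)))

  -- An additive inverse modulo ρ. It is ρ rather than 0 when ρ divides `a`, which `%` makes
  -- harmless.
  opposite : ℕ → ℕ
  opposite a = ρ ∸ a % ρ

  +-opposite : ∀ a s → (a + s + opposite a) % ρ ≡ s % ρ
  +-opposite a s = begin
    (a + s + opposite a) % ρ           ≡⟨ cong (_% ρ) (+-assoc a s _) ⟩
    (a + (s + opposite a)) % ρ         ≡⟨ %-+ a _ ⟨
    (a % ρ + (s + opposite a)) % ρ     ≡⟨ cong (_% ρ) (shuffle (a % ρ) s (opposite a)) ⟩
    (s + (a % ρ + opposite a)) % ρ     ≡⟨ cong (λ x → (s + x) % ρ) (m+[n∸m]≡n (<⇒≤ (m%n<n a ρ))) ⟩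
    (s + ρ) % ρ                        ≡⟨ [m+n]%n≡m%n s ρ ⟩
    s % ρ                              ∎
    where
    open ≡-Reasoning
    shuffle : ∀ a s o → a + (s + o) ≡ s + (a + o)
    shuffle = solve-∀

  unshift : ∀ a s → ((a + s) % ρ + opposite a) % ρ ≡ s % ρ
  unshift a s = trans (%-+ (a + s) _) (+-opposite a s)

  reshift : ∀ a s → (a + (s + opposite a) % ρ) % ρ ≡ s % ρ
  reshift a s = begin
    (a + (s + opposite a) % ρ) % ρ  ≡⟨ cong (_% ρ) (+-comm a _) ⟩
    ((s + opposite a) % ρ + a) % ρ  ≡⟨ %-+ (s + opposite a) a ⟩
    (s + opposite a + a) % ρ        ≡⟨ cong (_% ρ) (shuffle s (opposite a) a) ⟩
    (a + s + opposite a) % ρ        ≡⟨ +-opposite a s ⟩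
    s % ρ                           ∎
    where
    open ≡-Reasoning
    shuffle : ∀ s o a → s + o + a ≡ a + s + o
    shuffle = solve-∀

  residue-cong : ∀ {x y} → residue x ≡ residue y → x % ρ ≡ y % ρ
  residue-cong {x} {y} eq = trans (sym (toℕ-residue x)) (trans (cong toℕ eq) (toℕ-residue y))

  shift-injective : ∀ a {s s′} → s < ρ → s′ < ρ → residue (a + s) ≡ residue (a + s′) → s ≡ s′
  shift-injective a {s} {s′} s<ρ s′<ρ eq = begin
    s                                   ≡⟨ m<n⇒m%n≡m s<ρ ⟨
    s % ρ                               ≡⟨ unshift a s ⟨
    ((a + s) % ρ + opposite a) % ρ      ≡⟨ cong (λ x → (x + opposite a) % ρ) (residue-cong eq) ⟩
    ((a + s′) % ρ + opposite a) % ρ     ≡⟨ unshift a s′ ⟩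
    s′ % ρ                              ≡⟨ m<n⇒m%n≡m s′<ρ ⟩
    s′                                  ∎
    where open ≡-Reasoning

-- The vertices (σ , inj₁ i) form the independent sets I₁, I₂ of size p and the (σ , inj₂ j)
-- the sets R₁, R₂ of size ρ; here m = p + a and n = a + 2h + 2, on 2m + 2h vertices.  Each
-- vertex of I has h neighbours in the opposite R, assigned cyclically, so that a vertex of
-- R has κ or κ + 1 neighbours in the opposite I; a c-regular graph between R₁ and R₂ makes
-- up for what is missing.

module Construction (p a h′ κ c : ℕ)
  (c≤ρ : c ≤ suc (a + h′)) (κρ≤ : κ * suc (a + h′) ≤ p * suc h′) (≤κρ : p * suc h′ ≤ suc κ * suc (a + h′))
  (κ+c : κ + c ≡ a + 2 * suc h′) where

  h ρ : ℕ
  h = suc h′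
  ρ = suc (a + h′)

  open Residues ρ

  V : Set
  V = Bool × (Fin p ⊎ Fin ρ)

  -- The edges from I to the opposite R are numbered, edge h·i + s being the s-th one at vertex i;
  -- edge number k ends at the vertex k mod ρ.
  Q : Fin p → Fin ρ → Set
  Q i j = ∃[ s ] residue (toℕ (combine {p} {h} i s)) ≡ j

  -- In the last clause the condition is symmetric in j and j′, and for a given j each residue below
  -- c determines one j′; this is the c-regular graph between R₁ and R₂.
  E : V → V → Set
  E (σ , inj₁ i) (τ , inj₁ i′) = σ ≢ τ
  E (σ , inj₁ i) (τ , inj₂ j)  = σ ≡ τ ⊎ Q i j
  E (σ , inj₂ j) (τ , inj₁ i)  = σ ≡ τ ⊎ Q i j
  E (σ , inj₂ j) (τ , inj₂ j′) = σ ≢ τ × (toℕ j + toℕ j′) % ρ < c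

  Q? : ∀ i j → Dec (Q i j)
  Q? i j = any? (λ s → residue (toℕ (combine {p} {h} i s)) ≟ᶠ j)

  E? : ∀ u v → Dec (E u v)
  E? (σ , inj₁ i) (τ , inj₁ i′) = ¬? (σ ≟ᵇ τ)
  E? (σ , inj₁ i) (τ , inj₂ j)  = (σ ≟ᵇ τ) ⊎-dec Q? i j
  E? (σ , inj₂ j) (τ , inj₁ i)  = (σ ≟ᵇ τ) ⊎-dec Q? i j
  E? (σ , inj₂ j) (τ , inj₂ j′) = ¬? (σ ≟ᵇ τ) ×-dec (_ <? c)

  E-sym : ∀ u v → E u v → E v u
  E-sym (σ , inj₁ i) (τ , inj₁ i′) ne        = ne ∘ sym
  E-sym (σ , inj₁ i) (τ , inj₂ j)  (inj₁ eq) = inj₁ (sym eq)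
  E-sym (σ , inj₁ i) (τ , inj₂ j)  (inj₂ q)  = inj₂ q
  E-sym (σ , inj₂ j) (τ , inj₁ i)  (inj₁ eq) = inj₁ (sym eq)
  E-sym (σ , inj₂ j) (τ , inj₁ i)  (inj₂ q)  = inj₂ q
  E-sym (σ , inj₂ j) (τ , inj₂ j′) (ne , lt) = ne ∘ sym , subst (λ x → x % ρ < c) (+-comm (toℕ j) _) lt

  E-irrefl : ∀ v → ¬ E v v
  E-irrefl (σ , inj₁ i) ne       = ne refl
  E-irrefl (σ , inj₂ j) (ne , _) = ne refl

  module D = Doubled (p + ρ)

  φ : Fin (2 * (p + ρ)) → V
  φ x = map₂ (splitAt p) (D.fromFin x)

  ψ : V → Fin (2 * (p + ρ))
  ψ v = D.toFin (map₂ (join p ρ) v)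

  φ-injective : Injective _≡_ _≡_ φ
  φ-injective eq = D.fromFin-injective (cong₂ _,_ (cong proj₁ eq) (splitAt-injective p (cong proj₂ eq)))

  ψ-injective : Injective _≡_ _≡_ ψ
  ψ-injective {σ , x} {τ , y} eq =
    let eq′ = D.toFin-injective {σ , join p ρ x} {τ , join p ρ y} eq
    in cong₂ _,_ (cong proj₁ eq′)
         (trans (sym (splitAt-join p ρ x)) (trans (cong (splitAt p) (cong proj₂ eq′)) (splitAt-join p ρ y)))

  open Avoiding E E? (λ {u} {v} → E-sym u v) (λ {v} → E-irrefl v) φ φ-injective ψ ψ-injective

  opposite-side : ∀ {σ : Bool} → σ ≢ not σ
  opposite-side = not-¬ refl

  enough : 2 * (p + ρ) ≤ p + (ρ + h) + (p + a)
  enough = ≤-reflexive (identity p a h′)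
    where
    identity : ∀ p a h′ → 2 * (p + suc (a + h′)) ≡ p + (suc (a + h′) + suc h′) + (p + a)
    identity = solve-∀

  h≤ρ : h ≤ ρ
  h≤ρ = s≤s (m≤n+m h′ a)

  far : Fin p → Fin h → Fin ρ
  far i s = residue (toℕ (combine {p} {h} i s))

  -- The h edges at a vertex have consecutive numbers, and h ≤ ρ keeps their residues apart.
  far-injective : ∀ i → Injective _≡_ _≡_ (far i)
  far-injective i {s} {s′} eq = toℕ-injective (shift-injective (h * toℕ i)
    (<-≤-trans (toℕ<n s) h≤ρ) (<-≤-trans (toℕ<n s′) h≤ρ)
    (trans (cong residue (sym (toℕ-combine i s))) (trans eq (cong residue (toℕ-combine i s′)))))

  neighbours-I : ∀ σ i → Neighbours (p + (ρ + h)) (σ , inj₁ i)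
  neighbours-I σ i =
    [ across , [ own , beyond ]′ ∘ splitAt ρ ]′ ∘ splitAt p ,
    [,]-injective {f = across} (λ { refl → refl })
      ([,]-injective {f = own} {beyond} (λ { refl → refl }) beyond-injective (λ j s eq → opposite-side (cong proj₁ eq)))
      (λ i′ x → apart i′ (splitAt ρ x)) ,
    λ x → adjacent (splitAt p x)
    where
    across : Fin p → V
    across i′ = not σ , inj₁ i′
    own : Fin ρ → V
    own j = σ , inj₂ j
    beyond : Fin h → V
    beyond s = not σ , inj₂ (far i s)
    beyond-injective : Injective _≡_ _≡_ beyond
    beyond-injective eq = far-injective i (inj₂-injective (cong proj₂ eq))
    apart : ∀ i′ x → across i′ ≢ [ own , beyond ]′ x
    apart i′ (inj₁ _) ()
    apart i′ (inj₂ _) ()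
    adjacent : ∀ x → E (σ , inj₁ i) ([ across , [ own , beyond ]′ ∘ splitAt ρ ]′ x)
    adjacent (inj₁ i′) = opposite-side
    adjacent (inj₂ y) with splitAt ρ y
    ... | inj₁ j = inj₁ refl
    ... | inj₂ s = inj₂ (s , refl)

  -- What is left of the neighbourhood after removing the ρ + h listed vertices lies in the opposite
  -- I, an independent set.
  cover-I : ∀ σ i → Cover (ρ + h) (σ , inj₁ i)
  cover-I σ i = s , λ {a} {b} → hits a b
    where
    own : Fin ρ → V
    own j = σ , inj₂ j
    beyond : Fin h → V
    beyond s = not σ , inj₂ (far i s)
    s : Fin (ρ + h) → V
    s = [ own , beyond ]′ ∘ splitAt ρ
    hit : ∀ τ j → E (σ , inj₁ i) (τ , inj₂ j) → ∃[ l ] s l ≡ (τ , inj₂ j)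
    hit τ j (inj₁ refl) = join ρ h (inj₁ j) , cong [ own , beyond ]′ (splitAt-join ρ h (inj₁ j))
    hit τ j (inj₂ (t , refl)) with σ ≟ᵇ τ
    ... | yes refl = join ρ h (inj₁ (far i t)) , cong [ own , beyond ]′ (splitAt-join ρ h (inj₁ (far i t)))
    ... | no σ≢τ   = join ρ h (inj₂ t) , trans (cong [ own , beyond ]′ (splitAt-join ρ h (inj₂ t)))
      (cong (_, inj₂ (far i t)) (sym (¬-not (σ≢τ ∘ sym))))
    hits : ∀ a b → E (σ , inj₁ i) a → E (σ , inj₁ i) b → E a b → ∃[ l ] (s l ≡ a ⊎ s l ≡ b)
    hits (τ , inj₂ j) b ea _ _ = map₂ inj₁ (hit τ j ea)
    hits (τ , inj₁ _) (ω , inj₂ j) _ eb _ = map₂ inj₂ (hit ω j eb)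
    hits (τ , inj₁ _) (ω , inj₁ _) ea eb ab = contradiction ab (two-sides ea eb)

  -- The vertex of I at which edge number `k` starts, that is, k / h.
  host : ∀ k → k < p * h → Fin p
  host k k< = proj₁ (remQuot h (fromℕ< k<))

  host-Q : ∀ k (k< : k < p * h) j → residue k ≡ j → Q (host k k<) j
  host-Q k k< j eq = proj₂ (remQuot {p} h (fromℕ< k<)) ,
    trans (cong (residue ∘ toℕ) (combine-remQuot {p} h (fromℕ< k<))) (trans (cong residue (toℕ-fromℕ< k<)) eq)

  host-combine : ∀ i s {k} (k< : k < p * h) → toℕ (combine {p} {h} i s) ≡ k → host k k< ≡ i
  host-combine i s k< eq = cong proj₁ (trans (cong (remQuot h) (toℕ-injective (trans (toℕ-fromℕ< k<) (sym eq))))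
    (remQuot-combine i s))

  host-far : ∀ {k k′} (k< : k < p * h) (k′< : k′ < p * h) → k + h ≤ k′ → host k k< ≢ host k′ k′<
  host-far {k} {k′} k< k′< k+h≤k′ eq = <⇒≱ k′<i*h+h (≤-trans (+-monoˡ-≤ h i*h≤k) k+h≤k′)
    where
    remainder : ∀ {k} → k < p * h → Fin h
    remainder k< = proj₂ (remQuot {p} h (fromℕ< k<))
    split : ∀ {k} (k< : k < p * h) → k ≡ h * toℕ (host k k<) + toℕ (remainder k<)
    split k< = trans (sym (toℕ-fromℕ< k<)) (trans (cong toℕ (sym (combine-remQuot {p} h (fromℕ< k<))))
      (toℕ-combine {p} {h} (host _ k<) (remainder k<)))
    i*h≤k : h * toℕ (host k k<) ≤ k
    i*h≤k = ≤-trans (m≤m+n _ _) (≤-reflexive (sym (split k<)))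
    k′<i*h+h : k′ < h * toℕ (host k k<) + h
    k′<i*h+h = ≤-<-trans (≤-reflexive (trans (split k′<) (cong (λ i → h * toℕ i + toℕ (remainder k′<)) (sym eq))))
      (+-monoʳ-< (h * toℕ (host k k<)) (toℕ<n (remainder k′<)))

  -- The numbers of the edges that end at `j`. Those with q < κ are below p h for every j, the one
  -- with q = κ may or may not be, and all later ones are not.
  visit : Fin ρ → ℕ → ℕ
  visit j q = toℕ j + q * ρ

  visit< : ∀ j {q} → q < κ → visit j q < p * h
  visit< j {q} q<κ = <-≤-trans (+-monoˡ-< (q * ρ) (toℕ<n j)) (≤-trans (*-monoˡ-≤ ρ q<κ) κρ≤)

  near : Fin ρ → Fin κ → Fin p
  near j q = host (visit j (toℕ q)) (visit< j (toℕ<n q))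

  visit-gap : ∀ j {q q′} → q < q′ → visit j q + h ≤ visit j q′
  visit-gap j {q} {q′} q<q′ = begin
    toℕ j + q * ρ + h   ≤⟨ +-monoʳ-≤ _ h≤ρ ⟩
    toℕ j + q * ρ + ρ   ≡⟨ trans (+-assoc (toℕ j) (q * ρ) ρ) (cong (toℕ j +_) (+-comm (q * ρ) ρ)) ⟩
    toℕ j + suc q * ρ   ≤⟨ +-monoʳ-≤ (toℕ j) (*-monoˡ-≤ ρ q<q′) ⟩
    toℕ j + q′ * ρ      ∎
    where open ≤-Reasoning

  near-injective : ∀ j → Injective _≡_ _≡_ (near j)
  near-injective j {q} {q′} eq with <-cmp (toℕ q) (toℕ q′)
  ... | tri≈ _ q≡q′ _ = toℕ-injective q≡q′
  ... | tri< q<q′ _ _ = contradiction eq (host-far (visit< j (toℕ<n q)) (visit< j (toℕ<n q′)) (visit-gap j q<q′))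
  ... | tri> _ _ q′<q = contradiction (sym eq) (host-far (visit< j (toℕ<n q′)) (visit< j (toℕ<n q)) (visit-gap j q′<q))

  -- The solution j′ of j + j′ ≡ s modulo ρ.
  mate : Fin ρ → Fin c → Fin ρ
  mate j s = residue (toℕ s + opposite (toℕ j))

  mate-injective : ∀ j → Injective _≡_ _≡_ (mate j)
  mate-injective j {s} {s′} eq = toℕ-injective (shift-injective (opposite (toℕ j))
    (<-≤-trans (toℕ<n s) c≤ρ) (<-≤-trans (toℕ<n s′) c≤ρ)
    (trans (cong residue (+-comm _ (toℕ s))) (trans eq (cong residue (+-comm (toℕ s′) _)))))

  mate-sum : ∀ j s → (toℕ j + toℕ (mate j s)) % ρ ≡ toℕ s
  mate-sum j s = trans (cong (λ x → (toℕ j + x) % ρ) (toℕ-residue (toℕ s + opposite (toℕ j))))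
    (trans (reshift (toℕ j) (toℕ s)) (m<n⇒m%n≡m (<-≤-trans (toℕ<n s) c≤ρ)))

  mate-surjective : ∀ j j′ (lt : (toℕ j + toℕ j′) % ρ < c) → mate j (fromℕ< lt) ≡ j′
  mate-surjective j j′ lt = toℕ-injective (begin
    toℕ (mate j (fromℕ< lt))                          ≡⟨ toℕ-residue (toℕ (fromℕ< lt) + opposite (toℕ j)) ⟩
    (toℕ (fromℕ< lt) + opposite (toℕ j)) % ρ          ≡⟨ cong (λ x → (x + opposite (toℕ j)) % ρ) (toℕ-fromℕ< lt) ⟩
    ((toℕ j + toℕ j′) % ρ + opposite (toℕ j)) % ρ     ≡⟨ unshift (toℕ j) (toℕ j′) ⟩
    toℕ j′ % ρ                                        ≡⟨ m<n⇒m%n≡m (toℕ<n j′) ⟩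
    toℕ j′                                            ∎)
    where open ≡-Reasoning

  neighbours-R : ∀ σ j → Neighbours (p + (κ + c)) (σ , inj₂ j)
  neighbours-R σ j =
    [ own , [ across , beyond ]′ ∘ splitAt κ ]′ ∘ splitAt p ,
    [,]-injective {f = own} (λ { refl → refl })
      ([,]-injective {f = across} {beyond} (λ eq → near-injective j (inj₁-injective (cong proj₂ eq)))
        (λ eq → mate-injective j (inj₂-injective (cong proj₂ eq))) (λ _ _ ()))
      (λ i x → apart i (splitAt κ x)) ,
    λ x → adjacent (splitAt p x)
    where
    own : Fin p → V
    own i = σ , inj₁ i
    across : Fin κ → V
    across q = not σ , inj₁ (near j q)
    beyond : Fin c → V
    beyond s = not σ , inj₂ (mate j s)
    apart : ∀ i x → own i ≢ [ across , beyond ]′ x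
    apart i (inj₁ _) eq = opposite-side (cong proj₁ eq)
    apart i (inj₂ _) eq = opposite-side (cong proj₁ eq)
    adjacent : ∀ x → E (σ , inj₂ j) ([ own , [ across , beyond ]′ ∘ splitAt κ ]′ x)
    adjacent (inj₁ i) = inj₁ refl
    adjacent (inj₂ y) with splitAt κ y
    ... | inj₁ q = inj₂ (host-Q _ (visit< j (toℕ<n q)) j (toℕ-injective (trans (toℕ-residue (visit j (toℕ q)))
                     (trans ([m+kn]%n≡m%n (toℕ j) (toℕ q) ρ) (m<n⇒m%n≡m (toℕ<n j))))))
    ... | inj₂ s = opposite-side , subst (_< c) (sym (mate-sum j s)) (toℕ<n s)

  -- The rest of the neighbourhood lies in the own I, which is independent; the opposite I
  -- contributes at most κ + 1 vertices because p h ≤ (κ + 1)ρ.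
  cover-R : ∀ σ j → Cover (suc κ + c) (σ , inj₂ j)
  cover-R σ j = s , λ {a} {b} → hits a b
    where
    guest : Fin (suc κ) → V
    guest q with visit j (toℕ q) <? p * h
    ... | yes k< = not σ , inj₁ (host _ k<)
    -- If the edge numbered `visit j q` does not exist, the vertex itself fills its place in the
    -- list.
    ... | no  _  = σ , inj₂ j
    beyond : Fin c → V
    beyond t = not σ , inj₂ (mate j t)
    s : Fin (suc κ + c) → V
    s = [ guest , beyond ]′ ∘ splitAt (suc κ)
    hit-I : ∀ τ i → σ ≢ τ → Q i j → ∃[ l ] s l ≡ (τ , inj₁ i)
    hit-I τ i σ≢τ (t , eq) = join (suc κ) c (inj₁ q) ,
      trans (cong [ guest , beyond ]′ (splitAt-join (suc κ) c (inj₁ q)))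
        (trans guest-q (cong (_, inj₁ i) (sym (¬-not (σ≢τ ∘ sym)))))
      where
      k : ℕ
      k = toℕ (combine {p} {h} i t)
      q< : k / ρ < suc κ
      q< = m<n*o⇒m/o<n (<-≤-trans (toℕ<n (combine {p} {h} i t)) ≤κρ)
      q : Fin (suc κ)
      q = fromℕ< q<
      k-visit : k ≡ visit j (toℕ q)
      k-visit = trans (m≡m%n+[m/n]*n k ρ)
        (cong₂ _+_ (trans (sym (toℕ-residue k)) (cong toℕ eq)) (cong (_* ρ) (sym (toℕ-fromℕ< q<))))
      guest-q : guest q ≡ (not σ , inj₁ i)
      guest-q with visit j (toℕ q) <? p * h
      ... | yes k< = cong (λ i → not σ , inj₁ i) (host-combine i t k< k-visit)
      ... | no  k≮ = contradiction (subst (_< p * h) k-visit (toℕ<n (combine {p} {h} i t))) k≮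
    hit-R : ∀ τ j′ → E (σ , inj₂ j) (τ , inj₂ j′) → ∃[ l ] s l ≡ (τ , inj₂ j′)
    hit-R τ j′ (σ≢τ , lt) = join (suc κ) c (inj₂ (fromℕ< lt)) ,
      trans (cong [ guest , beyond ]′ (splitAt-join (suc κ) c (inj₂ (fromℕ< lt))))
        (cong₂ _,_ (sym (¬-not (σ≢τ ∘ sym))) (cong inj₂ (mate-surjective j j′ lt)))
    hits : ∀ a b → E (σ , inj₂ j) a → E (σ , inj₂ j) b → E a b → ∃[ l ] (s l ≡ a ⊎ s l ≡ b)
    hits (τ , inj₂ j′) b ea _ _ = map₂ inj₁ (hit-R τ j′ ea)
    hits (τ , inj₁ i) (ω , inj₂ j′) _ eb _ = map₂ inj₂ (hit-R ω j′ eb)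
    hits (τ , inj₁ i) (ω , inj₁ i′) ea eb ab with σ ≟ᵇ τ | σ ≟ᵇ ω
    ... | yes refl | yes refl = contradiction refl ab
    ... | no σ≢τ   | no σ≢ω   = contradiction ab (two-sides σ≢τ σ≢ω)
    hits (τ , inj₁ i) (ω , inj₁ i′) (inj₁ refl) eb ab | no σ≢τ | yes _ = contradiction refl σ≢τ
    hits (τ , inj₁ i) (ω , inj₁ i′) (inj₂ q)    eb ab | no σ≢τ | yes _ = map₂ inj₁ (hit-I τ i σ≢τ q)
    hits (τ , inj₁ i) (ω , inj₁ i′) ea (inj₁ refl) ab | yes _ | no σ≢ω = contradiction refl σ≢ω
    hits (τ , inj₁ i) (ω , inj₁ i′) ea (inj₂ q)    ab | yes _ | no σ≢ω = map₂ inj₂ (hit-I ω i′ σ≢ω q)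

  ρ+h≡κ+c : ρ + h ≡ κ + c
  ρ+h≡κ+c = trans (identity a h′) (sym κ+c)
    where
    identity : ∀ a h′ → suc (a + h′) + suc h′ ≡ a + 2 * suc h′
    identity = solve-∀

  construction-avoids : ¬ Arrows (2 * (p + ρ)) (star (p + a)) (fan (suc (suc (a + 2 * h))))
  construction-avoids = avoids nbrs covers
    where
    nbrs : ∀ v → ∃[ k ] 2 * (p + ρ) ≤ k + (p + a) × Neighbours k v
    nbrs (σ , inj₁ i) = _ , enough , neighbours-I σ i
    nbrs (σ , inj₂ j) = _ , subst (λ z → 2 * (p + ρ) ≤ p + z + (p + a)) ρ+h≡κ+c enough , neighbours-R σ j
    covers : ∀ v → ∃[ k ] k ≤ suc (a + 2 * h) × Cover k v
    covers (σ , inj₁ i) = _ , ≤-trans (≤-reflexive (trans ρ+h≡κ+c κ+c)) (n≤1+n _) , cover-I σ i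
    covers (σ , inj₂ j) = _ , ≤-reflexive (cong suc κ+c) , cover-R σ j

-- Choice of the parameters of the construction

last-before : ∀ {P : ℕ → Set} → (∀ k → Dec (P k)) → P 0 → ∀ b → ¬ P b → ∃[ k ] P k × ¬ P (suc k)
last-before P? p₀ zero    ¬p = contradiction p₀ ¬p
last-before P? p₀ (suc b) ¬p with P? b
... | yes p  = b , p , ¬p
... | no ¬p′ = last-before P? p₀ b ¬p′

-- With a = ν - 1 - 2h, ρ = a + h and p = m - a this is the inequality p h ≤ ν ρ: on average a
-- vertex of R receives at most ν edges from the opposite I.
Fits : ℕ → ℕ → ℕ → Set
Fits m ν h = h * (m + 2 * h) + h + ν ≤ ν * ν

¬fits-suc : ∀ {m ν} → suc ν < m → ¬ Fits m ν (suc ν)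
¬fits-suc {m} {ν} n<m fits =
  infeasible (4 + 9 * ν + 2 * (ν * ν)) (fits ⊞ scale (suc ν) n<m) (solve (m ∷ ν ∷ []))

positive-construction : ∀ a p h′ → let h = suc h′; ν = suc (a + 2 * h) in
  suc ν < p + a → Fits (p + a) ν h → ¬ Fits (p + a) ν (suc h) →
  ¬ Arrows (2 * (p + suc (a + h′))) (star (p + a)) (fan (suc ν))
positive-construction a p h′ n<m fits ¬fits =
  Construction.construction-avoids p a h′ κ c c≤ρ κρ≤ ≤κρ (m+[n∸m]≡n κ≤)
  where
  h ν ρ κ c : ℕ
  h = suc h′
  ν = suc (a + 2 * h)
  ρ = suc (a + h′)
  -- One less than the ceiling of p h / ρ. The plain quotient would be ν when p h = ν ρ, one too
  -- many for κ + c = ν - 1.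
  κ = (p * h ∸ 1) / ρ
  c = a + 2 * h ∸ κ

  -- This is where the maximality of h enters: if p ≤ ρ, then n < m forces a ≥ h + 3, and in that
  -- range h + 1 would still fit.
  ρ<p : ρ < p
  ρ<p = ≰⇒> λ p≤ρ → too-small p≤ρ
    (m≤n⇒∃[o]m+o≡n (linear {h + 3} {a} 0 (n<m ⊞ p≤ρ) (identity a p h′)))
    where
    identity : ∀ a p h′ → let h = suc h′ in
      a + (suc (suc (suc (a + 2 * h))) + p) ≡ h + 3 + (p + a + suc (a + h′)) + 0
    identity = solve-∀
    too-small : p ≤ ρ → ¬ (∃[ x ] h + 3 + x ≡ a)
    too-small p≤ρ (x , refl) =
      infeasible (14 + 15 * h′ + 4 * (h′ * h′) + 4 * (h′ * x) + 9 * x + x * x)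
        (≰⇒> ¬fits ⊞ scale (suc h) p≤ρ) (expand p h′ x)
      where
      expand : ∀ p h′ x → let h = suc h′; a = h + 3 + x; ν = suc (a + 2 * h); ρ = suc (a + h′) in
        suc (ν * ν) + suc h * p ≡ 1 + (suc h * (p + a + 2 * suc h) + suc h + ν + suc h * ρ)
          + (14 + 15 * h′ + 4 * (h′ * h′) + 4 * (h′ * x) + 9 * x + x * x)
      expand = solve-∀

  1≤ph : 1 ≤ p * h
  1≤ph = *-mono-≤ (≤-trans (s≤s z≤n) ρ<p) (s≤s z≤n)

  ph∸1<ph : p * h ∸ 1 < p * h
  ph∸1<ph = ≤-reflexive (m+[n∸m]≡n 1≤ph)

  ph≤νρ : p * h ≤ ν * ρ
  ph≤νρ = linear 0 fits (identity a p h′)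
    where
    identity : ∀ a p h′ → let h = suc h′; ν = suc (a + 2 * h) in
      ν * suc (a + h′) + (h * (p + a + 2 * h) + h + ν) ≡ p * h + ν * ν + 0
    identity = solve-∀

  κ≤ : κ ≤ a + 2 * h
  κ≤ = ≤-pred (m<n*o⇒m/o<n (<-≤-trans ph∸1<ph ph≤νρ))

  -- Equivalent to c ≤ ρ, as c = a + 2h - κ and ρ = a + h.
  h≤κ : h ≤ κ
  h≤κ = ≤-trans (≤-reflexive (sym (m*n/n≡m h ρ))) (/-monoˡ-≤ ρ (≤-pred (begin
    suc (h * ρ)         ≤⟨ s≤s (m≤n+m (h * ρ) h′) ⟩
    h + h * ρ           ≡⟨ *-suc h ρ ⟨
    h * suc ρ           ≤⟨ *-monoʳ-≤ h ρ<p ⟩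
    h * p               ≡⟨ *-comm h p ⟩
    p * h               ≡⟨ m+[n∸m]≡n 1≤ph ⟨
    suc (p * h ∸ 1)     ∎)))
    where open ≤-Reasoning

  c≤ρ : c ≤ ρ
  c≤ρ = linear 0 (≤-reflexive (m∸n+n≡m κ≤) ⊞ h≤κ) (identity c κ a h′)
    where
    identity : ∀ c κ a h′ → suc (a + h′) + (c + κ + suc h′) ≡ c + (a + 2 * suc h′ + κ) + 0
    identity = solve-∀

  κρ≤ : κ * ρ ≤ p * h
  κρ≤ = ≤-trans (m/n*n≤m (p * h ∸ 1) ρ) (m∸n≤m (p * h) 1)

  ≤κρ : p * h ≤ suc κ * ρ
  ≤κρ = begin
    p * h                             ≡⟨ m+[n∸m]≡n 1≤ph ⟨
    suc (p * h ∸ 1)                   ≡⟨ cong suc (m≡m%n+[m/n]*n (p * h ∸ 1) ρ) ⟩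
    suc ((p * h ∸ 1) % ρ) + κ * ρ     ≤⟨ +-monoˡ-≤ (κ * ρ) (m%n<n (p * h ∸ 1) ρ) ⟩
    suc κ * ρ                         ∎
    where open ≤-Reasoning

-- Maximality of h says 2ν² < 2(h + 1)(m + 2h + 3) + 2ν. Passing from 2ν² to 2n² costs another 4ν +
-- 2, and raising 2h + 2 to 2h + 9 gains at least 7m > 7n, which pays for both.
lower-construction : ∀ {ν m} → 1 ≤ ν → suc ν < m →
  ∃[ h ] ¬ Arrows (2 * (m + h)) (star m) (fan (suc ν)) × 2 * (suc ν * suc ν) < (m + 2 * h + 9) * (2 * h + 9)
lower-construction {ν} {m} 1≤ν n<m
  with h , fits , ¬fits ← last-before {Fits m ν} (λ h → h * (m + 2 * h) + h + ν ≤? ν * ν)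
         (m≤n*m ν ν {{>-nonZero 1≤ν}}) (suc ν) (¬fits-suc n<m)
  = h , avoids h fits ¬fits ,
    linear (88 + 26 * h + ν) (scale 2 (≰⇒> ¬fits) ⊞ scale 7 n<m) (solve (h ∷ m ∷ ν ∷ []))
  where
  avoids : ∀ h → Fits m ν h → ¬ Fits m ν (suc h) → ¬ Arrows (2 * (m + h)) (star m) (fan (suc ν))
  avoids zero fits ¬fits =
    subst (λ N → ¬ Arrows (2 * N) (star m) (fan (suc ν))) (sym (+-identityʳ m)) (complete-bipartite-avoids m ν)
  avoids (suc h′) fits ¬fits = by-parts (m≤n⇒∃[o]m+o≡n 2h<ν)
    where
    -- Makes a = ν - 1 - 2h a natural number.
    2h<ν : 2 * suc h′ < ν
    2h<ν = ≰⇒> λ ν≤2h → infeasible (suc h′ + ν)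
      (fits ⊞ scaleʳ (ν + 1) ν≤2h ⊞ scale (suc h′) ν≤2h ⊞ scale (suc h′) n<m ⊞ 1≤ν)
      (identity (suc h′) m ν)
      where
      identity : ∀ h m ν → h * (m + 2 * h) + h + ν + (ν * (ν + 1) + (h * ν + (h * suc (suc ν) + 1)))
        ≡ 1 + (ν * ν + (2 * h * (ν + 1) + (h * (2 * h) + (h * m + ν)))) + (h + ν)
      identity = solve-∀
    shape : ∀ a p h′ → p + suc (a + h′) ≡ p + a + suc h′
    shape = solve-∀
    by-parts : ∃[ a ] suc (2 * suc h′) + a ≡ ν → ¬ Arrows (2 * (m + suc h′)) (star m) (fan (suc ν))
    by-parts (a , 2h+a≡ν)
      with refl ← trans (cong suc (+-comm a (2 * suc h′))) 2h+a≡ν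
      with p , a+p≡m ← m≤n⇒∃[o]m+o≡n (linear {a} {m} (5 + 2 * h′) n<m (solve (a ∷ h′ ∷ m ∷ [])))
      with refl ← trans (+-comm p a) a+p≡m
      = subst (λ N → ¬ Arrows (2 * N) (star m) (fan (suc ν))) (shape a p h′) (positive-construction a p h′ n<m fits ¬fits)

open import Algebra.Properties.CommutativeMonoid.Sum +-0-commutativeMonoid
  using (sum; sum-cong-≗; ∑-distrib-+; ∑-comm)
open import Algebra.Properties.Semiring.Sum +-*-semiring using (*-distribˡ-sum; *-distribʳ-sum)
open import Data.List.Relation.Unary.All as All using (All; []; _∷_)
open import Data.List.Relation.Unary.All.Properties using (++⁺; ++⁻ˡ; ++⁻ʳ)
open import Data.Vec.Base as Vec using (Vec; []; _∷_)
open import Data.Vec.Properties using (lookup∘tabulate)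

-- The upper bound

-- Weights Fin N → ℕ bounded by 1 play the role of subsets.

Weight : ℕ → Set
Weight N = Fin N → ℕ

sum-mono : ∀ {k} {f g : Fin k → ℕ} → (∀ i → f i ≤ g i) → sum f ≤ sum g
sum-mono {zero}  f≤g = z≤n
sum-mono {suc k} f≤g = +-mono-≤ (f≤g zero) (sum-mono (f≤g ∘ suc))

term≤sum : ∀ {k} (f : Fin k → ℕ) i → f i ≤ sum f
term≤sum f zero    = m≤m+n _ _
term≤sum f (suc i) = ≤-trans (term≤sum (f ∘ suc) i) (m≤n+m _ _)

δ : ∀ {N} → Fin N → Weight N
δ zero    zero    = 1
δ zero    (suc w) = 0
δ (suc v) zero    = 0
δ (suc v) (suc w) = δ v w

sum-zero : ∀ k → sum {k} (λ _ → 0) ≡ 0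
sum-zero zero    = refl
sum-zero (suc k) = sum-zero k

sum-one : ∀ k → sum {k} (λ _ → 1) ≡ k
sum-one zero    = refl
sum-one (suc k) = cong suc (sum-one k)

sum-δ* : ∀ {N} (v : Fin N) (f : Fin N → ℕ) → sum (λ w → δ v w * f w) ≡ f v
sum-δ* {suc N} zero f =
  trans (cong₂ _+_ (+-identityʳ (f zero)) (sum-zero N)) (+-identityʳ (f zero))
sum-δ* (suc v) f = sum-δ* v (f ∘ suc)

sum-δ : ∀ {N} (v : Fin N) → sum (δ v) ≡ 1
sum-δ v = trans (sum-cong-≗ (λ w → sym (*-identityʳ (δ v w)))) (sum-δ* v (λ _ → 1))

δ-refl : ∀ {N} (v : Fin N) → δ v v ≡ 1
δ-refl zero    = refl
δ-refl (suc v) = δ-refl v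

δ-≢ : ∀ {N} {v w : Fin N} → v ≢ w → δ v w ≡ 0
δ-≢ {v = zero}  {zero}  v≢w = contradiction refl v≢w
δ-≢ {v = zero}  {suc w} v≢w = refl
δ-≢ {v = suc v} {zero}  v≢w = refl
δ-≢ {v = suc v} {suc w} v≢w = δ-≢ (v≢w ∘ cong suc)

select : ∀ {N} (f : Weight N) → (∀ w → f w ≤ 1) → ∀ {k} → k ≤ sum f →
  ∃[ g ] Injective {A = Fin k} {B = Fin N} _≡_ _≡_ g × (∀ i → 1 ≤ f (g i))
select f f≤1 {zero} _ = (λ ()) , (λ { {()} }) , λ ()
select {suc N} f f≤1 {suc k} k<sum with f zero in f₀ | f≤1 zero
... | 0 | _ =
  let (g , g-inj , g∈f) = select (f ∘ suc) (f≤1 ∘ suc) k<sum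
  in suc ∘ g , g-inj ∘ suc-injective , g∈f
... | 1 | _ =
  let (g , g-inj , g∈f) = select (f ∘ suc) (f≤1 ∘ suc) (≤-pred k<sum)
  in (λ { zero → zero ; (suc i) → suc (g i) }) ,
     (λ { {zero} {zero} _ → refl ; {suc i} {suc j} eq → cong suc (g-inj (suc-injective eq)) }) ,
     (λ { zero → ≤-reflexive (sym f₀) ; (suc i) → g∈f i })
... | suc (suc _) | s≤s ()

-- Each vertex in turn keeps as much of its weight as the remainder of `k` allows.
trim : ∀ {N} (f : Weight N) → ∀ {k} → k ≤ sum f →
  ∃[ h ] (∀ w → h w ≤ f w) × sum h ≡ k
trim {zero}  f {zero} _ = f , (λ ()) , refl
trim {suc N} f {k} k≤sum =
  let (h , h≤f , sum-h) = trim (f ∘ suc) (m≤n+o⇒m∸n≤o k (f zero) k≤sum)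
  in (λ { zero → k ⊓ f zero ; (suc w) → h w }) ,
     (λ { zero → m⊓n≤n k (f zero) ; (suc w) → h≤f w }) ,
     trans (cong (k ⊓ f zero +_) sum-h) (m⊓n+n∸m≡n′ k (f zero))
  where
  m⊓n+n∸m≡n′ : ∀ a b → a ⊓ b + (a ∸ b) ≡ a
  m⊓n+n∸m≡n′ a b = trans (cong (_+ (a ∸ b)) (⊓-comm a b)) (m⊓n+n∸m≡n b a)

pick : ∀ {N} (f : Weight N) → 1 ≤ sum f → ∃[ w ] 1 ≤ f w
pick {suc N} f 1≤sum with f zero in f₀
... | suc _ = zero , subst (1 ≤_) (sym f₀) (s≤s z≤n)
... | zero  = let (w , w∈f) = pick (f ∘ suc) 1≤sum in suc w , w∈f

pick-other : ∀ {N} (f : Weight N) → (∀ w → f w ≤ 1) → 2 ≤ sum f → ∀ v → ∃[ w ] w ≢ v × 1 ≤ f w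
pick-other f f≤1 2≤sum v =
  let (g , g-inj , g∈f) = select f f≤1 2≤sum
  in case g zero ≟ᶠ v of λ where
       (no  g₀≢v) → g zero , g₀≢v , g∈f zero
       (yes g₀≡v) → g (suc zero) ,
         (λ g₁≡v → contradiction (g-inj (trans g₀≡v (sym g₁≡v))) (λ ())) , g∈f (suc zero)

*-factors : ∀ m n → 1 ≤ m * n → 1 ≤ m × 1 ≤ n
*-factors (suc m) zero    p = contradiction (subst (1 ≤_) (*-zeroʳ m) p) (λ ())
*-factors (suc m) (suc n) p = s≤s z≤n , s≤s z≤n

≱1⇒≡0 : ∀ {m} → ¬ 1 ≤ m → m ≡ 0
≱1⇒≡0 {zero}  _ = refl
≱1⇒≡0 {suc m} h = contradiction (s≤s z≤n) h

-- Matchings and the weak decomposition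

Edges : ℕ → Set
Edges N = List (Fin N × Fin N)

-- Counts edge ends, so that a bound `occ M w ≤ U w` with `U` at most 1 says at once that the edges
-- are disjoint, are no loops and lie in `U`.
occ : ∀ {N} → Edges N → Weight N
occ []            w = 0
occ ((c , d) ∷ M) w = δ c w + δ d w + occ M w

occ-++ : ∀ {N} (M M′ : Edges N) w → occ (M ++ M′) w ≡ occ M w + occ M′ w
occ-++ []            M′ w = refl
occ-++ ((c , d) ∷ M) M′ w =
  trans (cong (δ c w + δ d w +_) (occ-++ M M′ w)) (sym (+-assoc (δ c w + δ d w) _ _))

sum-occ* : ∀ {N} (M : Edges N) (h : Fin N → ℕ) b → All (λ (c , d) → h c ≤ b × h d ≤ b) M →
  sum (λ w → occ M w * h w) ≤ length M * (2 * b)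
sum-occ* {N} []      h b [] = ≤-reflexive (sum-zero N)
sum-occ* ((c , d) ∷ M) h b ((hc , hd) ∷ hM) = begin
  sum (λ w → (δ c w + δ d w + occ M w) * h w)
    ≡⟨ sum-cong-≗ (λ w → dist (δ c w) (δ d w) (occ M w) (h w)) ⟩
  sum (λ w → δ c w * h w + (δ d w * h w + occ M w * h w))
    ≡⟨ ∑-distrib-+ (λ w → δ c w * h w) _ ⟩
  sum (λ w → δ c w * h w) + sum (λ w → δ d w * h w + occ M w * h w)
    ≡⟨ cong₂ _+_ (sum-δ* c h) (trans (∑-distrib-+ (λ w → δ d w * h w) _) (cong (_+ _) (sum-δ* d h))) ⟩
  h c + (h d + sum (λ w → occ M w * h w))
    ≤⟨ +-mono-≤ hc (+-mono-≤ hd (sum-occ* M h b hM)) ⟩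
  b + (b + length M * (2 * b))
    ≡⟨ assoc′ b (length M) ⟩
  suc (length M) * (2 * b) ∎
  where
  open ≤-Reasoning
  dist : ∀ p q r s → (p + q + r) * s ≡ p * s + (q * s + r * s)
  dist = solve-∀
  assoc′ : ∀ b l → b + (b + l * (2 * b)) ≡ suc l * (2 * b)
  assoc′ = solve-∀

sum-occ : ∀ {N} (M : Edges N) → sum (occ M) ≡ 2 * length M
sum-occ {N} []            = sum-zero N
sum-occ ((c , d) ∷ M) = begin
  sum (λ w → δ c w + δ d w + occ M w)        ≡⟨ ∑-distrib-+ (λ w → δ c w + δ d w) (occ M) ⟩
  sum (λ w → δ c w + δ d w) + sum (occ M)    ≡⟨ cong₂ _+_ (∑-distrib-+ (δ c) (δ d)) (sum-occ M) ⟩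
  sum (δ c) + sum (δ d) + 2 * length M       ≡⟨ cong₂ (λ x y → x + y + 2 * length M) (sum-δ c) (sum-δ d) ⟩
  2 + 2 * length M                           ≡⟨ *-suc 2 (length M) ⟨
  2 * suc (length M)                         ∎
  where open ≡-Reasoning

split? : ∀ {A : Set} {P : A → Set} → (∀ x → Dec (P x)) → (xs : List A) →
  All P xs ⊎ ∃[ ys ] ∃[ x ] ∃[ zs ] xs ≡ ys ++ x ∷ zs × ¬ P x
split? P? []       = inj₁ []
split? P? (x ∷ xs) with P? x | split? P? xs
... | no ¬p | _ = inj₂ ([] , x , xs , refl , ¬p)
... | yes p | inj₁ all = inj₁ (p ∷ all)
... | yes p | inj₂ (ys , y , zs , eq , ¬p) = inj₂ (x ∷ ys , y , zs , cong (x ∷_) eq , ¬p)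

module Matchings {N : ℕ} (g : Fin N → Fin N → ℕ) (g≤1 : ∀ u v → g u v ≤ 1)
  (g-sym : ∀ u v → g u v ≡ g v u) (g-irrefl : ∀ v → g v v ≡ 0) where

  Edge : Fin N × Fin N → Set
  Edge (c , d) = 1 ≤ g c d

  deg : Fin N → Weight N → ℕ
  deg v P = sum (λ w → g v w * P w)

  Matching : Weight N → ℕ → Set
  Matching U k = ∃[ M ] All Edge M × length M ≡ k × (∀ w → occ M w ≤ U w)

  -- S can be matched into J avoiding any two members of J, so an edge inside J enlarges
  -- the matching.  If an end c of an edge (c , d) of Z has two neighbours in J, then c may
  -- join S and d may join J.

  record State (U : Weight N) (k : ℕ) : Set where
    field
      S J       : Weight N
      Z         : Edges N
      edges     : All Edge Z
      partition : ∀ w → J w + S w + occ Z w ≡ U w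
      size      : sum S + length Z ≡ k
      rematch   : ∀ {i j} → 1 ≤ J i → 1 ≤ J j → i ≢ j →
        ∃[ M ] All Edge M × length M ≡ sum S × (∀ w → occ M w + (δ i w + δ j w) ≤ J w + S w)

  -- What remains of the Gallai–Edmonds decomposition of the subgraph on U:
  -- S meets every edge at J, except for few edges between J and X.

  record Structure (U : Weight N) (k : ℕ) : Set where
    field
      S J X       : Weight N
      f           : ℕ
      partition   : ∀ w → J w + S w + X w ≡ U w
      size        : sum S + f ≤ k
      sum-X       : sum X ≡ 2 * f
      independent : ∀ {i j} → 1 ≤ J i → 1 ≤ J j → g i j ≡ 0
      few         : sum (λ w → X w * deg w J) ≤ 2 * f

  module _ {U : Weight N} (U≤1 : ∀ w → U w ≤ 1) where

    module _ {k} (σ : State U k) where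
      open State σ

      J≤1 : ∀ w → J w ≤ 1
      J≤1 w = ≤-trans (≤-trans (m≤m+n (J w) _) (≤-reflexive (trans (sym (+-assoc (J w) _ _)) (partition w)))) (U≤1 w)

      augment : ∀ {i j} → 1 ≤ J i → 1 ≤ J j → 1 ≤ g i j → Matching U (suc k)
      augment {i} {j} i∈J j∈J ij =
        (i , j) ∷ M ++ Z , ij ∷ ++⁺ M-edges edges ,
        cong suc (trans (length-++ M) (trans (cong (_+ length Z) len) size)) ,
        λ w → begin
          δ i w + δ j w + occ (M ++ Z) w       ≡⟨ cong (δ i w + δ j w +_) (occ-++ M Z w) ⟩
          δ i w + δ j w + (occ M w + occ Z w)  ≡⟨ shuffle (δ i w) (δ j w) (occ M w) (occ Z w) ⟩
          occ M w + (δ i w + δ j w) + occ Z w  ≤⟨ +-monoˡ-≤ (occ Z w) (bound w) ⟩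
          J w + S w + occ Z w                  ≡⟨ partition w ⟩
          U w                                  ∎
        where
        open ≤-Reasoning
        i≢j : i ≢ j
        i≢j refl = contradiction (subst (1 ≤_) (g-irrefl i) ij) (λ ())
        shuffle : ∀ a b c d → a + b + (c + d) ≡ c + (a + b) + d
        shuffle = solve-∀
        r = rematch i∈J j∈J i≢j
        M = proj₁ r
        M-edges = proj₁ (proj₂ r)
        len = proj₁ (proj₂ (proj₂ r))
        bound = proj₂ (proj₂ (proj₂ r))

      -- If d is not among the two vertices to be avoided, the edge (c , d) extends an old
      -- rematching. If d and j are to be avoided, c needs a partner x ≠ j in J, which its two
      -- neighbours there provide, and the old rematching is made to avoid x and j; hence the
      -- invariant speaks of two vertices.
      grow : ∀ Z₁ {c d} Z₂ → (∀ w → occ Z w ≡ δ c w + δ d w + occ (Z₁ ++ Z₂) w) →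
        All Edge (Z₁ ++ Z₂) → length Z ≡ suc (length (Z₁ ++ Z₂)) → 1 ≤ g c d → 2 ≤ deg c J →
        ∃[ σ′ ] State.Z {U} {k} σ′ ≡ Z₁ ++ Z₂
      grow Z₁ {c} {d} Z₂ occ-Z edges′ len-Z cd c-deg = record
        { S = S′ ; J = J′ ; Z = Z₁ ++ Z₂ ; edges = edges′
        ; partition = λ w → trans (shuffle₁ (J w) (S w) (δ c w) (δ d w) _)
            (trans (cong (J w + S w +_) (sym (occ-Z w))) (partition w))
        ; size = trans (cong (_+ length (Z₁ ++ Z₂)) sum-S′)
            (trans (sym (+-suc (sum S) _)) (trans (cong (sum S +_) (sym len-Z)) size))
        ; rematch = rematch′ } , refl
        where
        S′ J′ : Weight N
        S′ w = δ c w + S w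
        J′ w = δ d w + J w

        shuffle₁ : ∀ j s c d z → d + j + (c + s) + z ≡ j + s + (c + d + z)
        shuffle₁ = solve-∀

        sum-S′ : sum S′ ≡ suc (sum S)
        sum-S′ = trans (∑-distrib-+ (δ c) S) (cong (_+ sum S) (sum-δ c))

        neighbour : ∀ v → ∃[ x ] x ≢ v × 1 ≤ g c x × 1 ≤ J x
        neighbour v =
          let (x , x≢v , x∈) = pick-other (λ w → g c w * J w)
                (λ w → *-mono-≤ (g≤1 c w) (J≤1 w)) c-deg v
          in x , x≢v , *-factors (g c x) (J x) x∈

        old : ∀ {v} → d ≢ v → 1 ≤ J′ v → 1 ≤ J v
        old {v} d≢v = subst (λ e → 1 ≤ e + J v) (δ-≢ d≢v)

        with-d : ∀ {j} → 1 ≤ J j → ∃[ M ] All Edge M × length M ≡ sum S′ ×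
          (∀ w → occ M w + (δ d w + δ j w) ≤ J′ w + S′ w)
        with-d {j} j∈J =
          let (x , x≢j , cx , x∈J)       = neighbour j
              (M , M-edges , len , bound) = rematch x∈J j∈J x≢j
          in (c , x) ∷ M , cx ∷ M-edges , trans (cong suc len) (sym sum-S′) ,
             λ w → linear 0 (bound w)
               (shuffle (J w) (S w) (δ c w) (δ d w) (δ x w) (δ j w) (occ M w))
          where
          shuffle : ∀ J S c d x j o →
            (d + J) + (c + S) + (o + (x + j)) ≡ c + x + o + (d + j) + (J + S) + 0
          shuffle = solve-∀

        rematch′ : ∀ {i j} → 1 ≤ J′ i → 1 ≤ J′ j → i ≢ j → ∃[ M ] All Edge M × length M ≡ sum S′ ×
          (∀ w → occ M w + (δ i w + δ j w) ≤ J′ w + S′ w)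
        rematch′ {i} {j} i∈J′ j∈J′ i≢j with d ≟ᶠ i | d ≟ᶠ j
        ... | yes refl | yes refl = contradiction refl i≢j
        ... | yes refl | no  d≢j  = with-d (old d≢j j∈J′)
        ... | no  d≢i  | yes refl =
          let (M , M-edges , len , bound) = with-d (old d≢i i∈J′)
          in M , M-edges , len ,
             λ w → subst (λ e → occ M w + e ≤ J′ w + S′ w) (+-comm (δ d w) (δ i w)) (bound w)
        ... | no  d≢i  | no  d≢j  =
          let (M , M-edges , len , bound) = rematch (old d≢i i∈J′) (old d≢j j∈J′) i≢j
          in (c , d) ∷ M , cd ∷ M-edges , trans (cong suc len) (sym sum-S′) ,
             λ w → linear 0 (bound w)
               (shuffle (J w) (S w) (δ c w) (δ d w) (δ i w) (δ j w) (occ M w))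
          where
          shuffle : ∀ J S c d i j o →
            (d + J) + (c + S) + (o + (i + j)) ≡ c + d + o + (i + j) + (J + S) + 0
          shuffle = solve-∀

      finish : (∀ {i j} → 1 ≤ J i → 1 ≤ J j → g i j ≡ 0) →
        All (λ (c , d) → deg c J ≤ 1 × deg d J ≤ 1) Z → Structure U k
      finish indep light = record
        { S = S ; J = J ; X = occ Z ; f = length Z ; partition = partition
        ; size = ≤-reflexive size ; sum-X = sum-occ Z ; independent = indep
        ; few = ≤-trans (sum-occ* Z (λ w → deg w J) 1 light) (≤-reflexive (*-comm (length Z) 2)) }

    -- Each application of `grow` removes an edge from Z, so the process ends with an edge inside J
    -- or with only light edges in Z; `z` is the fuel.
    refine : ∀ {k} z (σ : State U k) → length (State.Z σ) ≤ z → Matching U (suc k) ⊎ Structure U k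
    refine z σ len≤z
      with any? (λ i → any? (λ j → (1 ≤? State.J σ i) ×-dec (1 ≤? State.J σ j) ×-dec (1 ≤? g i j)))
    ... | yes (i , j , i∈J , j∈J , ij) = inj₁ (augment σ i∈J j∈J ij)
    ... | no none
      with split? (λ (c , d) → (deg c (State.J σ) ≤? 1) ×-dec (deg d (State.J σ) ≤? 1)) (State.Z σ)
    ...   | inj₁ light =
            inj₂ (finish σ (λ {i} {j} i∈J j∈J → ≱1⇒≡0 (λ ij → none (i , j , i∈J , j∈J , ij))) light)
    ...   | inj₂ (Z₁ , (c , d) , Z₂ , eq , heavy) = continue z len≤z
      where
      open State σ

      cd∷ : All Edge ((c , d) ∷ Z₂)
      cd∷ = ++⁻ʳ Z₁ (subst (All Edge) eq edges)

      edges′ : All Edge (Z₁ ++ Z₂)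
      edges′ = ++⁺ (++⁻ˡ Z₁ (subst (All Edge) eq edges)) (All.tail cd∷)

      len-Z : length Z ≡ suc (length (Z₁ ++ Z₂))
      len-Z = trans (cong length eq) (trans (length-++ Z₁)
        (trans (+-suc (length Z₁) _) (cong suc (sym (length-++ Z₁)))))

      occ-Z : ∀ w → occ Z w ≡ δ c w + δ d w + occ (Z₁ ++ Z₂) w
      occ-Z w = trans (cong (λ M → occ M w) eq) (trans (occ-++ Z₁ _ w)
        (trans (shuffle (occ Z₁ w) (δ c w + δ d w) (occ Z₂ w))
          (cong (δ c w + δ d w +_) (sym (occ-++ Z₁ Z₂ w)))))
        where
        shuffle : ∀ x y z → x + (y + z) ≡ y + (x + z)
        shuffle = solve-∀

      next : ∃[ σ′ ] State.Z {U} σ′ ≡ Z₁ ++ Z₂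
      next with deg c J ≤? 1
      ... | no  c-heavy = grow σ Z₁ Z₂ occ-Z edges′ len-Z (All.head cd∷) (≰⇒> c-heavy)
      ... | yes c-light = grow σ Z₁ Z₂
        (λ w → trans (occ-Z w) (cong (_+ occ (Z₁ ++ Z₂) w) (+-comm (δ c w) (δ d w))))
        edges′ len-Z (subst (1 ≤_) (g-sym c d) (All.head cd∷))
        (≰⇒> (λ d-light → heavy (c-light , d-light)))

      continue : ∀ z → length Z ≤ z → Matching U (suc _) ⊎ Structure U _
      continue zero    len≤0 = contradiction (subst (_≤ 0) len-Z len≤0) λ ()
      continue (suc z) len≤z =
        let (σ′ , Z′) = next
        in refine z σ′ (subst (λ Z → length Z ≤ z) (sym Z′) (≤-pred (subst (_≤ suc z) len-Z len≤z)))

    -- A matching of k edges starts the process with S empty and J the unmatched vertices, where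
    -- `rematch` is trivial. Without such a matching, the structure obtained for k - 1 serves.
    structure : ∀ k → Matching U (suc k) ⊎ Structure U k
    structure k with step k
      where
      step : ∀ k → Matching U k ⊎ Structure U k
      step zero    = inj₁ ([] , [] , refl , λ _ → z≤n)
      step (suc k) with structure k
      ... | inj₁ M = inj₁ M
      ... | inj₂ σ = inj₂ record
        { S = S ; J = J ; X = X ; f = f ; partition = partition ; size = m≤n⇒m≤1+n size
        ; sum-X = sum-X ; independent = independent ; few = few }
        where open Structure σ
    ... | inj₂ σ = inj₂ σ
    ... | inj₁ (M , M-edges , len , M⊆U) = refine (length M) initial ≤-refl
      where
      J₀ : Weight N
      J₀ w = U w ∸ occ M w

      J₀+occ : ∀ w → J₀ w + occ M w ≡ U w
      J₀+occ w = m∸n+n≡m (M⊆U w)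

      initial : State U k
      initial = record
        { S = λ _ → 0 ; J = J₀ ; Z = M ; edges = M-edges
        ; partition = λ w → trans (cong (_+ occ M w) (+-identityʳ (J₀ w))) (J₀+occ w)
        ; size = trans (cong (_+ length M) (sum-zero N)) len
        ; rematch = λ {i} {j} i∈J j∈J i≢j → [] , [] , sym (sum-zero N) ,
            λ w → ≤-trans (δ+δ≤ i≢j i∈J j∈J w) (m≤m+n (J₀ w) 0) }
        where
        δ+δ≤ : ∀ {i j} → i ≢ j → 1 ≤ J₀ i → 1 ≤ J₀ j → ∀ w → δ i w + δ j w ≤ J₀ w
        δ+δ≤ {i} {j} i≢j i∈J j∈J w with i ≟ᶠ w | j ≟ᶠ w
        ... | yes refl | yes refl = contradiction refl i≢j
        ... | yes refl | no  j≢w  rewrite δ-refl i | δ-≢ j≢w = i∈J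
        ... | no  i≢w  | yes refl rewrite δ-refl j | δ-≢ i≢w = j∈J
        ... | no  i≢w  | no  j≢w  rewrite δ-≢ i≢w | δ-≢ j≢w = z≤n

-- Greedy matchings

mult : ∀ {N} → List (Fin N) → Weight N
mult []       w = 0
mult (x ∷ xs) w = δ x w + mult xs w

δ≤ : ∀ {N} (f : Weight N) {v} → 1 ≤ f v → ∀ w → δ v w ≤ f w
δ≤ f {v} v∈f w with v ≟ᶠ w
... | yes refl rewrite δ-refl v = v∈f
... | no  v≢w  rewrite δ-≢ v≢w = z≤n

elements : ∀ {N} (f : Weight N) k → sum f ≡ k →
  ∃[ xs ] length xs ≡ k × All (λ x → 1 ≤ f x) xs × (∀ w → mult xs w ≡ f w)
elements f zero    sum-f = [] , refl , [] , λ w → sym (n≤0⇒n≡0 (subst (f w ≤_) sum-f (term≤sum f w)))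
elements f (suc k) sum-f =
  let (x , x∈f) = pick f (subst (1 ≤_) (sym sum-f) (s≤s z≤n))
      f′+δ w    = m∸n+n≡m (δ≤ f x∈f w)
      (xs , len , xs∈f , mult-xs) = elements (λ w → f w ∸ δ x w) k (+-cancelʳ-≡ 1 _ k (begin
        sum (λ w → f w ∸ δ x w) + 1           ≡⟨ cong (sum (λ w → f w ∸ δ x w) +_) (sum-δ x) ⟨
        sum (λ w → f w ∸ δ x w) + sum (δ x)   ≡⟨ ∑-distrib-+ (λ w → f w ∸ δ x w) (δ x) ⟨
        sum (λ w → f w ∸ δ x w + δ x w)       ≡⟨ sum-cong-≗ f′+δ ⟩
        sum f                                 ≡⟨ sum-f ⟩
        suc k                                 ≡⟨ +-comm 1 k ⟩
        k + 1                                 ∎))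
  in x ∷ xs , cong suc len ,
     x∈f ∷ All.map (λ {w} w∈f′ → ≤-trans w∈f′ (m∸n≤m (f w) (δ x w))) xs∈f ,
     λ w → trans (cong (δ x w +_) (mult-xs w)) (trans (+-comm (δ x w) _) (f′+δ w))
  where open ≡-Reasoning

on-yes on-no : {A : Set} → Dec A → ℕ → ℕ
on-yes (yes _) n = n
on-yes (no  _) n = 0
on-no  (yes _) n = 0
on-no  (no  _) n = n

on-no+on-yes : ∀ {A : Set} (d : Dec A) n → on-no d n + on-yes d n ≡ n
on-no+on-yes (yes _) n = refl
on-no+on-yes (no  _) n = +-identityʳ n

on-yes-≡ : ∀ {A : Set} (d : Dec A) n → on-yes d n ≡ 0 ⊎ (A × on-yes d n ≡ n)
on-yes-≡ (yes a) n = inj₂ (a , refl)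
on-yes-≡ (no  _) n = inj₁ refl

on-no-≡ : ∀ {A : Set} (d : Dec A) n → on-no d n ≡ 0 ⊎ (¬ A × on-no d n ≡ n)
on-no-≡ (yes _)  n = inj₁ refl
on-no-≡ (no  ¬a) n = inj₂ (¬a , refl)

module _ {N : ℕ} {g : Fin N → Fin N → ℕ} (g≤1 : ∀ u v → g u v ≤ 1)
  (g-sym : ∀ u v → g u v ≡ g v u) (g-irrefl : ∀ v → g v v ≡ 0) where

  open Matchings g g≤1 g-sym g-irrefl

  deg-+ : ∀ v P Q → deg v (λ w → P w + Q w) ≡ deg v P + deg v Q
  deg-+ v P Q = trans (sum-cong-≗ (λ w → *-distribˡ-+ (g v w) (P w) (Q w)))
    (∑-distrib-+ (λ w → g v w * P w) (λ w → g v w * Q w))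

  deg-cong : ∀ v {P Q : Weight N} → (∀ w → P w ≡ Q w) → deg v P ≡ deg v Q
  deg-cong v P≗Q = sum-cong-≗ (λ w → cong (g v w *_) (P≗Q w))

  deg≤sum : ∀ v P → deg v P ≤ sum P
  deg≤sum v P = sum-mono (λ w → ≤-trans (*-monoˡ-≤ (P w) (g≤1 v w)) (≤-reflexive (*-identityˡ (P w))))

  -- Double counting of the edges between P and Q.
  deg-swap : ∀ P Q → sum (λ v → P v * deg v Q) ≡ sum (λ w → Q w * deg w P)
  deg-swap P Q = begin
    sum (λ v → P v * sum (λ w → g v w * Q w))    ≡⟨ sum-cong-≗ (λ v → *-distribˡ-sum (P v) (λ w → g v w * Q w)) ⟩
    sum (λ v → sum (λ w → P v * (g v w * Q w)))  ≡⟨ ∑-comm (λ v w → P v * (g v w * Q w)) ⟩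
    sum (λ w → sum (λ v → P v * (g v w * Q w)))
      ≡⟨ sum-cong-≗ (λ w → sum-cong-≗ (λ v → trans (cong (λ e → P v * (e * Q w)) (g-sym v w))
           (rotate (P v) (g w v) (Q w)))) ⟩
    sum (λ w → sum (λ v → Q w * (g w v * P v)))  ≡⟨ sum-cong-≗ (λ w → *-distribˡ-sum (Q w) (λ v → g w v * P v)) ⟨
    sum (λ w → Q w * sum (λ v → g w v * P v))    ∎
    where
    open ≡-Reasoning
    rotate : ∀ p e q → p * (e * q) ≡ q * (e * p)
    rotate = solve-∀

  -- What keeps a greedy choice from the end of the list from getting stuck: when x is reached, one
  -- vertex of Q has been spent on each later entry.
  data Choosable (Q : Weight N) : List (Fin N) → Set where
    []  : Choosable Q []
    _∷_ : ∀ {x xs} → length (x ∷ xs) ≤ deg x Q → Choosable Q xs → Choosable Q (x ∷ xs)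

  choosable-++ : ∀ {Q} b xs ys → length xs + length ys ≤ b → All (λ x → b ≤ deg x Q) xs →
    Choosable Q ys → Choosable Q (xs ++ ys)
  choosable-++ b []       ys len≤b []       c = c
  choosable-++ b (x ∷ xs) ys len≤b (b≤ ∷ bs≤) c =
    ≤-trans (≤-trans (≤-reflexive (cong suc (length-++ xs))) len≤b) b≤ ∷
    choosable-++ b xs ys (≤-trans (n≤1+n _) len≤b) bs≤ c

  greedy : ∀ {Q} xs → Choosable Q xs → ∃[ M ] ∃[ Y ] All Edge M × length M ≡ length xs ×
    (∀ w → occ M w ≡ mult xs w + Y w) × (∀ w → Y w ≤ Q w) × sum Y ≡ length xs
  greedy {Q} [] [] = [] , (λ _ → 0) , [] , refl , (λ _ → refl) , (λ _ → z≤n) , sum-zero N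
  greedy {Q} (x ∷ xs) (len≤ ∷ c) =
    let (M , Y , M-edges , len-M , occ-M , Y≤Q , sum-Y) = greedy xs c
        split w   = m∸n+n≡m (Y≤Q w)
        rest      = +-cancelʳ-≤ (length xs) 1 (deg x (λ w → Q w ∸ Y w)) (begin
          suc (length xs)                          ≤⟨ len≤ ⟩
          deg x Q                                  ≡⟨ deg-cong x split ⟨
          deg x (λ w → Q w ∸ Y w + Y w)            ≡⟨ deg-+ x (λ w → Q w ∸ Y w) Y ⟩
          deg x (λ w → Q w ∸ Y w) + deg x Y        ≤⟨ +-monoʳ-≤ _ (deg≤sum x Y) ⟩
          deg x (λ w → Q w ∸ Y w) + sum Y          ≡⟨ cong (deg x (λ w → Q w ∸ Y w) +_) sum-Y ⟩
          deg x (λ w → Q w ∸ Y w) + length xs      ∎)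
        (y , y∈)  = pick (λ w → g x w * (Q w ∸ Y w)) rest
        (xy , y∈Q) = *-factors (g x y) (Q y ∸ Y y) y∈
    in (x , y) ∷ M , (λ w → δ y w + Y w) , xy ∷ M-edges , cong suc len-M ,
       (λ w → trans (cong (δ x w + δ y w +_) (occ-M w)) (shuffle (δ x w) (δ y w) (mult xs w) (Y w))) ,
       (λ w → ≤-trans (+-monoˡ-≤ (Y w) (δ≤ (λ w → Q w ∸ Y w) y∈Q w)) (≤-reflexive (split w))) ,
       trans (∑-distrib-+ (δ y) Y) (cong₂ _+_ (sum-δ y) sum-Y)
    where
    open ≤-Reasoning
    shuffle : ∀ a b c d → a + b + (c + d) ≡ a + c + (b + d)
    shuffle = solve-∀

  -- Two neighbourhoods in a graph of minimum degree D

  module _ {m D t : ℕ} (D≡m+t : D ≡ m + t) (N≡m+D : N ≡ m + D) (D≤deg : ∀ v → D ≤ sum (g v)) where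

    -- A vertex has at most N - D = m non-neighbours, itself included. The pointwise inequality p +
    -- e ≤ ep + 1 is inclusion-exclusion for P and the neighbourhood of `v`.
    missing≤m : ∀ v {P : Weight N} → (∀ w → P w ≤ 1) → sum P ≤ deg v P + m
    missing≤m v {P} P≤1 = +-cancelʳ-≤ D _ _ (begin
      sum P + D                       ≤⟨ +-monoʳ-≤ (sum P) (D≤deg v) ⟩
      sum P + sum (g v)               ≡⟨ ∑-distrib-+ P (g v) ⟨
      sum (λ w → P w + g v w)         ≤⟨ sum-mono (λ w → pointwise (P≤1 w) (g≤1 v w)) ⟩
      sum (λ w → g v w * P w + 1)     ≡⟨ ∑-distrib-+ (λ w → g v w * P w) (λ _ → 1) ⟩
      deg v P + sum {N} (λ _ → 1)     ≡⟨ cong (deg v P +_) (trans (sum-one N) N≡m+D) ⟩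
      deg v P + (m + D)               ≡⟨ +-assoc (deg v P) m D ⟨
      deg v P + m + D                 ∎)
      where
      open ≤-Reasoning
      pointwise : ∀ {p e} → p ≤ 1 → e ≤ 1 → p + e ≤ e * p + 1
      pointwise {0} {0} _ _ = z≤n
      pointwise {0} {1} _ _ = ≤-refl
      pointwise {1} {0} _ _ = ≤-refl
      pointwise {1} {1} _ _ = ≤-refl
      pointwise {suc (suc _)} (s≤s ()) _
      pointwise {0} {suc (suc _)} _ (s≤s ())
      pointwise {1} {suc (suc _)} _ (s≤s ())

    module Part {U : Weight N} (U≤1 : ∀ w → U w ≤ 1) (sum-U : sum U ≡ D) {ν} (σ : Structure U ν) where
      open Structure σ public

      s : ℕ
      s = sum S

      A : Weight N
      A w = J w + X w

      A+S≡U : ∀ w → A w + S w ≡ U w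
      A+S≡U w = trans (shuffle (J w) (X w) (S w)) (partition w)
        where
        shuffle : ∀ j x s → j + x + s ≡ j + s + x
        shuffle = solve-∀

      sum-A+s≡D : sum A + s ≡ D
      sum-A+s≡D = trans (sym (∑-distrib-+ A S)) (trans (sum-cong-≗ A+S≡U) sum-U)

      D-eq : sum J + s + 2 * f ≡ D
      D-eq = begin
        sum J + s + 2 * f     ≡⟨ cong (sum J + s +_) sum-X ⟨
        sum J + s + sum X     ≡⟨ shuffle (sum J) s (sum X) ⟩
        sum J + sum X + s     ≡⟨ cong (_+ s) (∑-distrib-+ J X) ⟨
        sum A + s             ≡⟨ sum-A+s≡D ⟩
        D                     ∎
        where
        open ≡-Reasoning
        shuffle : ∀ j s x → j + s + x ≡ j + x + s
        shuffle = solve-∀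

      A≤1 : ∀ w → A w ≤ 1
      A≤1 w = ≤-trans (≤-trans (m≤m+n (A w) (S w)) (≤-reflexive (A+S≡U w))) (U≤1 w)

      deg-J : ∀ {i} → 1 ≤ J i → deg i J ≡ 0
      deg-J {i} i∈J = trans (sum-cong-≗ zeroed) (sum-zero N)
        where
        zeroed : ∀ w → g i w * J w ≡ 0
        zeroed w with 1 ≤? J w
        ... | yes w∈J rewrite independent i∈J w∈J = refl
        ... | no  w∉J rewrite ≱1⇒≡0 w∉J = *-zeroʳ (g i w)

      deg-A : ∀ {i} → 1 ≤ J i → deg i A ≡ deg i X
      deg-A {i} i∈J = trans (deg-+ i J X) (cong (_+ deg i X) (deg-J i∈J))

      few′ : sum (λ i → J i * deg i X) ≤ 2 * f
      few′ = ≤-trans (≤-reflexive (deg-swap J X)) few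

      deg-X≤ : ∀ {i} → 1 ≤ J i → deg i X ≤ 2 * f
      deg-X≤ {i} i∈J = begin
        deg i X          ≡⟨ *-identityˡ (deg i X) ⟨
        1 * deg i X      ≤⟨ *-monoˡ-≤ (deg i X) i∈J ⟩
        J i * deg i X    ≤⟨ term≤sum (λ i → J i * deg i X) i ⟩
        sum (λ i → J i * deg i X) ≤⟨ few′ ⟩
        2 * f            ∎
        where open ≤-Reasoning

      weighted : ∀ {P : Weight N} → (∀ w → P w ≤ J w) → sum (λ i → P i * deg i X) ≤ 2 * f
      weighted P≤J = ≤-trans (sum-mono (λ i → *-monoˡ-≤ (deg i X) (P≤J i))) few′

      -- A vertex of J misses all of A but its neighbours in X, hence little outside A.

      into : ∀ {Q : Weight N} → (∀ w → Q w + A w ≤ 1) → ∀ {i} → 1 ≤ J i → sum Q + t ≤ s + deg i X + deg i Q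
      into {Q} QA≤1 {i} i∈J = linear 0
        (missing≤m i QA≤1 ⊞ ≡⇒≥ (∑-distrib-+ Q A) ⊞ ≤-reflexive (deg-+ i Q A)
          ⊞ ≤-reflexive (deg-A i∈J) ⊞ ≡⇒≥ sum-A+s≡D ⊞ ≡⇒≥ D≡m+t)
        (identity (sum (λ w → Q w + A w)) (sum Q) (sum A) (deg i (λ w → Q w + A w)) (deg i Q) (deg i A)
          (deg i X) s D m t)
        where
        identity : ∀ qa q a dqa dq da dx s D m t →
          s + dx + dq + (qa + (q + a + (dqa + (da + (D + (m + t))))))
          ≡ q + t + (dqa + m + (qa + (dq + da + (dx + (a + s + D))))) + 0
        identity = solve-∀

      -- At most 2f edges join P to X, so at most f vertices of P have two or more neighbours in X.
      -- Even if all 2f edges leave one such vertex, it has f choices in Q; every other vertex loses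
      -- at most one neighbour to X and has n choices.
      match-into : ∀ {n} {P Q : Weight N} → (∀ w → P w ≤ J w) → sum P ≡ n → (∀ w → Q w + A w ≤ 1) →
        s + 3 * f ≤ sum Q + t → s + 1 + n ≤ sum Q + t →
        ∃[ M ] All Edge M × length M ≡ n × (∀ w → occ M w ≤ P w + Q w)
      match-into {n} {P} {Q} P≤J sum-P QA≤1 many-heavy many-light =
        -- greedy serves the end of the list first: the vertices with two neighbours in X.
        let (hs , len-hs , hs∈H , mult-hs) = elements H (sum H) refl
            (ls , len-ls , ls∈L , mult-ls) = elements L (sum L) refl
            lengths = trans (cong₂ _+_ len-ls len-hs) sum-L+H
            heavies = subst (Choosable Q) (++-identityʳ hs)
              (choosable-++ f hs [] (≤-trans (≤-reflexive (trans (+-identityʳ _) len-hs)) sum-H≤f)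
                (All.map heavy-deg hs∈H) [])
            (M , Y , M-edges , len-M , occ-M , Y≤Q , _) = greedy (ls ++ hs)
              (choosable-++ n ls hs (≤-reflexive lengths) (All.map light-deg ls∈L) heavies)
        in M , M-edges , trans len-M (trans (length-++ ls) lengths) , λ w → begin
             occ M w                             ≡⟨ occ-M w ⟩
             mult (ls ++ hs) w + Y w             ≡⟨ cong (_+ Y w) (mult-++ ls hs w) ⟩
             mult ls w + mult hs w + Y w         ≡⟨ cong (_+ Y w) (cong₂ _+_ (mult-ls w) (mult-hs w)) ⟩
             L w + H w + Y w                     ≡⟨ cong (_+ Y w) (L+H≡P w) ⟩
             P w + Y w                           ≤⟨ +-monoʳ-≤ (P w) (Y≤Q w) ⟩
             P w + Q w                           ∎
        where
        open ≤-Reasoning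
        H L : Weight N
        H w = on-yes (2 ≤? deg w X) (P w)
        L w = on-no  (2 ≤? deg w X) (P w)

        mult-++ : ∀ (xs ys : List (Fin N)) w → mult (xs ++ ys) w ≡ mult xs w + mult ys w
        mult-++ []       ys w = refl
        mult-++ (x ∷ xs) ys w = trans (cong (δ x w +_) (mult-++ xs ys w)) (sym (+-assoc (δ x w) _ _))

        L+H≡P : ∀ w → L w + H w ≡ P w
        L+H≡P w = on-no+on-yes (2 ≤? deg w X) (P w)

        sum-L+H : sum L + sum H ≡ n
        sum-L+H = trans (sym (∑-distrib-+ L H)) (trans (sum-cong-≗ L+H≡P) sum-P)

        H-heavy : ∀ w → H w * 2 ≤ P w * deg w X
        H-heavy w with on-yes-≡ (2 ≤? deg w X) (P w)
        ... | inj₁ H≡0          = ≤-trans (≤-reflexive (cong (_* 2) H≡0)) z≤n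
        ... | inj₂ (2≤d , H≡P) = ≤-trans (≤-reflexive (cong (_* 2) H≡P)) (*-monoʳ-≤ (P w) 2≤d)

        sum-H≤f : sum H ≤ f
        sum-H≤f = *-cancelˡ-≤ 2 (begin
          2 * sum H                   ≡⟨ *-comm 2 (sum H) ⟩
          sum H * 2                   ≡⟨ *-distribʳ-sum 2 H ⟩
          sum (λ w → H w * 2)         ≤⟨ sum-mono H-heavy ⟩
          sum (λ w → P w * deg w X)   ≤⟨ weighted {P} P≤J ⟩
          2 * f                       ∎)

        heavy-deg : ∀ {i} → 1 ≤ H i → f ≤ deg i Q
        heavy-deg {i} i∈H = linear 0 (many-heavy ⊞ into QA≤1 i∈J ⊞ deg-X≤ i∈J)
          (identity s f (sum Q) t (deg i X) (deg i Q))
          where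
          i∈J : 1 ≤ J i
          i∈J = ≤-trans i∈H (≤-trans (≤-trans (m≤n+m (H i) (L i)) (≤-reflexive (L+H≡P i))) (P≤J i))
          identity : ∀ s f q t dx dq →
            dq + (s + 3 * f + (q + t + dx)) ≡ f + (q + t + (s + dx + dq + 2 * f)) + 0
          identity = solve-∀

        light-deg : ∀ {i} → 1 ≤ L i → n ≤ deg i Q
        light-deg {i} i∈L with on-no-≡ (2 ≤? deg i X) (P i)
        ... | inj₁ L≡0 = contradiction (≤-trans i∈L (≤-reflexive L≡0)) λ ()
        ... | inj₂ (light , L≡P) = linear 0
          (many-light ⊞ into QA≤1 (≤-trans i∈L (≤-trans (≤-reflexive L≡P) (P≤J i))) ⊞ ≤-pred (≰⇒> light))
          (identity s n (sum Q) t (deg i X) (deg i Q))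
          where
          identity : ∀ s n q t dx dq →
            dq + (s + 1 + n + (q + t + dx)) ≡ n + (q + t + (s + dx + dq + 1)) + 0
          identity = solve-∀

      -- A vertex of J has at least D neighbours, at most D - s′ of them in A′, and inside A only
      -- those in X; the others, at least s′ - deg X of them, are in R.
      escape : ∀ {A′ R : Weight N} {s′} → sum A′ + s′ ≡ D → (∀ w → R w + (A′ w + A w) ≡ 1) →
        ∀ {I : Weight N} → (∀ w → I w ≤ J w) → sum I * s′ ≤ 2 * f + sum (λ x → R x * deg x I)
      escape {A′} {R} {s′} sum-A′ cover {I} I≤J = begin
        sum I * s′                                           ≡⟨ *-distribʳ-sum s′ I ⟩
        sum (λ i → I i * s′)                                 ≤⟨ sum-mono pointwise ⟩
        sum (λ i → I i * deg i X + I i * deg i R)            ≡⟨ ∑-distrib-+ (λ i → I i * deg i X) (λ i → I i * deg i R) ⟩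
        sum (λ i → I i * deg i X) + sum (λ i → I i * deg i R) ≤⟨ +-mono-≤ (weighted {I} I≤J) (≤-reflexive (deg-swap I R)) ⟩
        2 * f + sum (λ x → R x * deg x I)                    ∎
        where
        open ≤-Reasoning
        out : ∀ {i} → 1 ≤ J i → s′ ≤ deg i X + deg i R
        out {i} i∈J = linear 0
          (D≤deg i ⊞ ≤-reflexive (sum-cong-≗ (λ w → sym (trans (cong (g i w *_) (cover w)) (*-identityʳ (g i w)))))
            ⊞ ≤-reflexive (deg-+ i R (λ w → A′ w + A w)) ⊞ ≤-reflexive (deg-+ i A′ A)
            ⊞ deg≤sum i A′ ⊞ ≤-reflexive (deg-A i∈J) ⊞ ≤-reflexive sum-A′)
          (identity D (sum (g i)) (deg i (λ w → R w + (A′ w + A w))) (deg i R) (deg i (λ w → A′ w + A w))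
            (deg i A′) (deg i A) (deg i X) (sum A′) s′)
          where
          identity : ∀ D d d₁ r d₂ a′ a x σ s′ →
            x + r + (D + (d + (d₁ + (d₂ + (a′ + (a + (σ + s′)))))))
            ≡ s′ + (d + (d₁ + (r + d₂ + (a′ + a + (σ + (x + D)))))) + 0
          identity = solve-∀
        pointwise : ∀ i → I i * s′ ≤ I i * deg i X + I i * deg i R
        pointwise i with 1 ≤? J i
        ... | yes i∈J = ≤-trans (*-monoʳ-≤ (I i) (out i∈J)) (≤-reflexive (*-distribˡ-+ (I i) (deg i X) (deg i R)))
        ... | no  i∉J rewrite n≤0⇒n≡0 (≤-trans (I≤J i) (≤-reflexive (≱1⇒≡0 i∉J))) = z≤n

      module _ (n<m : suc ν < m) (large : 2 * (suc ν * suc ν) ≤ D * t) where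
        open Bounds {ν} {D} {t} large

        -- With Q empty, `into` gives t ≤ s + deg X at every vertex of J, to be summed over J.
        t≤s : t ≤ s
        t≤s = t≤s-bound {f = f} {j = sum J} D≡m+t n<m D-eq size (begin
          sum J * t                                        ≡⟨ *-distribʳ-sum t J ⟩
          sum (λ i → J i * t)                              ≤⟨ sum-mono pointwise ⟩
          sum (λ i → J i * s + J i * deg i X)              ≡⟨ ∑-distrib-+ (λ i → J i * s) (λ i → J i * deg i X) ⟩
          sum (λ i → J i * s) + sum (λ i → J i * deg i X)  ≤⟨ +-mono-≤ (≡⇒≥ (*-distribʳ-sum s J)) few′ ⟩
          sum J * s + 2 * f                                ∎)
          where
          open ≤-Reasoning
          many : ∀ {i} → 1 ≤ J i → t ≤ s + deg i X
          many {i} i∈J = begin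
            t                                    ≡⟨ cong (_+ t) (sum-zero N) ⟨
            sum {N} (λ _ → 0) + t                ≤⟨ into A≤1 i∈J ⟩
            s + deg i X + deg i (λ _ → 0)
              ≡⟨ cong (s + deg i X +_) (trans (sum-cong-≗ (λ w → *-zeroʳ (g i w))) (sum-zero N)) ⟩
            s + deg i X + 0                      ≡⟨ +-identityʳ _ ⟩
            s + deg i X                          ∎
          pointwise : ∀ i → J i * t ≤ J i * s + J i * deg i X
          pointwise i with 1 ≤? J i
          ... | yes i∈J = ≤-trans (*-monoʳ-≤ (J i) (many i∈J)) (≤-reflexive (*-distribˡ-+ (J i) s (deg i X)))
          ... | no  i∉J rewrite ≱1⇒≡0 i∉J = z≤n

        isolated : ∃[ u ] 1 ≤ J u × deg u X ≡ 0
        isolated with any? (λ u → (1 ≤? J u) ×-dec (deg u X ≟ 0))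
        ... | yes found = found
        ... | no  none  = contradiction (2f<j {f = f} {j = sum J} D-eq size t≤s)
          (≤⇒≯ (≤-trans (sum-mono pointwise) few′))
          where
          pointwise : ∀ i → J i ≤ J i * deg i X
          pointwise i with 1 ≤? J i | 1 ≤? deg i X
          ... | no  i∉J | _ rewrite ≱1⇒≡0 i∉J = z≤n
          ... | yes i∈J | yes 1≤d = ≤-trans (≤-reflexive (sym (*-identityʳ (J i)))) (*-monoʳ-≤ (J i) 1≤d)
          ... | yes i∈J | no  1≰d = contradiction (i , i∈J , ≱1⇒≡0 1≰d) none

    module _ {ν} (n<m : suc ν < m) (large : 2 * (suc ν * suc ν) ≤ D * t)
      (no-matching : ∀ v → ¬ Matching (g v) (suc ν)) where
      open Bounds {ν} {D} {t} large

      -- The neighbourhood is cut down to exactly D vertices, so that |A| = D - s holds with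
      -- equality and the size of the complement R below is known.
      locally : ∀ v → ∃[ U ] (∀ w → U w ≤ g v w) × sum U ≡ D × Structure U ν
      locally v with (U , U≤g , sum-U) ← trim (g v) (D≤deg v)
        with structure (λ w → ≤-trans (U≤g w) (g≤1 v w)) ν
      ... | inj₁ (M , M-edges , len , M⊆U) =
        contradiction (M , M-edges , len , λ w → ≤-trans (M⊆U w) (U≤g w)) (no-matching v)
      ... | inj₂ σ = U , U≤g , sum-U , σ

      module Pair {v u U₁ U₂} (U₁≤g : ∀ w → U₁ w ≤ g v w) (sum-U₁ : sum U₁ ≡ D) (σ₁ : Structure U₁ ν)
        (U₂≤g : ∀ w → U₂ w ≤ g u w) (sum-U₂ : sum U₂ ≡ D) (σ₂ : Structure U₂ ν)
        (u∈J : 1 ≤ Structure.J σ₁ u) (u-isolated : deg u (Structure.X σ₁) ≡ 0) where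

        module P₁ = Part (λ w → ≤-trans (U₁≤g w) (g≤1 v w)) sum-U₁ σ₁
        module P₂ = Part (λ w → ≤-trans (U₂≤g w) (g≤1 u w)) sum-U₂ σ₂

        -- A₂ consists of neighbours of u, whereas u, a member of J₁ without neighbours in X₁, has
        -- none in A₁.
        disjoint-A : ∀ w → P₂.A w + P₁.A w ≤ 1
        disjoint-A w with 1 ≤? P₁.A w | 1 ≤? P₂.A w
        ... | no  w∉A₁ | _ rewrite ≱1⇒≡0 w∉A₁ = ≤-trans (≤-reflexive (+-identityʳ _)) (P₂.A≤1 w)
        ... | yes _    | no w∉A₂ rewrite ≱1⇒≡0 w∉A₂ = P₁.A≤1 w
        ... | yes w∈A₁ | yes w∈A₂ = contradiction
          (≤-trans (*-mono-≤ uw w∈A₁) (≤-trans (term≤sum (λ w → g u w * P₁.A w) w)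
            (≤-reflexive (trans (P₁.deg-A u∈J) u-isolated)))) (λ ())
          where
          uw : 1 ≤ g u w
          uw = ≤-trans w∈A₂ (≤-trans (m≤m+n _ (Structure.S σ₂ w)) (≤-trans (≤-reflexive (P₂.A+S≡U w)) (U₂≤g w)))

        R : Weight N
        R w = 1 ∸ (P₂.A w + P₁.A w)

        cover : ∀ w → R w + (P₂.A w + P₁.A w) ≡ 1
        cover w = m∸n+n≡m (disjoint-A w)

        r+t≡s₁+s₂ : sum R + t ≡ P₁.s + P₂.s
        r+t≡s₁+s₂ = +-cancelʳ-≡ (m + D) _ _ (begin
          sum R + t + (m + D)                           ≡⟨ shuffle₁ (sum R) t m D ⟩
          sum R + ((m + t) + D)                         ≡⟨ cong (λ z → sum R + (z + D)) D≡m+t ⟨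
          sum R + (D + D)                               ≡⟨ cong₂ (λ x y → sum R + (x + y)) P₂.sum-A+s≡D P₁.sum-A+s≡D ⟨
          sum R + (sum P₂.A + P₂.s + (sum P₁.A + P₁.s)) ≡⟨ shuffle₂ (sum R) (sum P₂.A) P₂.s (sum P₁.A) P₁.s ⟩
          P₁.s + P₂.s + (sum R + (sum P₂.A + sum P₁.A)) ≡⟨ cong (λ z → P₁.s + P₂.s + (sum R + z)) (∑-distrib-+ P₂.A P₁.A) ⟨
          P₁.s + P₂.s + (sum R + sum (λ w → P₂.A w + P₁.A w))
            ≡⟨ cong (P₁.s + P₂.s +_) (trans (sym (∑-distrib-+ R (λ w → P₂.A w + P₁.A w)))
              (trans (sum-cong-≗ cover) (trans (sum-one N) N≡m+D))) ⟩
          P₁.s + P₂.s + (m + D)                         ∎)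
          where
          open ≡-Reasoning
          shuffle₁ : ∀ r t m D → r + t + (m + D) ≡ r + (m + t + D)
          shuffle₁ = solve-∀
          shuffle₂ : ∀ r a s a′ s′ → r + (a + s + (a′ + s′)) ≡ s′ + s + (r + (a + a′))
          shuffle₂ = solve-∀

        -- Both independent sets are cut down to the smaller size: the count is then symmetric, and
        -- the neighbourhood attaining the minimum supplies D = k + s + 2f.
        k : ℕ
        k = sum P₁.J ⊓ sum P₂.J

        I-trim = trim P₁.J {k} (m⊓n≤m _ _)
        J-trim = trim P₂.J {k} (m⊓n≤n (sum P₁.J) _)

        I J′ : Weight N
        I  = proj₁ I-trim
        J′ = proj₁ J-trim
        I≤J₁ : ∀ w → I w ≤ P₁.J w
        I≤J₁ = proj₁ (proj₂ I-trim)
        J′≤J₂ : ∀ w → J′ w ≤ P₂.J w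
        J′≤J₂ = proj₁ (proj₂ J-trim)
        sum-I : sum I ≡ k
        sum-I = proj₂ (proj₂ I-trim)
        sum-J′ : sum J′ ≡ k
        sum-J′ = proj₂ (proj₂ J-trim)

        J₁≤A₁ : ∀ w → P₁.J w ≤ P₁.A w
        J₁≤A₁ w = m≤m+n _ _
        J₂≤A₂ : ∀ w → P₂.J w ≤ P₂.A w
        J₂≤A₂ w = m≤m+n _ _

        restrict : ∀ x (P : Weight N) w → g x w * P w ≤ P w
        restrict x P w = ≤-trans (*-monoˡ-≤ (P w) (g≤1 x w)) (≤-reflexive (*-identityˡ (P w)))

        in-neighbourhood : ∀ x {P Q : Weight N} → (∀ w → P w ≤ g x w * I w) → (∀ w → Q w ≤ g x w * J′ w) →
          ∀ w → P w + Q w ≤ g x w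
        in-neighbourhood x P≤ Q≤ w = ≤-trans (+-mono-≤ (P≤ w) (Q≤ w)) (≤-trans
          (≤-reflexive (sym (*-distribˡ-+ (g x w) (I w) (J′ w))))
          (≤-trans (*-monoʳ-≤ (g x w) (≤-trans (≤-reflexive (+-comm (I w) (J′ w)))
              (≤-trans (+-mono-≤ (≤-trans (J′≤J₂ w) (J₂≤A₂ w)) (≤-trans (I≤J₁ w) (J₁≤A₁ w))) (disjoint-A w))))
            (≤-reflexive (*-identityʳ (g x w)))))

        -- With k + n neighbours in the two sets of size k, x would have at least n in each. By
        -- `two-sided`, n of them on one side could be matched to neighbours of x on the other,
        -- which makes a forbidden matching.
        deg-bound : ∀ x → deg x I + deg x J′ ≤ k + ν
        deg-bound x = ≮⇒≥ λ large-degs →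
          let p≤k = ≤-trans (deg≤sum x I) (≤-reflexive sum-I)
              q≤k = ≤-trans (deg≤sum x J′) (≤-reflexive sum-J′)
              n≤q = +-cancelˡ-≤ k _ _ (≤-trans (≤-reflexive (+-suc k ν)) (≤-trans large-degs (+-monoˡ-≤ _ p≤k)))
              n≤p = +-cancelʳ-≤ k _ _ (≤-trans (≤-reflexive (cong suc (+-comm ν k))) (≤-trans large-degs (+-monoʳ-≤ _ q≤k)))
          in conflict large-degs (from-I n≤p) (from-J n≤q)
          where
          P Q : Weight N
          P w = g x w * I w
          Q w = g x w * J′ w

          from-I : suc ν ≤ deg x I → ¬ (P₁.s + 3 * P₁.f ≤ deg x J′ + t × P₁.s + 1 + suc ν ≤ deg x J′ + t)
          from-I n≤p (heavy , light) =
            let (P′ , P′≤P , sum-P′) = trim P n≤p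
                (M , M-edges , len , M⊆) = P₁.match-into {Q = Q}
                  (λ w → ≤-trans (P′≤P w) (≤-trans (restrict x I w) (I≤J₁ w))) sum-P′
                  (λ w → ≤-trans (+-monoˡ-≤ _ (≤-trans (restrict x J′ w) (≤-trans (J′≤J₂ w) (J₂≤A₂ w)))) (disjoint-A w))
                  heavy light
            in no-matching x (M , M-edges , len , λ w → ≤-trans (M⊆ w) (in-neighbourhood x {Q = Q} P′≤P (λ _ → ≤-refl) w))

          from-J : suc ν ≤ deg x J′ → ¬ (P₂.s + 3 * P₂.f ≤ deg x I + t × P₂.s + 1 + suc ν ≤ deg x I + t)
          from-J n≤q (heavy , light) =
            let (Q′ , Q′≤Q , sum-Q′) = trim Q n≤q
                (M , M-edges , len , M⊆) = P₂.match-into {Q = P}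
                  (λ w → ≤-trans (Q′≤Q w) (≤-trans (restrict x J′ w) (J′≤J₂ w))) sum-Q′
                  (λ w → ≤-trans (≤-reflexive (+-comm (P w) _))
                    (≤-trans (+-monoʳ-≤ _ (≤-trans (restrict x I w) (≤-trans (I≤J₁ w) (J₁≤A₁ w)))) (disjoint-A w)))
                  heavy light
            in no-matching x (M , M-edges , len ,
                 λ w → ≤-trans (M⊆ w)
                   (≤-trans (≤-reflexive (+-comm (Q′ w) (P w))) (in-neighbourhood x {P = P} (λ _ → ≤-refl) Q′≤Q w)))

          conflict : suc (k + ν) ≤ deg x I + deg x J′ →
            ¬ (P₁.s + 3 * P₁.f ≤ deg x J′ + t × P₁.s + 1 + suc ν ≤ deg x J′ + t) →
            ¬ (P₂.s + 3 * P₂.f ≤ deg x I + t × P₂.s + 1 + suc ν ≤ deg x I + t) → ⊥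
          conflict large-degs ¬q ¬p with ⊓-sel (sum P₁.J) (sum P₂.J)
          ... | inj₁ k≡ = two-sided {f = P₁.f} {f′ = P₂.f} {k = k}
            (trans (cong (λ z → z + P₁.s + 2 * P₁.f) k≡) P₁.D-eq) P₁.size P₂.size
            (P₁.t≤s n<m large) (P₂.t≤s n<m large) large-degs ¬q ¬p
          ... | inj₂ k≡ = two-sided {f = P₂.f} {f′ = P₁.f} {k = k}
            (trans (cong (λ z → z + P₂.s + 2 * P₂.f) k≡) P₂.D-eq) P₂.size P₁.size
            (P₂.t≤s n<m large) (P₁.t≤s n<m large)
            (≤-trans large-degs (≤-reflexive (+-comm (deg x I) (deg x J′)))) ¬p ¬q

        counted : k * (P₁.s + P₂.s) ≤ 2 * P₁.f + 2 * P₂.f + sum R * (k + ν)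
        counted = linear 0
          (≡⇒≥ (cong (_* P₂.s) sum-I) ⊞ ≡⇒≥ (cong (_* P₁.s) sum-J′)
            ⊞ P₁.escape {P₂.A} {R} P₂.sum-A+s≡D cover I≤J₁
            ⊞ P₂.escape {P₁.A} {R} P₁.sum-A+s≡D (λ w → trans (cong (R w +_) (+-comm (P₁.A w) _)) (cover w)) J′≤J₂
            ⊞ ≡⇒≥ (∑-distrib-+ (λ x → R x * deg x I) (λ x → R x * deg x J′))
            ⊞ sum-mono (λ x → ≤-trans (≤-reflexive (sym (*-distribˡ-+ (R x) (deg x I) (deg x J′))))
              (*-monoʳ-≤ (R x) (deg-bound x)))
            ⊞ ≡⇒≥ (*-distribʳ-sum (k + ν) R))
          (identity k P₁.s P₂.s (sum I * P₂.s) (sum J′ * P₁.s) P₁.f P₂.f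
            (sum (λ x → R x * deg x I)) (sum (λ x → R x * deg x J′))
            (sum (λ x → R x * deg x I + R x * deg x J′)) (sum (λ x → R x * (k + ν))) (sum R * (k + ν)))
          where
          identity : ∀ k s s′ a b f f′ c d e h l →
            2 * f + 2 * f′ + l + (k * s′ + (k * s + (a + (b + (c + d + (e + h))))))
            ≡ k * (s + s′) + (a + (b + (2 * f + c + (2 * f′ + d + (e + (h + l)))))) + 0
          identity = solve-∀

        contradictory : ⊥
        contradictory with ⊓-sel (sum P₁.J) (sum P₂.J)
        ... | inj₁ k≡ = final-bound {f = P₁.f} {f′ = P₂.f} {k = k} r+t≡s₁+s₂
          (trans (cong (λ z → z + P₁.s + 2 * P₁.f) k≡) P₁.D-eq) P₁.size P₂.size (P₁.t≤s n<m large) counted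
        ... | inj₂ k≡ = final-bound {f = P₂.f} {f′ = P₁.f} {k = k} (trans r+t≡s₁+s₂ (+-comm P₁.s P₂.s))
          (trans (cong (λ z → z + P₂.s + 2 * P₂.f) k≡) P₂.D-eq) P₂.size P₁.size (P₂.t≤s n<m large)
          (subst₂ _≤_ (cong (k *_) (+-comm P₁.s P₂.s)) (cong (_+ sum R * (k + ν)) (+-comm (2 * P₁.f) _)) counted)

      no-matching-absurd : Fin N → ⊥
      no-matching-absurd v =
        let (U₁ , U₁≤g , sum-U₁ , σ₁) = locally v
            (u , u∈J , u-iso) = Part.isolated (λ w → ≤-trans (U₁≤g w) (g≤1 v w)) sum-U₁ σ₁ n<m large
            (U₂ , U₂≤g , sum-U₂ , σ₂) = locally u
        in Pair.contradictory U₁≤g sum-U₁ σ₁ U₂≤g sum-U₂ σ₂ u∈J u-iso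

-- Decidability of arrowing

anyVec? : ∀ {b} k {P : Vec (Fin b) k → Set} → (∀ xs → Dec (P xs)) → Dec (∃ P)
anyVec? zero    P? = map′ ([] ,_) (λ { ([] , p) → p }) (P? [])
anyVec? (suc k) P? =
  map′ (λ (x , xs , p) → x ∷ xs , p) (λ { (x ∷ xs , p) → x , xs , p })
    (any? (λ x → anyVec? k (λ xs → P? (x ∷ xs))))

allVec? : ∀ {b} k {P : Vec (Fin b) k → Set} → (∀ xs → Dec (P xs)) → Dec (∀ xs → P xs)
allVec? k P? = map′ (λ none xs → decidable-stable (P? xs) (λ ¬p → none (xs , ¬p)))
  (λ all (xs , ¬p) → ¬p (all xs)) (¬? (anyVec? k (λ xs → ¬? (P? xs))))

record Finite (V : Set) : Set where
  field
    size       : ℕ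
    enum       : Fin size → V
    index      : V → Fin size
    enum-index : ∀ v → enum (index v) ≡ v

  equal? : (u v : V) → Dec (u ≡ v)
  equal? u v = map′ (λ eq → trans (sym (enum-index u)) (trans (cong enum eq) (enum-index v)))
    (cong index) (index u ≟ᶠ index v)

  every? : {P : V → Set} → (∀ v → Dec (P v)) → Dec (∀ v → P v)
  every? {P} P? = map′ (λ all v → subst P (enum-index v) (all (index v))) (λ all i → all (enum i))
    (all? (λ i → P? (enum i)))

record FiniteGraph (H : Graph) : Set where
  field
    vertices : Finite (Vertex H)
    adj?     : ∀ u v → Dec (Adj H u v)

IsCopy : (H : Graph) → ∀ {N} → Colouring N → Fin 2 → (Vertex H → Fin N) → Set
IsCopy H {N} c k f = Injective {A = Vertex H} {B = Fin N} _≡_ _≡_ f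
  × (∀ {u v} → Adj H u v → colour c (f u) (f v) ≡ k)

module _ {H : Graph} (fin : FiniteGraph H) {N : ℕ} (c : Colouring N) (k : Fin 2) where
  open FiniteGraph fin
  open Finite vertices

  isCopy? : ∀ f → Dec (IsCopy H c k f)
  isCopy? f =
    map′ (λ inj {u} {v} → inj u v) (λ inj u v → inj {u} {v})
      (every? λ u → every? λ v → (f u ≟ᶠ f v) →-dec (equal? u v))
    ×-dec
    map′ (λ col {u} {v} → col u v) (λ col u v → col {u} {v})
      (every? λ u → every? λ v → adj? u v →-dec (colour c (f u) (f v) ≟ᶠ k))

  -- Tabulating a map and looking it up again returns it up to pointwise equality only.
  IsCopy-resp : ∀ {f f′} → (∀ v → f v ≡ f′ v) → IsCopy H c k f → IsCopy H c k f′
  IsCopy-resp f≗f′ (inj , col) =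
    (λ {u} {v} eq → inj (trans (f≗f′ u) (trans eq (sym (f≗f′ v))))) ,
    (λ {u} {v} uv → trans (sym (cong₂ (colour c) (f≗f′ u) (f≗f′ v))) (col uv))

  copy? : Dec (MonochromaticCopy H c k)
  copy? = map′ (λ (xs , copy) → Vec.lookup xs ∘ index , copy)
    (λ (f , copy) → Vec.tabulate (f ∘ enum) , IsCopy-resp
       (λ v → sym (trans (lookup∘tabulate (f ∘ enum) (index v)) (cong f (enum-index v)))) copy)
    (anyVec? size (λ xs → isCopy? (Vec.lookup xs ∘ index)))

recolour : ∀ {H N} {c c′ : Colouring N} → (∀ u v → colour c u v ≡ colour c′ u v) →
  ∀ {k} → MonochromaticCopy H c k → MonochromaticCopy H c′ k
recolour c≗c′ (f , inj , col) = f , inj , λ uv → trans (sym (c≗c′ _ _)) (col uv)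

-- Colourings are enumerated as arbitrary maps, which meet makes symmetric.

meet : Fin 2 → Fin 2 → Fin 2
meet 0F _ = 0F
meet 1F y = y

meet-comm : ∀ x y → meet x y ≡ meet y x
meet-comm 0F 0F = refl
meet-comm 0F 1F = refl
meet-comm 1F 0F = refl
meet-comm 1F 1F = refl

meet-idem : ∀ x → meet x x ≡ x
meet-idem 0F = refl
meet-idem 1F = refl

decode : ∀ {N} → Vec (Fin 2) (N * N) → Colouring N
decode {N} xs = record
  { colour     = λ u v → meet (Vec.lookup xs (combine u v)) (Vec.lookup xs (combine v u))
  ; colour-sym = λ u v → meet-comm (Vec.lookup xs (combine u v)) _ }

encode : ∀ {N} → Colouring N → Vec (Fin 2) (N * N)
encode {N} c = Vec.tabulate (λ e → let (u , v) = remQuot {N} N e in colour c u v)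

decode-encode : ∀ {N} (c : Colouring N) u v → colour (decode (encode c)) u v ≡ colour c u v
decode-encode {N} c u v = trans (cong₂ meet (entry u v) (trans (entry v u) (colour-sym c v u))) (meet-idem _)
  where
  entry : ∀ u v → Vec.lookup (encode c) (combine u v) ≡ colour c u v
  entry u v = trans (lookup∘tabulate _ (combine u v))
    (cong (λ (u , v) → colour c u v) (remQuot-combine {N} u v))

-- Lets `least` find the Ramsey number constructively; `copy?` also lets the upper bound argue by
-- contradiction.
arrows? : ∀ {H₁ H₂} → FiniteGraph H₁ → FiniteGraph H₂ → ∀ N → Dec (Arrows N H₁ H₂)
arrows? {H₁} {H₂} fin₁ fin₂ N =
  map′ (λ all c → transfer c (all (encode c))) (λ arr xs → arr (decode xs))
    (allVec? (N * N) (λ xs → copy? fin₁ (decode xs) 0F ⊎-dec copy? fin₂ (decode xs) 1F))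
  where
  transfer : ∀ c → MonochromaticCopy H₁ (decode (encode c)) 0F ⊎ MonochromaticCopy H₂ (decode (encode c)) 1F →
    MonochromaticCopy H₁ c 0F ⊎ MonochromaticCopy H₂ c 1F
  transfer c (inj₁ copy) = inj₁ (recolour {H₁} {c = decode (encode c)} {c} (decode-encode c) copy)
  transfer c (inj₂ copy) = inj₂ (recolour {H₂} {c = decode (encode c)} {c} (decode-encode c) copy)

arrows-mono : ∀ {H₁ H₂ M N} → M ≤ N → Arrows M H₁ H₂ → Arrows N H₁ H₂
arrows-mono {H₁} {H₂} {M} {N} M≤N arr c with arr c′
  where
  c′ : Colouring M
  c′ = record
    { colour     = λ u v → colour c (inject≤ u M≤N) (inject≤ v M≤N)
    ; colour-sym = λ u v → colour-sym c _ _ }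
... | inj₁ (f , inj , col) = inj₁ ((λ v → inject≤ (f v) M≤N) , (λ eq → inj (inject≤-injective M≤N M≤N _ _ eq)) , col)
... | inj₂ (f , inj , col) = inj₂ ((λ v → inject≤ (f v) M≤N) , (λ eq → inj (inject≤-injective M≤N M≤N _ _ eq)) , col)

least : ∀ {P : ℕ → Set} → (∀ n → Dec (P n)) → ∀ n → P n → ∃[ r ] P r × (∀ k → P k → r ≤ k)
least {P} P? = <-rec (λ n → P n → ∃[ r ] P r × (∀ k → P k → r ≤ k)) λ n rec p →
  case anyUpTo? P? n of λ where
    (yes (k , k<n , q)) → rec k<n q
    (no none)           → n , p , λ k q → ≮⇒≥ (λ k<n → none (k , k<n , q))

finite-star : ∀ m → FiniteGraph (star m)
finite-star m = record
  { vertices = record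
    { size       = suc m
    ; enum       = λ { zero → nothing ; (suc i) → just i }
    ; index      = λ { nothing → zero ; (just i) → suc i }
    ; enum-index = λ { nothing → refl ; (just i) → refl } }
  ; adj? = λ where
      nothing  nothing  → no λ ()
      nothing  (just _) → yes apex-base
      (just _) nothing  → yes base-apex
      (just _) (just _) → no λ { (base-base ()) } }

finite-fan : ∀ n → FiniteGraph (fan n)
finite-fan n = record
  { vertices = record
    { size       = suc (n * 2)
    ; enum       = λ { zero → nothing ; (suc e) → let (i , b) = remQuot {n} 2 e in just (i , side b) }
    ; index      = λ { nothing → zero ; (just (i , b)) → suc (combine i (side⁻¹ b)) }
    ; enum-index = λ where
        nothing        → refl
        (just (i , b)) → cong just (trans (cong (λ (i , b) → i , side b) (remQuot-combine i (side⁻¹ b)))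
          (cong (i ,_) (side-side⁻¹ b))) }
  ; adj? = λ where
      nothing        nothing        → no λ ()
      nothing        (just _)       → yes apex-base
      (just _)       nothing        → yes base-apex
      (just (i , a)) (just (j , b)) → map′ base-base (λ { (base-base e) → e }) ((i ≟ᶠ j) ×-dec ¬? (a ≟ᵇ b)) }

-- Colour classes as weights

module Classes {N : ℕ} (c : Colouring N) where

  -- The diagonal is set to 0, since `colour u u` carries no information.
  blue red : Fin N → Weight N
  blue u v = on-no (u ≟ᶠ v) (toℕ (colour c u v))
  red  u v = on-no (u ≟ᶠ v) (1 ∸ toℕ (colour c u v))

  blue≤1 : ∀ u v → blue u v ≤ 1
  blue≤1 u v with u ≟ᶠ v | colour c u v
  ... | yes _ | _  = z≤n
  ... | no  _ | 0F = z≤n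
  ... | no  _ | 1F = ≤-refl

  red≤1 : ∀ u v → red u v ≤ 1
  red≤1 u v with u ≟ᶠ v
  ... | yes _ = z≤n
  ... | no  _ = m∸n≤m 1 (toℕ (colour c u v))

  blue-sym : ∀ u v → blue u v ≡ blue v u
  blue-sym u v with u ≟ᶠ v | v ≟ᶠ u
  ... | yes _    | yes _    = refl
  ... | yes refl | no  v≢u  = contradiction refl v≢u
  ... | no  u≢v  | yes refl = contradiction refl u≢v
  ... | no  _    | no  _    = cong toℕ (colour-sym c u v)

  blue-irrefl : ∀ v → blue v v ≡ 0
  blue-irrefl v with v ≟ᶠ v
  ... | yes _  = refl
  ... | no v≢v = contradiction refl v≢v

  blue-1F : ∀ {u v} → 1 ≤ blue u v → u ≢ v × colour c u v ≡ 1F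
  blue-1F {u} {v} 1≤ with u ≟ᶠ v | colour c u v
  ... | no u≢v | 1F = u≢v , refl

  red-0F : ∀ {u v} → 1 ≤ red u v → u ≢ v × colour c u v ≡ 0F
  red-0F {u} {v} 1≤ with u ≟ᶠ v | colour c u v
  ... | no u≢v | 0F = u≢v , refl
  ... | no u≢v | 1F = contradiction 1≤ λ ()

  blue+red+δ : ∀ u v → blue u v + (red u v + δ u v) ≡ 1
  blue+red+δ u v with u ≟ᶠ v | colour c u v
  ... | yes refl | _  = δ-refl u
  ... | no  u≢v  | 0F = cong suc (δ-≢ u≢v)
  ... | no  u≢v  | 1F = cong suc (δ-≢ u≢v)

  red-star : ∀ {m} v → m ≤ sum (red v) → MonochromaticCopy (star m) c 0F
  red-star {m} v m≤ with (g , g-inj , g∈) ← select (red v) (red≤1 v) m≤ = f , inj , col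
    where
    f : Maybe (Fin m) → Fin N
    f nothing  = v
    f (just i) = g i
    inj : Injective {A = Maybe (Fin m)} _≡_ _≡_ f
    inj {nothing} {nothing} _  = refl
    inj {nothing} {just i}  eq = contradiction eq (proj₁ (red-0F (g∈ i)))
    inj {just i}  {nothing} eq = contradiction (sym eq) (proj₁ (red-0F (g∈ i)))
    inj {just i}  {just j}  eq = cong just (g-inj eq)
    col : ∀ {a b} → Adj (star m) a b → colour c (f a) (f b) ≡ 0F
    col (apex-base {i}) = proj₂ (red-0F (g∈ i))
    col (base-apex {i}) = trans (colour-sym c _ _) (proj₂ (red-0F (g∈ i)))
    col (base-base ())

  open Matchings blue blue≤1 blue-sym blue-irrefl

  endpoint : Bool → Fin N × Fin N → Fin N
  endpoint false = proj₁
  endpoint true  = proj₂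

  end : ∀ (M : Edges N) → Fin (length M) × Bool → Fin N
  end M (i , b) = endpoint b (lookup M i)

  endpoint-occ : ∀ b (e : Fin N × Fin N) → 1 ≤ δ (proj₁ e) (endpoint b e) + δ (proj₂ e) (endpoint b e)
  endpoint-occ false (c , d) = ≤-trans (≤-reflexive (sym (δ-refl c))) (m≤m+n _ (δ d c))
  endpoint-occ true  (c , d) = ≤-trans (≤-reflexive (sym (δ-refl d))) (m≤n+m _ (δ c d))

  end-occ : ∀ M e → 1 ≤ occ M (end M e)
  end-occ (e ∷ M) (zero , b)  = ≤-trans (endpoint-occ b e) (m≤m+n _ _)
  end-occ (e ∷ M) (suc i , b) = ≤-trans (end-occ M (i , b)) (m≤n+m _ _)

  head≢tail : ∀ e M → (∀ w → occ (e ∷ M) w ≤ 1) → ∀ b e′ → endpoint b e ≢ end M e′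
  head≢tail e M M≤1 b e′ eq = <⇒≱ (≤-trans (+-mono-≤ (endpoint-occ b e)
    (subst (λ w → 1 ≤ occ M w) (sym eq) (end-occ M e′))) (M≤1 (endpoint b e))) ≤-refl

  -- A vertex shared by two edges, or both ends of a loop, would be counted twice by `occ`.
  end-injective : ∀ M → (∀ w → occ M w ≤ 1) → ∀ e e′ → end M e ≡ end M e′ → e ≡ e′
  end-injective (e ∷ M) M≤1 (zero , a)  (suc j , b) eq = contradiction eq (head≢tail e M M≤1 a (j , b))
  end-injective (e ∷ M) M≤1 (suc i , a) (zero , b)  eq = contradiction (sym eq) (head≢tail e M M≤1 b (i , a))
  end-injective (e ∷ M) M≤1 (suc i , a) (suc j , b) eq =
    cong (λ (i , a) → suc i , a)
      (end-injective M (λ w → ≤-trans (m≤n+m _ _) (M≤1 w)) (i , a) (j , b) eq)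
  end-injective ((c , d) ∷ M) M≤1 (zero , a) (zero , b) eq with c ≟ᶠ d
  ... | yes refl = contradiction
    (≤-trans (+-mono-≤ (≡⇒≥ (δ-refl c)) (≡⇒≥ (δ-refl c))) (≤-trans (m≤m+n _ (occ M c)) (M≤1 c))) λ { (s≤s ()) }
  ... | no c≢d with a | b
  ...   | false | false = refl
  ...   | true  | true  = refl
  ...   | false | true  = contradiction eq c≢d
  ...   | true  | false = contradiction (sym eq) c≢d

  end-edge : ∀ {M} → All Edge M → ∀ i → colour c (end M (i , false)) (end M (i , true)) ≡ 1F
  end-edge (e ∷ _)  zero    = proj₂ (blue-1F e)
  end-edge (_ ∷ es) (suc i) = end-edge es i

  blue-fan : ∀ {n} v → Matching (blue v) n → MonochromaticCopy (fan n) c 1F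
  blue-fan v (M , M-edges , refl , M⊆) = f , inj , col
    where
    n = length M
    f : Maybe (Fin n × Bool) → Fin N
    f nothing  = v
    f (just e) = end M e
    spoke : ∀ e → v ≢ end M e × colour c v (end M e) ≡ 1F
    spoke e = blue-1F (≤-trans (end-occ M e) (M⊆ (end M e)))
    inj : Injective {A = Maybe (Fin n × Bool)} _≡_ _≡_ f
    inj {nothing} {nothing} _  = refl
    inj {nothing} {just e}  eq = contradiction eq (proj₁ (spoke e))
    inj {just e}  {nothing} eq = contradiction (sym eq) (proj₁ (spoke e))
    inj {just e}  {just e′} eq = cong just (end-injective M (λ w → ≤-trans (M⊆ w) (blue≤1 v w)) e e′ eq)
    col : ∀ {a b} → Adj (fan n) a b → colour c (f a) (f b) ≡ 1F
    col (apex-base {e}) = proj₂ (spoke e)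
    col (base-apex {e}) = trans (colour-sym c _ _) (proj₂ (spoke e))
    col (base-base {i , false} {_ , false} (refl , ne)) = contradiction refl ne
    col (base-base {i , true}  {_ , true}  (refl , ne)) = contradiction refl ne
    col (base-base {i , false} {_ , true}  (refl , _))  = end-edge M-edges i
    col (base-base {i , true}  {_ , false} (refl , _))  = trans (colour-sym c _ _) (end-edge M-edges i)

arrows-upper : ∀ {n m t} → n < m → 1 ≤ n → 2 * (n * n) ≤ (m + t) * t →
  Arrows (m + (m + t)) (star m) (fan n)
arrows-upper {suc ν} {m@(suc _)} {t} n<m 1≤n large c
  with copy? (finite-star m) c 0F | copy? (finite-fan (suc ν)) c 1F
... | yes copy | _        = inj₁ copy
... | no  _    | yes copy = inj₂ copy
... | no ¬star | no ¬fan  = ⊥-elim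
  (no-matching-absurd blue≤1 blue-sym blue-irrefl refl refl large-degree n<m large (λ v M → ¬fan (blue-fan v M)) zero)
  where
  open Classes c
  -- Fewer than m red neighbours leave at least (2m + t - 1) - (m - 1) blue ones.
  large-degree : ∀ v → m + t ≤ sum (blue v)
  large-degree v = linear 0
    (≰⇒> (λ m≤ → ¬star (red-star v m≤)) ⊞ ≡⇒≥ (trans (sym (∑-distrib-+ (blue v) (λ w → red v w + δ v w)))
       (trans (sum-cong-≗ (blue+red+δ v)) (sum-one (m + (m + t)))))
     ⊞ ≤-reflexive (∑-distrib-+ (red v) (δ v)) ⊞ ≤-reflexive (sum-δ v))
    (identity m t (sum (blue v)) (sum (red v)) (sum (λ w → red v w + δ v w)) (sum (δ v)))
    where
    identity : ∀ m t b r x y → b + (suc r + (m + (m + t) + (x + y))) ≡ m + t + (m + (b + x + (r + y + 1))) + 0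
    identity = solve-∀

open import Data.Integer.Base as ℤ using (+_)
import Data.Integer.Properties as ℤ
open import Data.Rational.Base as ℚ using (ℚ; 0ℚ; 1ℚ; ½; 1/_)
import Data.Rational.Properties as ℚ
import Data.Rational.Solver
import Data.Rational.Unnormalised.Base as ℚᵘ
import Data.Rational.Unnormalised.Properties as ℚᵘ
open Data.Rational.Solver.+-*-Solver using (_:+_; _:*_; _:-_; :-_; _:=_; con) renaming (solve to solveℚ)

-- Bounds on reals

toℚᵘ-ℕ⇒ℚ : ∀ n → ℚ.toℚᵘ (ℕ⇒ℚ n) ℚᵘ.≃ ℚᵘ.mkℚᵘ (+ n) 0
toℚᵘ-ℕ⇒ℚ n = ℚ.toℚᵘ-fromℚᵘ (ℚᵘ.mkℚᵘ (+ n) 0)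

ℕ⇒ℚ-+ : ∀ a b → ℕ⇒ℚ (a + b) ≡ ℕ⇒ℚ a ℚ.+ ℕ⇒ℚ b
ℕ⇒ℚ-+ a b = ℚ.toℚᵘ-injective (begin
  ℚ.toℚᵘ (ℕ⇒ℚ (a + b))                            ≈⟨ toℚᵘ-ℕ⇒ℚ (a + b) ⟩
  ℚᵘ.mkℚᵘ (+ (a + b)) 0
    ≈⟨ ℚᵘ.*≡* (cong (ℤ._* + 1) (sym (cong₂ ℤ._+_ (ℤ.*-identityʳ (+ a)) (ℤ.*-identityʳ (+ b))))) ⟩
  ℚᵘ.mkℚᵘ (+ a) 0 ℚᵘ.+ ℚᵘ.mkℚᵘ (+ b) 0             ≈⟨ ℚᵘ.+-cong (toℚᵘ-ℕ⇒ℚ a) (toℚᵘ-ℕ⇒ℚ b) ⟨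
  ℚ.toℚᵘ (ℕ⇒ℚ a) ℚᵘ.+ ℚ.toℚᵘ (ℕ⇒ℚ b)              ≈⟨ ℚ.toℚᵘ-homo-+ (ℕ⇒ℚ a) (ℕ⇒ℚ b) ⟨
  ℚ.toℚᵘ (ℕ⇒ℚ a ℚ.+ ℕ⇒ℚ b)                        ∎)
  where open ℚᵘ.≃-Reasoning

ℕ⇒ℚ-* : ∀ a b → ℕ⇒ℚ (a * b) ≡ ℕ⇒ℚ a ℚ.* ℕ⇒ℚ b
ℕ⇒ℚ-* a b = ℚ.toℚᵘ-injective (begin
  ℚ.toℚᵘ (ℕ⇒ℚ (a * b))                            ≈⟨ toℚᵘ-ℕ⇒ℚ (a * b) ⟩
  ℚᵘ.mkℚᵘ (+ (a * b)) 0                            ≈⟨ ℚᵘ.*≡* (cong (ℤ._* + 1) (ℤ.pos-* a b)) ⟩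
  ℚᵘ.mkℚᵘ (+ a) 0 ℚᵘ.* ℚᵘ.mkℚᵘ (+ b) 0             ≈⟨ ℚᵘ.*-cong (toℚᵘ-ℕ⇒ℚ a) (toℚᵘ-ℕ⇒ℚ b) ⟨
  ℚ.toℚᵘ (ℕ⇒ℚ a) ℚᵘ.* ℚ.toℚᵘ (ℕ⇒ℚ b)              ≈⟨ ℚ.toℚᵘ-homo-* (ℕ⇒ℚ a) (ℕ⇒ℚ b) ⟨
  ℚ.toℚᵘ (ℕ⇒ℚ a ℚ.* ℕ⇒ℚ b)                        ∎)
  where open ℚᵘ.≃-Reasoning

ℕ⇒ℚ-mono-< : ∀ {a b} → a < b → ℕ⇒ℚ a ℚ.< ℕ⇒ℚ b
ℕ⇒ℚ-mono-< {a} {b} a<b = ℚ.toℚᵘ-cancel-< (ℚᵘ.<-respˡ-≃ (ℚᵘ.≃-sym (toℚᵘ-ℕ⇒ℚ a)) (ℚᵘ.<-respʳ-≃ (ℚᵘ.≃-sym (toℚᵘ-ℕ⇒ℚ b))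
  (ℚᵘ.*<* (subst₂ ℤ._<_ (sym (ℤ.*-identityʳ (+ a))) (sym (ℤ.*-identityʳ (+ b))) (ℤ.+<+ a<b)))))

ℕ⇒ℚ-mono-≤ : ∀ {a b} → a ≤ b → ℕ⇒ℚ a ℚ.≤ ℕ⇒ℚ b
ℕ⇒ℚ-mono-≤ a≤b with m≤n⇒m<n∨m≡n a≤b
... | inj₁ a<b  = ℚ.<⇒≤ (ℕ⇒ℚ-mono-< a<b)
... | inj₂ refl = ℚ.≤-refl

<-sub : ∀ {p q r} → p ℚ.+ q ℚ.< r → q ℚ.< r ℚ.- p
<-sub {p} {q} {r} lt = subst (ℚ._< r ℚ.- p) (solveℚ 2 (λ p q → p :+ q :- p := q) refl p q) (ℚ.+-monoˡ-< (ℚ.- p) lt)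

sub-< : ∀ {p q r} → r ℚ.< p ℚ.+ q → r ℚ.- p ℚ.< q
sub-< {p} {q} {r} lt = subst (r ℚ.- p ℚ.<_) (solveℚ 2 (λ p q → p :+ q :- p := q) refl p q) (ℚ.+-monoˡ-< (ℚ.- p) lt)

p+[r-p]≡r : ∀ p r → r ≡ p ℚ.+ (r ℚ.- p)
p+[r-p]≡r = solveℚ 2 (λ p r → r := p :+ (r :- p)) refl

[r-p]+p≡r : ∀ p r → r ≡ (r ℚ.- p) ℚ.+ p
[r-p]+p≡r = solveℚ 2 (λ p r → r := (r :- p) :+ p) refl

½+½ : ∀ s → ½ ℚ.* s ℚ.+ ½ ℚ.* s ≡ s
½+½ = solveℚ 1 (λ s → con ½ :* s :+ con ½ :* s := s) refl

double-cancel-< : ∀ {p q} → p ℚ.+ p ℚ.< q ℚ.+ q → p ℚ.< q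
double-cancel-< {p} {q} lt = ℚ.≰⇒> λ q≤p → ℚ.<-irrefl refl (ℚ.<-≤-trans lt (ℚ.+-mono-≤ q≤p q≤p))

double-cancel-≤ : ∀ {p q} → p ℚ.+ p ℚ.≤ q ℚ.+ q → p ℚ.≤ q
double-cancel-≤ p+p≤q+q = ℚ.≮⇒≥ λ q<p → ℚ.<-irrefl refl (ℚ.<-≤-trans (ℚ.+-mono-< q<p q<p) p+p≤q+q)

module _ (x : ℝ) (k : ℕ) where

  upper-minus : ∀ {p r} → upper x p → p ℚ.< r ℚ.+ ℕ⇒ℚ k → upper (x -ᴿ fromℕ k) r
  upper-minus {p} {r} u lt = p , r ℚ.- p , u ,
    subst (ℚ._< ℕ⇒ℚ k) (solveℚ 2 (λ p r → p :- r := :- (r :- p)) refl p r) (sub-< lt) , p+[r-p]≡r p r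

  lower-plus : ∀ {p r} → lower x p → r ℚ.< p ℚ.+ ℕ⇒ℚ k → lower (x +ᴿ fromℕ k) r
  lower-plus {p} {r} l lt = p , r ℚ.- p , l , sub-< lt , p+[r-p]≡r p r

  upper-plus : ∀ {p r} → upper x p → p ℚ.+ ℕ⇒ℚ k ℚ.< r → upper (fromℕ k +ᴿ x) r
  upper-plus {p} {r} u lt = r ℚ.- p , p , <-sub lt , u , [r-p]+p≡r p r

  lower-plusˡ : ∀ {p r} → lower x p → r ℚ.< p ℚ.+ ℕ⇒ℚ k → lower (fromℕ k +ᴿ x) r
  lower-plusˡ {p} {r} l lt = r ℚ.- p , p , sub-< lt , l , [r-p]+p≡r p r

upper-minus-<ᴿ : ∀ x k R {p} → upper x p → p ℚ.< ℕ⇒ℚ R ℚ.+ ℕ⇒ℚ k → x -ᴿ fromℕ k <ᴿ fromℕ R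
upper-minus-<ᴿ x k R {p} u lt =
  let (q , p-k<q , q<R) = ℚ.<-dense (sub-< (subst (p ℚ.<_) (ℚ.+-comm (ℕ⇒ℚ R) (ℕ⇒ℚ k)) lt))
  in q , upper-minus x k u (subst (ℚ._< q ℚ.+ ℕ⇒ℚ k) (sym ([r-p]+p≡r (ℕ⇒ℚ k) p)) (ℚ.+-monoˡ-< (ℕ⇒ℚ k) p-k<q)) , q<R

lower-plus-<ᴿ : ∀ x k R {p} → lower x p → ℕ⇒ℚ R ℚ.< p ℚ.+ ℕ⇒ℚ k → fromℕ R <ᴿ x +ᴿ fromℕ k
lower-plus-<ᴿ x k R l lt =
  let (q , R<q , q<p+k) = ℚ.<-dense lt in q , R<q , lower-plus x k l q<p+k

upper-√-ℕ : ∀ {d y} → d < y * y → upper (√ d) (ℕ⇒ℚ y)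
upper-√-ℕ {d} {zero}  ()
upper-√-ℕ {d} {suc y} d<yy = ℕ⇒ℚ-mono-< {0} {suc y} (s≤s z≤n) , subst (ℕ⇒ℚ d ℚ.<_) (ℕ⇒ℚ-* (suc y) (suc y)) (ℕ⇒ℚ-mono-< d<yy)

lower-√-ℕ : ∀ {d y} → y * y < d → lower (√ d) (ℕ⇒ℚ y)
lower-√-ℕ {d} {y} yy<d = inj₂ (subst (ℚ._< ℕ⇒ℚ d) (ℕ⇒ℚ-* y y) (ℕ⇒ℚ-mono-< yy<d))

double-bound-≤ : ∀ M k R y → M + y ≤ 2 * (R + k) →
  ℕ⇒ℚ y ℚ.+ ℕ⇒ℚ M ℚ.≤ (ℕ⇒ℚ R ℚ.+ ℕ⇒ℚ k) ℚ.+ (ℕ⇒ℚ R ℚ.+ ℕ⇒ℚ k)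
double-bound-≤ M k R y M+y≤ = subst₂ ℚ._≤_ (trans (cong ℕ⇒ℚ (+-comm M y)) (ℕ⇒ℚ-+ y M))
    (trans (cong (λ e → ℕ⇒ℚ (R + k + e)) (+-identityʳ (R + k)))
      (trans (ℕ⇒ℚ-+ (R + k) (R + k)) (cong₂ ℚ._+_ (ℕ⇒ℚ-+ R k) (ℕ⇒ℚ-+ R k))))
    (ℕ⇒ℚ-mono-≤ M+y≤)

double-bound-≥ : ∀ M k R y → 2 * R ≤ M + 2 * k + y →
  ℕ⇒ℚ R ℚ.+ ℕ⇒ℚ R ℚ.≤ ℕ⇒ℚ y ℚ.+ ℕ⇒ℚ M ℚ.+ (ℕ⇒ℚ k ℚ.+ ℕ⇒ℚ k)
double-bound-≥ M k R y ≤M+y = subst₂ ℚ._≤_ (trans (cong (λ e → ℕ⇒ℚ (R + e)) (+-identityʳ R)) (ℕ⇒ℚ-+ R R))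
    (trans (ℕ⇒ℚ-+ (M + 2 * k) y) (trans (cong (ℚ._+ ℕ⇒ℚ y) (trans (ℕ⇒ℚ-+ M (2 * k))
       (cong (ℕ⇒ℚ M ℚ.+_) (trans (cong (λ e → ℕ⇒ℚ (k + e)) (+-identityʳ k)) (ℕ⇒ℚ-+ k k)))))
       (solveℚ 3 (λ M k y → M :+ (k :+ k) :+ y := y :+ M :+ (k :+ k)) refl (ℕ⇒ℚ M) (ℕ⇒ℚ k) (ℕ⇒ℚ y))))
    (ℕ⇒ℚ-mono-≤ ≤M+y)

-- As y lies strictly above √d, so does some p < y, and the gap between them pays for the strict
-- inequalities that the sum and the subtraction of `k` demand. The witness is ½ s because `_/2`
-- tests the double of its argument.
half-sum-< : ∀ M d k R y → M + y ≤ 2 * (R + k) → d < y * y → (fromℕ M +ᴿ √ d) /2 -ᴿ fromℕ k <ᴿ fromℕ R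
half-sum-< M d k R y M+y≤ d<yy =
  let (p , p<y , p∈)      = upper-open (√ d) (upper-√-ℕ {d} {y} d<yy)
      (s , p+M<s , s<y+M) = ℚ.<-dense (ℚ.+-monoˡ-< (ℕ⇒ℚ M) p<y)
      s≡                  = ½+½ s
  in upper-minus-<ᴿ ((fromℕ M +ᴿ √ d) /2) k R {½ ℚ.* s}
       (upper-plus (√ d) M p∈ (subst (p ℚ.+ ℕ⇒ℚ M ℚ.<_) (sym s≡) p+M<s))
       (double-cancel-< (subst (ℚ._< _) (sym s≡) (ℚ.<-≤-trans s<y+M bound)))
  where
  bound = double-bound-≤ M k R y M+y≤

half-sum-> : ∀ M d k R y → 2 * R ≤ M + 2 * k + y → y * y < d → fromℕ R <ᴿ (fromℕ M +ᴿ √ d) /2 +ᴿ fromℕ k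
half-sum-> M d k R y ≤M+y yy<d =
  let (p , y<p , p∈)      = lower-open (√ d) (lower-√-ℕ {d} {y} yy<d)
      (s , y+M<s , s<p+M) = ℚ.<-dense (ℚ.+-monoˡ-< (ℕ⇒ℚ M) y<p)
      s≡                  = ½+½ s
  in lower-plus-<ᴿ ((fromℕ M +ᴿ √ d) /2) k R {½ ℚ.* s}
       (lower-plusˡ (√ d) M p∈ (subst (ℚ._< p ℚ.+ ℕ⇒ℚ M) (sym s≡) s<p+M))
       (double-cancel-< (ℚ.≤-<-trans bound (subst (ℕ⇒ℚ y ℚ.+ ℕ⇒ℚ M ℚ.+ (ℕ⇒ℚ k ℚ.+ ℕ⇒ℚ k) ℚ.<_)
         (trans (cong (ℚ._+ (ℕ⇒ℚ k ℚ.+ ℕ⇒ℚ k)) (sym s≡))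
           (solveℚ 2 (λ h k → h :+ h :+ (k :+ k) := h :+ k :+ (h :+ k)) refl (½ ℚ.* s) (ℕ⇒ℚ k)))
         (ℚ.+-monoˡ-< (ℕ⇒ℚ k ℚ.+ ℕ⇒ℚ k) y+M<s))))
  where
  bound = double-bound-≥ M k R y ≤M+y

-- Each summand of the iterated sum takes p, and the slack r - n p is handed on to the final summand
-- 0.
upper-· : ∀ x n {p r} → upper x p → ℕ⇒ℚ n ℚ.* p ℚ.< r → upper (n ·ᴿ x) r
upper-· x zero    {p} {r} u lt = subst (ℚ._< r) (ℚ.*-zeroˡ p) lt
upper-· x (suc n) {p} {r} u lt = p , r ℚ.- p , u , upper-· x n u (<-sub (subst (ℚ._< r) suc-* lt)) , p+[r-p]≡r p r
  where
  suc-* : ℕ⇒ℚ (suc n) ℚ.* p ≡ p ℚ.+ ℕ⇒ℚ n ℚ.* p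
  suc-* = trans (cong (ℚ._* p) (ℕ⇒ℚ-+ 1 n)) (solveℚ 2 (λ n p → (con 1ℚ :+ n) :* p := p :+ n :* p) refl (ℕ⇒ℚ n) p)

lower-· : ∀ x n {p r} → lower x p → r ℚ.< ℕ⇒ℚ n ℚ.* p → lower (n ·ᴿ x) r
lower-· x zero    {p} {r} l lt = subst (r ℚ.<_) (ℚ.*-zeroˡ p) lt
lower-· x (suc n) {p} {r} l lt = p , r ℚ.- p , l , lower-· x n l (sub-< (subst (r ℚ.<_) suc-* lt)) , p+[r-p]≡r p r
  where
  suc-* : ℕ⇒ℚ (suc n) ℚ.* p ≡ p ℚ.+ ℕ⇒ℚ n ℚ.* p
  suc-* = trans (cong (ℚ._* p) (ℕ⇒ℚ-+ 1 n)) (solveℚ 2 (λ n p → (con 1ℚ :+ n) :* p := p :+ n :* p) refl (ℕ⇒ℚ n) p)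

-- With p = y / 2n, comparing p with √3 is comparing y² with 12n² = m² + 8n², m = 2n.

module Slope (n y : ℕ) (1≤n : 1 ≤ n) where
  N K Y p : ℚ
  N = ℕ⇒ℚ n
  K = ℕ⇒ℚ (2 * n)
  Y = ℕ⇒ℚ y

  0<N : 0ℚ ℚ.< N
  0<N = ℕ⇒ℚ-mono-< {0} {n} 1≤n

  0<K : 0ℚ ℚ.< K
  0<K = ℕ⇒ℚ-mono-< {0} {2 * n} (*-mono-≤ {1} {2} (s≤s z≤n) 1≤n)

  instance
    N-pos : ℚ.Positive N
    N-pos = ℚ.positive 0<N
    K-pos : ℚ.Positive K
    K-pos = ℚ.positive 0<K
    K-nonNeg : ℚ.NonNegative K
    K-nonNeg = ℚ.pos⇒nonNeg K
    K-nonZero : ℚ.NonZero K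
    K-nonZero = ℚ.pos⇒nonZero K
    KK-nonNeg : ℚ.NonNegative (K ℚ.* K)
    KK-nonNeg = ℚ.pos⇒nonNeg (K ℚ.* K) {{ℚ.pos*pos⇒pos K K}}

  p = Y ℚ.* 1/ K

  pK≡Y : p ℚ.* K ≡ Y
  pK≡Y = trans (ℚ.*-assoc Y (1/ K) K) (trans (cong (Y ℚ.*_) (ℚ.*-inverseˡ K)) (ℚ.*-identityʳ Y))

  ppKK≡yy : p ℚ.* p ℚ.* (K ℚ.* K) ≡ ℕ⇒ℚ (y * y)
  ppKK≡yy = trans (solveℚ 2 (λ p K → p :* p :* (K :* K) := (p :* K) :* (p :* K)) refl p K)
    (trans (cong₂ ℚ._*_ pK≡Y pK≡Y) (sym (ℕ⇒ℚ-* y y)))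

  3KK : ℕ⇒ℚ (3 * (2 * n * (2 * n))) ≡ ℕ⇒ℚ 3 ℚ.* (K ℚ.* K)
  3KK = trans (ℕ⇒ℚ-* 3 (2 * n * (2 * n))) (cong (ℕ⇒ℚ 3 ℚ.*_) (ℕ⇒ℚ-* (2 * n) (2 * n)))

  -- That is, n(p + 3) = (6n + y) / 2, the general bound at m = 2n with y for the square root.
  doubled : N ℚ.* (p ℚ.+ ℕ⇒ℚ 3) ℚ.+ N ℚ.* (p ℚ.+ ℕ⇒ℚ 3) ≡ Y ℚ.+ ℕ⇒ℚ (2 * n * 3)
  doubled = trans (solveℚ 3 (λ N p t → N :* (p :+ t) :+ N :* (p :+ t) := p :* (N :+ N) :+ (N :+ N) :* t) refl N p (ℕ⇒ℚ 3))
    (cong₂ ℚ._+_ (trans (cong (p ℚ.*_) (sym K≡N+N)) pK≡Y)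
      (trans (cong (ℚ._* ℕ⇒ℚ 3) (sym K≡N+N)) (sym (ℕ⇒ℚ-* (2 * n) 3))))
    where
    K≡N+N : K ≡ N ℚ.+ N
    K≡N+N = trans (cong (λ e → ℕ⇒ℚ (n + e)) (+-identityʳ n)) (ℕ⇒ℚ-+ n n)

  upper-√3 : 3 * (2 * n * (2 * n)) < y * y → upper (√ 3) p
  upper-√3 lt =
    ℚ.*-cancelʳ-<-nonNeg K (subst₂ ℚ._<_ (sym (ℚ.*-zeroˡ K)) (sym pK≡Y) (ℕ⇒ℚ-mono-< {0} {y} (positive lt))) ,
    ℚ.*-cancelʳ-<-nonNeg (K ℚ.* K) (subst₂ ℚ._<_ 3KK (sym ppKK≡yy) (ℕ⇒ℚ-mono-< lt))
    where
    positive : ∀ {a y} → a < y * y → 0 < y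
    positive {y = suc y} _ = s≤s z≤n

  lower-√3 : y * y < 3 * (2 * n * (2 * n)) → lower (√ 3) p
  lower-√3 lt = inj₂ (ℚ.*-cancelʳ-<-nonNeg (K ℚ.* K) (subst₂ ℚ._<_ (sym ppKK≡yy) 3KK (ℕ⇒ℚ-mono-< lt)))

  multiple-< : ∀ k R → 2 * n * 3 + y ≤ 2 * (R + k) → 3 * (2 * n * (2 * n)) < y * y →
    n ·ᴿ (fromℕ 3 +ᴿ √ 3) -ᴿ fromℕ k <ᴿ fromℕ R
  multiple-< k R ≤R+k lt =
    let (p′ , p′<p , p′∈)   = upper-open (√ 3) (upper-√3 lt)
        (s , p′+3<s , s<p+3) = ℚ.<-dense (ℚ.+-monoˡ-< (ℕ⇒ℚ 3) p′<p)
        (r , Ns<r , r<)      = ℚ.<-dense (ℚ.*-monoʳ-<-pos N s<p+3)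
    in upper-minus-<ᴿ (n ·ᴿ (fromℕ 3 +ᴿ √ 3)) k R
         (upper-· (fromℕ 3 +ᴿ √ 3) n (upper-plus (√ 3) 3 p′∈ p′+3<s) Ns<r)
         (ℚ.<-≤-trans r< (double-cancel-≤ (ℚ.≤-trans (ℚ.≤-reflexive doubled) (double-bound-≤ (2 * n * 3) k R y ≤R+k))))

  multiple-> : ∀ k R → 2 * R ≤ 2 * n * 3 + 2 * k + y → y * y < 3 * (2 * n * (2 * n)) →
    fromℕ R <ᴿ n ·ᴿ (fromℕ 3 +ᴿ √ 3) +ᴿ fromℕ k
  multiple-> k R R≤ lt =
    let (p′ , p<p′ , p′∈)   = lower-open (√ 3) (lower-√3 lt)
        (s , p+3<s , s<p′+3) = ℚ.<-dense (ℚ.+-monoˡ-< (ℕ⇒ℚ 3) p<p′)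
        (r , <r , r<Ns)      = ℚ.<-dense (ℚ.*-monoʳ-<-pos N p+3<s)
    in lower-plus-<ᴿ (n ·ᴿ (fromℕ 3 +ᴿ √ 3)) k R
         (lower-· (fromℕ 3 +ᴿ √ 3) n (lower-plusˡ (√ 3) 3 p′∈ s<p′+3) r<Ns)
         (ℚ.≤-<-trans (double-cancel-≤ (ℚ.≤-trans (double-bound-≥ (2 * n * 3) k R y R≤)
           (ℚ.≤-reflexive (trans (cong (ℚ._+ (ℕ⇒ℚ k ℚ.+ ℕ⇒ℚ k)) (sym doubled))
             (solveℚ 2 (λ h k → h :+ h :+ (k :+ k) := h :+ k :+ (h :+ k)) refl (N ℚ.* (p ℚ.+ ℕ⇒ℚ 3)) (ℕ⇒ℚ k))))))
           (ℚ.+-monoˡ-< (ℕ⇒ℚ k) <r))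

-- The Ramsey number between its bounds

module _ {n m : ℕ} (1≤n : 1 ≤ n) (n<m : n < m) where

  ramsey-number : ∃[ R ] IsRamseyNumber (star m) (fan n) R
  -- Any order that arrows can start the search; t = 2n satisfies 2n² ≤ (m + t)t at sight.
  ramsey-number = least (arrows? (finite-star m) (finite-fan n)) (m + (m + 2 * n))
    (arrows-upper n<m 1≤n (linear (2 * (n * n) + 2 * (m * n)) ≤-refl (identity n m)))
    where
    identity : ∀ n m → (m + 2 * n) * (2 * n) + 0 ≡ 2 * (n * n) + 0 + (2 * (n * n) + 2 * (m * n))
    identity = solve-∀

  ramsey-upper : ∀ {R} → IsRamseyNumber (star m) (fan n) R →
    ∃[ y ] 2 * R ≤ 3 * m + 2 * 1 + y × y * y < m ^ 2 + 8 * n ^ 2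
  ramsey-upper {zero} _ = 0 , z≤n , ≤-trans (*-mono-≤ 1≤m (*-mono-≤ 1≤m ≤-refl)) (m≤m+n (m ^ 2) _)
    where
    1≤m : 1 ≤ m
    1≤m = ≤-trans 1≤n (<⇒≤ n<m)
  -- Here `R` is one below the Ramsey number and does not arrow, so (m + t)t < 2n² for t = R - 2m.
  -- If R ≤ 2m, truncation makes t = 0 and the inequality only says n ≥ 1.
  ramsey-upper {suc R} (_ , minimal) = m + 2 * t ,
    linear 0 (scale 2 (m≤n+m∸n R (m + m))) (identity₁ R m t) ,
    linear 3 (scale 4 below) (identity₂ m n t)
    where
    t : ℕ
    t = R ∸ (m + m)
    below : (m + t) * t < 2 * (n * n)
    below = ≰⇒> λ large → reach large (m≤n⊎n≤m)
      where
      m≤n⊎n≤m : R ≤ m + m ⊎ m + m ≤ R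
      m≤n⊎n≤m = ≤-total R (m + m)
      reach : 2 * (n * n) ≤ (m + t) * t → R ≤ m + m ⊎ m + m ≤ R → ⊥
      reach large (inj₁ R≤2m) = contradiction
        (≤-trans (*-mono-≤ {1} {2} (s≤s z≤n) (*-mono-≤ 1≤n 1≤n)) (≤-trans large (≤-reflexive
          (trans (cong ((m + t) *_) (m≤n⇒m∸n≡0 R≤2m)) (*-zeroʳ (m + t)))))) λ ()
      reach large (inj₂ 2m≤R) = contradiction (minimal (m + (m + t)) (arrows-upper n<m 1≤n large))
        (<⇒≱ (s≤s (≤-reflexive (trans (sym (+-assoc m m t)) (m+[n∸m]≡n 2m≤R)))))
    identity₁ : ∀ R m t → 3 * m + 2 * 1 + (m + 2 * t) + 2 * R ≡ 2 * suc R + 2 * (m + m + t) + 0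
    identity₁ = solve-∀
    identity₂ : ∀ m n t → m * (m * 1) + 8 * (n * (n * 1)) + 4 * suc ((m + t) * t)
      ≡ suc ((m + 2 * t) * (m + 2 * t)) + 4 * (2 * (n * n)) + 3
    identity₂ = solve-∀

ramsey-lower : ∀ {n m R} → 2 ≤ n → n < m → IsRamseyNumber (star m) (fan n) R →
  ∃[ y ] 3 * m + y ≤ 2 * (R + 8) × m ^ 2 + 8 * n ^ 2 < y * y
ramsey-lower {suc ν} {m} {R} (s≤s 1≤ν) n<m (arrows , _) =
  let (h , avoids , far) = lower-construction 1≤ν n<m
      R>2[m+h]           = ≰⇒> λ R≤ → avoids (arrows-mono {star m} {fan (suc ν)} R≤ arrows)
  -- This y gives 3m + y = 2(2(m + h) + 9), at most 2(R + 8) since R ≥ 2(m + h) + 1.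
  in m + 2 * (2 * h + 9) ,
     linear 0 (scale 2 R>2[m+h]) (identity₁ m h R) ,
     linear 3 (scale 4 far) (identity₂ m (suc ν) h)
  where
  identity₁ : ∀ m h R → 2 * (R + 8) + 2 * suc (2 * (m + h)) ≡ 3 * m + (m + 2 * (2 * h + 9)) + 2 * R + 0
  identity₁ = solve-∀
  identity₂ : ∀ m n h → (m + 2 * (2 * h + 9)) * (m + 2 * (2 * h + 9)) + 4 * suc (2 * (n * n))
    ≡ suc (m * (m * 1) + 8 * (n * (n * 1))) + 4 * ((m + 2 * h + 9) * (2 * h + 9)) + 3
  identity₂ = solve-∀

theorem1p2 : (∀ (n m : ℕ) → 2 ≤ n → n < m →
    ∃[ R ] IsRamseyNumber (star m) (fan n) R
    × (fromℕ (3 * m) +ᴿ √ (m ^ 2 + 8 * n ^ 2)) /2 -ᴿ fromℕ 8 <ᴿ fromℕ R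
    × fromℕ R <ᴿ (fromℕ (3 * m) +ᴿ √ (m ^ 2 + 8 * n ^ 2)) /2 +ᴿ fromℕ 1)
    × (∀ (n : ℕ) → 2 ≤ n →
    ∃[ R ] IsRamseyNumber (star (2 * n)) (fan n) R
    × n ·ᴿ (fromℕ 3 +ᴿ √ 3) -ᴿ fromℕ 8 <ᴿ fromℕ R
    × fromℕ R <ᴿ n ·ᴿ (fromℕ 3 +ᴿ √ 3) +ᴿ fromℕ 1)
theorem1p2 = general , special
  where
  general : ∀ (n m : ℕ) → 2 ≤ n → n < m →
    ∃[ R ] IsRamseyNumber (star m) (fan n) R
    × (fromℕ (3 * m) +ᴿ √ (m ^ 2 + 8 * n ^ 2)) /2 -ᴿ fromℕ 8 <ᴿ fromℕ R
    × fromℕ R <ᴿ (fromℕ (3 * m) +ᴿ √ (m ^ 2 + 8 * n ^ 2)) /2 +ᴿ fromℕ 1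
  general n m 2≤n n<m =
    let 1≤n             = <⇒≤ 2≤n
        (R , R-ramsey)  = ramsey-number 1≤n n<m
        (y , y-≤ , d<y) = ramsey-lower 2≤n n<m R-ramsey
        (z , ≤-z , z<d) = ramsey-upper 1≤n n<m R-ramsey
        d               = m ^ 2 + 8 * n ^ 2
    in R , R-ramsey , half-sum-< (3 * m) d 8 R y y-≤ d<y , half-sum-> (3 * m) d 1 R z ≤-z z<d

  special : ∀ (n : ℕ) → 2 ≤ n →
    ∃[ R ] IsRamseyNumber (star (2 * n)) (fan n) R
    × n ·ᴿ (fromℕ 3 +ᴿ √ 3) -ᴿ fromℕ 8 <ᴿ fromℕ R
    × fromℕ R <ᴿ n ·ᴿ (fromℕ 3 +ᴿ √ 3) +ᴿ fromℕ 1
  special n 2≤n =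
    let 1≤n             = <⇒≤ 2≤n
        n<2n            = m<m+n n (≤-trans 1≤n (m≤m+n n 0))
        (R , R-ramsey)  = ramsey-number 1≤n n<2n
        (y , y-≤ , d<y) = ramsey-lower 2≤n n<2n R-ramsey
        (z , ≤-z , z<d) = ramsey-upper 1≤n n<2n R-ramsey
    in R , R-ramsey ,
       Slope.multiple-< n y 1≤n 8 R (subst (λ M → M + y ≤ 2 * (R + 8)) (*-comm 3 (2 * n)) y-≤)
         (subst (_< y * y) (discriminant n) d<y) ,
       Slope.multiple-> n z 1≤n 1 R (subst (λ M → 2 * R ≤ M + 2 * 1 + z) (*-comm 3 (2 * n)) ≤-z)
         (subst (z * z <_) (discriminant n) z<d)
    where
    discriminant : ∀ n → 2 * n * (2 * n * 1) + 8 * (n * (n * 1)) ≡ 3 * (2 * n * (2 * n))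
    discriminant = solve-∀
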